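{- Let $p_{\{3,3\}}(n)$ denote the number of $3$-regular partitions of $n$ in three colours, i.e. the integers defined by the formal power series identity $$\sum_{n=0}^{\infty}p_{\{3,3\}}(n)q^n=\prod_{j=1}^{\infty}\frac{(1-q^{3j})^3}{(1-q^{j})^3}.$$ Then for all integers $n\geq 0$, \begin{align*} p_{\{3,3\}}(15n+6)&\equiv 0 \pmod{5},\\ p_{\{3,3\}}(25n+6)&\equiv 0 \pmod{5},\\ p_{\{3,3\}}(25n+16)&\equiv 0 \pmod{5},\\ p_{\{3,3\}}(25n+21)&\equiv 0 \pmod{5}. \end{align*}
   Context: A partition of a positive integer $n$ is a non-increasing sequence of positive integers, called parts, whose sum is $n$. For a positive integer $\ell$, an $\ell$-regular partition is a partition none of whose parts is divisible by $\ell$. $p_{\{3,3\}}(n)$ is the number of $3$-regular partitions of $n$ in which each part may appear in any of three colours; its generating function is $f_3^3/f_1^3$, where $f_k=(q^k;q^k)_\infty=\prod_{j=1}^{\infty}(1-q^{jk})$ for a positive integer $k$. -}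

module Defs where

open import Data.Bool.Base using (Bool; T; true; false; if_then_else_)
open import Data.Fin.Base using (Fin; zero; suc; toℕ)
open import Data.Fin.Properties using (toℕ<n)
open import Data.Integer.Base using (ℤ; _+_; _*_; _-_; -_; 0ℤ; 1ℤ)
import Data.Integer.Properties as ℤ
open import Data.Nat.Base as ℕ using (ℕ; zero; suc; _∸_; _≡ᵇ_; _<ᵇ_; _≤_; _<_; z≤n; s≤s)
import Data.Nat.Properties as ℕ
open import Data.Nat.Divisibility using (_∣_; _∣?_; _∣0; >⇒∤; ∣m∸n∣n⇒∣m; ∣m+n∣m⇒∣n; ∣-refl)
open import Data.Product.Base using (∃; _,_)
open import Function.Base using (_∘_)
open import Function.Bundles using (mk⇔)
open import Relation.Nullary.Decidable using (does; does-⇔; dec-true; dec-false)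
open import Relation.Binary.PropositionalEquality
  using (_≡_; _≗_; refl; sym; trans; cong; cong₂; subst)

open import Algebra.Properties.CommutativeMonoid.Sum ℤ.+-0-commutativeMonoid
  using (sum; sum-syntax; sum-cong-≗; sum-replicate-zero)

------------------------------------------------------------------------
-- Formal power series over ℤ, as coefficient sequences. Equality of
-- series is pointwise, _≗_.

Series : Set
Series = ℕ → ℤ

infixl 7 _⊛_
infixr 8 _^_
infix  9 1-q^_

[_] : Bool → ℤ
[ b ] = if b then 1ℤ else 0ℤ

1ˢ : Series
1ˢ n = [ n ≡ᵇ 0 ]

_⊛_ : Series → Series → Series
(a ⊛ b) n = ∑[ i < suc n ] (a (toℕ i) * b (n ∸ toℕ i))

_^_ : Series → ℕ → Series
a ^ zero  = 1ˢ
a ^ suc m = a ⊛ a ^ m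

1-q^_ : ℕ → Series
(1-q^ k) n = [ n ≡ᵇ 0 ] - [ n ≡ᵇ k ]

-- The geometric series 1 + q^k + q^2k + ⋯, for k ≥ 1; see `inverse`.
1/[1-q^_] : ℕ → Series
1/[1-q^ k ] n = [ does (k ∣? n) ]

-- a 1 ⋯ a N; the index starts at 1.
partialProduct : (ℕ → Series) → ℕ → Series
partialProduct a zero    = 1ˢ
partialProduct a (suc N) = a (suc N) ⊛ partialProduct a N

-- P is the formal infinite product ∏_{j ≥ 1} a j: each coefficient of
-- the partial products is eventually constant, equal to that of P.
_IsInfiniteProductOf_ : Series → (ℕ → Series) → Set
P IsInfiniteProductOf a = ∀ n → ∃ λ N₀ → ∀ N → N₀ ≤ N → partialProduct a N n ≡ P n

-- (1 - q^3j)³ / (1 - q^j)³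
factor : ℕ → Series
factor j = (1-q^ (3 ℕ.* j)) ^ 3 ⊛ 1/[1-q^ j ] ^ 3

-- Since factor j ≡ 1 modulo q^j, the factors with j > n do not affect
-- the coefficient of q^n, so it may be read off from the n-th partial
-- product; `p₃₃-isInfiniteProduct` shows that this is the infinite
-- product.
p₃₃ : ℕ → ℤ
p₃₃ n = partialProduct factor n n

------------------------------------------------------------------------
-- 1/[1-q^ k ] is the multiplicative inverse of 1-q^ k

private
  sum-zero : ∀ {m} (t : Fin m → ℤ) → (∀ i → t i ≡ 0ℤ) → sum t ≡ 0ℤ
  sum-zero {m} t t≡0 = trans (sum-cong-≗ t≡0) (sum-replicate-zero m)

  sum-select : ∀ m k (f : ℕ → ℤ) →
    ∑[ i < m ] ((0ℤ - [ toℕ i ≡ᵇ k ]) * f (toℕ i)) ≡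
    (if k <ᵇ m then - f k else 0ℤ)
  sum-select zero    k       f = refl
  sum-select (suc m) zero    f =
    trans (cong₂ _+_ (ℤ.-1*i≡-i (f 0)) (sum-zero {m} _ λ _ → refl))
          (ℤ.+-identityʳ (- f 0))
  sum-select (suc m) (suc k) f =
    trans (ℤ.+-identityˡ _) (sum-select m k (f ∘ suc))

inverse : ∀ k → 1-q^ suc k ⊛ 1/[1-q^ suc k ] ≗ 1ˢ
inverse k n = trans
  (cong₂ _+_ (ℤ.*-identityˡ (g n)) (sum-select n k (λ i → g (n ∸ suc i))))
  (cancel n)
  where
  g : Series
  g = 1/[1-q^ suc k ]

  cancel : ∀ n → g n + (if k <ᵇ n then - g (n ∸ suc k) else 0ℤ) ≡ 1ˢ n
  cancel zero    = cong (λ b → [ b ] + 0ℤ) (dec-true (suc k ∣? 0) (suc k ∣0))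
  cancel (suc n) with k <ᵇ suc n in eq
  ... | true  = trans (cong (λ b → [ b ] - g (n ∸ k)) same) (ℤ.+-inverseʳ (g (n ∸ k)))
    where
    k<n : suc k ≤ suc n
    k<n = ℕ.<ᵇ⇒< k (suc n) (subst T (sym eq) _)
    same : does (suc k ∣? suc n) ≡ does (suc k ∣? (n ∸ k))
    same = does-⇔ (mk⇔ (λ d → ∣m+n∣m⇒∣n (subst (suc k ∣_) (sym (ℕ.m+[n∸m]≡n k<n)) d) ∣-refl)
                       (λ d → ∣m∸n∣n⇒∣m (suc k) k<n d ∣-refl))
                 (suc k ∣? suc n) (suc k ∣? (n ∸ k))
  ... | false = cong (λ b → [ b ] + 0ℤ) (dec-false (suc k ∣? suc n) (>⇒∤ n<k))
    where
    n<k : suc n < suc k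
    n<k = s≤s (ℕ.≮⇒≥ λ lt → subst T eq (ℕ.<⇒<ᵇ lt))

------------------------------------------------------------------------
-- Convergence of the product

private
  infix 4 _≈[_]_

  _≈[_]_ : Series → ℕ → Series → Set
  a ≈[ j ] b = ∀ i → i < j → a i ≡ b i

  ⊛-cong : ∀ {j a a′ b b′} → a ≈[ j ] a′ → b ≈[ j ] b′ → a ⊛ b ≈[ j ] a′ ⊛ b′
  ⊛-cong a≈a′ b≈b′ n n<j = sum-cong-≗ {suc n} λ i → cong₂ _*_
    (a≈a′ (toℕ i) (ℕ.≤-trans (toℕ<n i) n<j))
    (b≈b′ (n ∸ toℕ i) (ℕ.≤-<-trans (ℕ.m∸n≤m n (toℕ i)) n<j))

  ⊛-identityˡ : ∀ a → 1ˢ ⊛ a ≗ a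
  ⊛-identityˡ a n =
    trans (cong₂ _+_ (ℤ.*-identityˡ (a n)) (sum-zero {n} _ λ _ → refl))
          (ℤ.+-identityʳ (a n))

  ⊛-one : ∀ {j a b} → a ≈[ j ] 1ˢ → b ≈[ j ] 1ˢ → a ⊛ b ≈[ j ] 1ˢ
  ⊛-one a≈1 b≈1 i i<j = trans (⊛-cong a≈1 b≈1 i i<j) (⊛-identityˡ 1ˢ i)

  ^-one : ∀ {j a} m → a ≈[ j ] 1ˢ → a ^ m ≈[ j ] 1ˢ
  ^-one zero    a≈1 = λ _ _ → refl
  ^-one (suc m) a≈1 = ⊛-one a≈1 (^-one m a≈1)

  1-q^-one : ∀ {j} k → j ≤ k → 1-q^ k ≈[ j ] 1ˢ
  1-q^-one k j≤k i i<j with i ≡ᵇ k in eq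
  ... | false = ℤ.+-identityʳ _
  ... | true  with refl ← ℕ.≡ᵇ⇒≡ i k (subst T (sym eq) _)
              with () ← ℕ.<⇒≱ i<j j≤k

  1/[1-q^]-one : ∀ j → 1/[1-q^ j ] ≈[ j ] 1ˢ
  1/[1-q^]-one j zero    _   = cong [_] (dec-true (j ∣? 0) (j ∣0))
  1/[1-q^]-one j (suc i) i<j = cong [_] (dec-false (j ∣? suc i) (>⇒∤ i<j))

  factor-one : ∀ j → factor j ≈[ j ] 1ˢ
  factor-one j = ⊛-one (^-one 3 (1-q^-one (3 ℕ.* j) (ℕ.m≤m+n j _)))
                       (^-one 3 (1/[1-q^]-one j))

  stable : ∀ n d → partialProduct factor (d ℕ.+ n) n ≡ p₃₃ n
  stable n zero    = refl
  stable n (suc d) = trans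
    (⊛-cong {b = P} {b′ = P} (factor-one (suc (d ℕ.+ n))) (λ _ _ → refl) n (s≤s (ℕ.m≤n+m n d)))
    (trans (⊛-identityˡ P n) (stable n d))
    where
    P : Series
    P = partialProduct factor (d ℕ.+ n)

p₃₃-isInfiniteProduct : p₃₃ IsInfiniteProductOf factor
p₃₃-isInfiniteProduct n = n , λ N n≤N →
  subst (λ M → partialProduct factor M n ≡ p₃₃ n) (ℕ.m∸n+n≡m n≤N) (stable n (N ∸ n))

{-# OPTIONS --safe #-}
module Submission where

-- Write f = (q; q)_∞. Modulo 5 one has f(q)⁵ ≡ f(q⁵), hence f(q⁵) Σ p₃₃(n) qⁿ ≡ f(q)² f(q³)³.
-- By the identities of Euler and Jacobi the right-hand side is a theta series of the form
-- x² + y² + 9z² with weight z. On the exponents ≡ 1 modulo 5 either the weight vanishes or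
-- exactly one of x, y is divisible by 5 and the other one is ≡ ± z; dividing, say, y + 3iz
-- by 2 + i in ℤ[i] and cancelling a factor f(q) gives
--   Σ p₃₃(5m+1) qᵐ ≡ 3 f(q⁵) A(q),   A(q) = Σ (-1)ˢ (6s+1) q^(s(3s+1)/2).
-- Modulo 5, the coefficients of A are supported on the exponents ≡ 0, 2 modulo 5. Moreover
-- f(q⁵) A(q) is a theta series of the form u² + 5w² with weight u, and the exponents ≡ 1
-- modulo 3 admit an isometric involution with u ↦ -u modulo 5, so these coefficients cancel.

open import Defs
open import Algebra.Bundles using (CommutativeRing)
import Algebra.Solver.Ring as RingSolver
open import Algebra.Solver.Ring.AlmostCommutativeRing
  using (fromCommutativeRing; _-Raw-AlmostCommutative⟶_)
open import Algebra.Structures using (IsCommutativeRing)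
open import Data.Bool.Base using (T; true; false)
open import Data.Fin.Base as Fin using (Fin; toℕ; fromℕ<)
open import Data.Fin.Properties using (all?; toℕ-fromℕ<)
open import Data.Integer.Base as ℤ using (ℤ; +_; -[1+_]; 0ℤ; 1ℤ; -1ℤ)
open import Data.Integer.Divisibility using (_∣_)
import Data.Integer.Divisibility.Signed as Signed
import Data.Integer.DivMod as DivMod
import Data.Integer.Properties as ℤ
open import Data.Integer.Tactic.RingSolver using (solve-∀)
open import Data.List.Base as List using (List; []; _∷_)
open import Data.List.Membership.Propositional using (_∈_)
open import Data.List.Membership.Propositional.Properties using (∈-cartesianProduct⁺)
open import Data.List.Relation.Unary.All as All using ([]; _∷_)
open import Data.List.Relation.Unary.AllPairs using ([]; _∷_)
open import Data.List.Relation.Unary.Any using (here; there)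
open import Data.List.Relation.Unary.Unique.Propositional using (Unique)
import Data.List.Relation.Unary.Unique.Propositional.Properties as Unique
open import Data.Maybe.Base using (Maybe; just; nothing)
open import Data.Nat.Base as ℕ using (ℕ; zero; suc; _+_; _*_; _≤_; _<_; z≤n; s≤s)
import Data.Nat.Properties as ℕ
import Data.Nat.Solver
open import Data.Product.Base using (_×_; _,_; ∃; proj₁; proj₂)
open import Data.Sum.Base as Sum using (_⊎_; inj₁; inj₂)
open import Data.Vec.Base using (lookup; []; _∷_)
open import Function.Base using (_∘_; id)
open import Level using (0ℓ)
open import Relation.Binary.Bundles using (Setoid)
open import Relation.Binary.PropositionalEquality
  using (_≡_; _≢_; _≗_; refl; sym; trans; cong; cong₂; subst; module ≡-Reasoning)
import Relation.Binary.Reasoning.Setoid as SetoidReasoning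
open import Relation.Nullary using (Dec; yes; no; ¬_; contradiction)
open import Relation.Nullary.Decidable using (map′; toWitness; _⊎-dec_; _→-dec_)

-- Completing squares: 24 `pent a` + 1 = (6a+1)² and 8 `triℤ k` + 1 = (2k+1)². So an exponent e of
-- f(q)² f(q³)³ satisfies 24e + 11 = x² + y² + 9z² with x = 6a+1, y = 6b+1, z = 2k+1, and e ≡ 1
-- modulo 5 is the class in which this form vanishes modulo 5. Since 9 ≡ -1, the condition y² ≡ z²
-- says that 5 divides the norm of y + 3iz, and the sign of z decides between the divisors 2 + i and
-- 2 - i. For e = 5m+1, writing x = -5w and y + 3iz = (2 + i)(u + iv) leaves 24m + 7 = u² + v² +
-- 5w², the exponents of f(q)² f(q⁵), but with weight z = (u + 2v)/3. The symmetry between u and v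
-- replaces this weight by u, and only then does a factor f(q) split off. The symmetries act on
-- infinite index sets, while series are compared modulo q^(N+1). To reconcile the two, a
-- coefficient is a sum over any duplicate-free list containing the support, and residue classes of
-- indices are selected by the factor 1 - x⁴.

module Nat = Data.Nat.Solver.+-*-Solver

-- Congruence modulo 5

infix 4 _≈_

-- Keeping the quotient explicit reduces each congruence rule to a polynomial identity over ℤ, which
-- the ring solver proves.
record _≈_ (x y : ℤ) : Set where
  constructor mod
  field
    quotient : ℤ
    equality : x ≡ y ℤ.+ quotient ℤ.* + 5

≈-reflexive : ∀ {x y} → x ≡ y → x ≈ y
≈-reflexive {x} refl = mod 0ℤ (sym (ℤ.+-identityʳ x))

≈-refl : ∀ {x} → x ≈ x
≈-refl = ≈-reflexive refl

≈-sym : ∀ {x y} → x ≈ y → y ≈ x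
≈-sym {y = y} (mod k refl) = mod (ℤ.- k) (identity y k)
  where
  identity : ∀ y k → y ≡ (y ℤ.+ k ℤ.* + 5) ℤ.+ (ℤ.- k) ℤ.* + 5
  identity = solve-∀

≈-trans : ∀ {x y z} → x ≈ y → y ≈ z → x ≈ z
≈-trans {z = z} (mod k refl) (mod l refl) = mod (k ℤ.+ l) (identity z k l)
  where
  identity : ∀ z k l → (z ℤ.+ l ℤ.* + 5) ℤ.+ k ℤ.* + 5 ≡ z ℤ.+ (k ℤ.+ l) ℤ.* + 5
  identity = solve-∀

+-cong : ∀ {x x′ y y′} → x ≈ x′ → y ≈ y′ → x ℤ.+ y ≈ x′ ℤ.+ y′
+-cong {x′ = x} {y′ = y} (mod k refl) (mod l refl) = mod (k ℤ.+ l) (identity x y k l)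
  where
  identity : ∀ x y k l → (x ℤ.+ k ℤ.* + 5) ℤ.+ (y ℤ.+ l ℤ.* + 5) ≡
                         (x ℤ.+ y) ℤ.+ (k ℤ.+ l) ℤ.* + 5
  identity = solve-∀

*-cong : ∀ {x x′ y y′} → x ≈ x′ → y ≈ y′ → x ℤ.* y ≈ x′ ℤ.* y′
*-cong {x′ = x} {y′ = y} (mod k refl) (mod l refl) =
  mod (x ℤ.* l ℤ.+ k ℤ.* y ℤ.+ k ℤ.* l ℤ.* + 5) (identity x y k l)
  where
  identity : ∀ x y k l → (x ℤ.+ k ℤ.* + 5) ℤ.* (y ℤ.+ l ℤ.* + 5) ≡
             x ℤ.* y ℤ.+ (x ℤ.* l ℤ.+ k ℤ.* y ℤ.+ k ℤ.* l ℤ.* + 5) ℤ.* + 5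
  identity = solve-∀

-‿cong : ∀ {x y} → x ≈ y → ℤ.- x ≈ ℤ.- y
-‿cong {y = y} (mod k refl) = mod (ℤ.- k) (identity y k)
  where
  identity : ∀ y k → ℤ.- (y ℤ.+ k ℤ.* + 5) ≡ ℤ.- y ℤ.+ (ℤ.- k) ℤ.* + 5
  identity = solve-∀

≈-setoid : Setoid 0ℓ 0ℓ
≈-setoid = record
  { Carrier       = ℤ
  ; _≈_           = _≈_
  ; isEquivalence = record { refl = ≈-refl ; sym = ≈-sym ; trans = ≈-trans }
  }

module ≈-Reasoning = SetoidReasoning ≈-setoid

≈0⇒∣ : ∀ {x} → x ≈ 0ℤ → + 5 ∣ x
≈0⇒∣ (mod k refl) = Signed.∣⇒∣ᵤ (Signed.divides k (ℤ.+-identityˡ (k ℤ.* + 5)))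

-- The ring of formal power series modulo 5

infix  4 _≋_
infixl 6 _⊕_
infixl 7 _⊗_
infixr 8 _·_
infix  9 ⊖_

record _≋_ (a b : Series) : Set where
  constructor pointwise
  field
    at : ∀ n → a n ≈ b n

open _≋_

0ˢ : Series
0ˢ _ = 0ℤ

tail : Series → Series
tail a n = a (suc n)

-- Opaque, so that unification does not unfold the operations into their coefficients.
opaque
  _⊕_ : Series → Series → Series
  (a ⊕ b) n = a n ℤ.+ b n

  ⊖_ : Series → Series
  (⊖ a) n = ℤ.- a n

  _·_ : ℤ → Series → Series
  (c · a) n = c ℤ.* a n

  _⊗_ : Series → Series → Series
  a ⊗ b = a ⊛ b

≋-setoid : Setoid 0ℓ 0ℓ
≋-setoid = record
  { Carrier       = Series
  ; _≈_           = _≋_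
  ; isEquivalence = record
    { refl  = pointwise λ _ → ≈-refl
    ; sym   = λ p → pointwise λ n → ≈-sym (at p n)
    ; trans = λ p q → pointwise λ n → ≈-trans (at p n) (at q n)
    }
  }

module ≋-Reasoning = SetoidReasoning ≋-setoid

≗⇒≋ : ∀ {a b} → a ≗ b → a ≋ b
≗⇒≋ p = pointwise λ n → ≈-reflexive (p n)

opaque
  unfolding _⊗_

  -- A coefficient of a product involves only coefficients of equal or lower order; this is what
  -- allows congruences modulo q^N to be multiplied.
  ⊗-cong-< : ∀ {a a′ b b′} n → (∀ i → i ≤ n → a i ≈ a′ i) → (∀ i → i ≤ n → b i ≈ b′ i) →
             (a ⊗ b) n ≈ (a′ ⊗ b′) n
  ⊗-cong-< zero    p q = +-cong (*-cong (p 0 z≤n) (q 0 z≤n)) ≈-refl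
  ⊗-cong-< (suc n) p q = +-cong
    (*-cong (p 0 z≤n) (q (suc n) ℕ.≤-refl))
    (⊗-cong-< n (λ i i≤n → p (suc i) (s≤s i≤n)) (λ i i≤n → q i (ℕ.m≤n⇒m≤1+n i≤n)))

  ⊗-cong : ∀ {a a′ b b′} → a ≋ a′ → b ≋ b′ → a ⊗ b ≋ a′ ⊗ b′
  ⊗-cong p q = pointwise λ n → ⊗-cong-< n (λ i _ → at p i) (λ i _ → at q i)

  ⊗-distribˡ : ∀ a b c → a ⊗ (b ⊕ c) ≗ a ⊗ b ⊕ a ⊗ c
  ⊗-distribˡ a b c zero    = identity (a 0) (b 0) (c 0)
    where
    identity : ∀ x y z → x ℤ.* (y ℤ.+ z) ℤ.+ 0ℤ ≡ (x ℤ.* y ℤ.+ 0ℤ) ℤ.+ (x ℤ.* z ℤ.+ 0ℤ)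
    identity = solve-∀
  ⊗-distribˡ a b c (suc n) = trans
    (cong₂ ℤ._+_ {x = a 0 ℤ.* (b (suc n) ℤ.+ c (suc n))} refl (⊗-distribˡ (tail a) b c n))
    (identity (a 0) (b (suc n)) (c (suc n)) ((tail a ⊗ b) n) ((tail a ⊗ c) n))
    where
    identity : ∀ x y z u v → x ℤ.* (y ℤ.+ z) ℤ.+ (u ℤ.+ v) ≡ (x ℤ.* y ℤ.+ u) ℤ.+ (x ℤ.* z ℤ.+ v)
    identity = solve-∀

  ·-⊗ : ∀ c a b → (c · a) ⊗ b ≗ c · (a ⊗ b)
  ·-⊗ c a b zero    = identity c (a 0) (b 0)
    where
    identity : ∀ x y z → (x ℤ.* y) ℤ.* z ℤ.+ 0ℤ ≡ x ℤ.* (y ℤ.* z ℤ.+ 0ℤ)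
    identity = solve-∀
  ·-⊗ c a b (suc n) = trans
    (cong₂ ℤ._+_ {x = (c ℤ.* a 0) ℤ.* b (suc n)} refl (·-⊗ c (tail a) b n))
    (identity c (a 0) (b (suc n)) ((tail a ⊗ b) n))
    where
    identity : ∀ x y z u → (x ℤ.* y) ℤ.* z ℤ.+ x ℤ.* u ≡ x ℤ.* (y ℤ.* z ℤ.+ u)
    identity = solve-∀

  -- The convolution unfolds at the leading coefficient of the left factor; splitting it at the
  -- right factor as well gives commutativity by induction.
  ⊗-sucʳ : ∀ a b n → (a ⊗ b) (suc n) ≡ (a ⊗ tail b) n ℤ.+ a (suc n) ℤ.* b 0
  ⊗-sucʳ a b zero    = identity (a 0 ℤ.* b 1) (a 1 ℤ.* b 0)
    where
    identity : ∀ x y → x ℤ.+ (y ℤ.+ 0ℤ) ≡ (x ℤ.+ 0ℤ) ℤ.+ y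
    identity = solve-∀
  ⊗-sucʳ a b (suc n) = trans
    (cong₂ ℤ._+_ {x = a 0 ℤ.* b (suc (suc n))} refl (⊗-sucʳ (tail a) b n))
    (sym (ℤ.+-assoc (a 0 ℤ.* b (suc (suc n))) ((tail a ⊗ tail b) n) _))

  ⊗-comm : ∀ a b → a ⊗ b ≗ b ⊗ a
  ⊗-comm a b zero    = cong (ℤ._+ 0ℤ) (ℤ.*-comm (a 0) (b 0))
  ⊗-comm a b (suc n) = trans
    (cong₂ ℤ._+_ (ℤ.*-comm (a 0) (b (suc n))) (⊗-comm (tail a) b n))
    (trans (ℤ.+-comm (b (suc n) ℤ.* a 0) _) (sym (⊗-sucʳ b a n)))

  ⊗-distribʳ : ∀ c a b → (a ⊕ b) ⊗ c ≗ a ⊗ c ⊕ b ⊗ c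
  ⊗-distribʳ c a b n = trans (⊗-comm (a ⊕ b) c n)
    (trans (⊗-distribˡ c a b n) (cong₂ ℤ._+_ (⊗-comm c a n) (⊗-comm c b n)))

  ⊗-assoc : ∀ a b c → (a ⊗ b) ⊗ c ≗ a ⊗ (b ⊗ c)
  ⊗-assoc a b c zero    = identity (a 0) (b 0) (c 0)
    where
    identity : ∀ x y z → (x ℤ.* y ℤ.+ 0ℤ) ℤ.* z ℤ.+ 0ℤ ≡ x ℤ.* (y ℤ.* z ℤ.+ 0ℤ) ℤ.+ 0ℤ
    identity = solve-∀
  ⊗-assoc a b c (suc n) = trans
    (cong₂ ℤ._+_ {x = (a 0 ℤ.* b 0 ℤ.+ 0ℤ) ℤ.* c (suc n)} refl
      (trans (⊗-distribʳ c (a 0 · tail b) (tail a ⊗ b) n)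
             (cong₂ ℤ._+_ (·-⊗ (a 0) (tail b) c n) (⊗-assoc (tail a) b c n))))
    (identity (a 0) (b 0) (c (suc n)) ((tail b ⊗ c) n) ((tail a ⊗ (b ⊗ c)) n))
    where
    identity : ∀ x y z u v → (x ℤ.* y ℤ.+ 0ℤ) ℤ.* z ℤ.+ (x ℤ.* u ℤ.+ v) ≡
                             x ℤ.* (y ℤ.* z ℤ.+ u) ℤ.+ v
    identity = solve-∀

  ⊗-zeroˡ : ∀ a → 0ˢ ⊗ a ≗ 0ˢ
  ⊗-zeroˡ a zero    = refl
  ⊗-zeroˡ a (suc n) = trans (ℤ.+-identityˡ _) (⊗-zeroˡ a n)

  ⊗-identityˡ : ∀ a → 1ˢ ⊗ a ≗ a
  ⊗-identityˡ a zero    = trans (ℤ.+-identityʳ _) (ℤ.*-identityˡ (a 0))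
  ⊗-identityˡ a (suc n) = trans (cong₂ ℤ._+_ (ℤ.*-identityˡ (a (suc n))) (⊗-zeroˡ a n))
                                (ℤ.+-identityʳ (a (suc n)))

  ⊗-identityʳ : ∀ a → a ⊗ 1ˢ ≗ a
  ⊗-identityʳ a n = trans (⊗-comm a 1ˢ n) (⊗-identityˡ a n)

  isCommutativeRing : IsCommutativeRing _≋_ _⊕_ _⊗_ ⊖_ 0ˢ 1ˢ
  isCommutativeRing = record
    { isRing = record
      { +-isAbelianGroup = record
        { isGroup = record
          { isMonoid = record
            { isSemigroup = record
              { isMagma = record
                { isEquivalence = Setoid.isEquivalence ≋-setoid
                ; ∙-cong = λ p q → pointwise λ n → +-cong (at p n) (at q n)
                }
              ; assoc = λ a b c → ≗⇒≋ λ n → ℤ.+-assoc (a n) (b n) (c n)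
              }
            ; identity = (λ a → ≗⇒≋ λ n → ℤ.+-identityˡ (a n))
                       , (λ a → ≗⇒≋ λ n → ℤ.+-identityʳ (a n))
            }
          ; inverse = (λ a → ≗⇒≋ λ n → ℤ.+-inverseˡ (a n))
                    , (λ a → ≗⇒≋ λ n → ℤ.+-inverseʳ (a n))
          ; ⁻¹-cong = λ p → pointwise λ n → -‿cong (at p n)
          }
        ; comm = λ a b → ≗⇒≋ λ n → ℤ.+-comm (a n) (b n)
        }
      ; *-cong = ⊗-cong
      ; *-assoc = λ a b c → ≗⇒≋ (⊗-assoc a b c)
      ; *-identity = (λ a → ≗⇒≋ (⊗-identityˡ a)) , (λ a → ≗⇒≋ (⊗-identityʳ a))
      ; distrib = (λ a b c → ≗⇒≋ (⊗-distribˡ a b c)) , (λ a b c → ≗⇒≋ (⊗-distribʳ a b c))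
      }
    ; *-comm = λ a b → ≗⇒≋ (⊗-comm a b)
    }

seriesRing : CommutativeRing 0ℓ 0ℓ
seriesRing = record
  { Carrier = Series ; _≈_ = _≋_ ; _+_ = _⊕_ ; _*_ = _⊗_ ; -_ = ⊖_ ; 0# = 0ˢ ; 1# = 1ˢ
  ; isCommutativeRing = isCommutativeRing
  }

open CommutativeRing seriesRing using ()
  renaming (refl to ≋-refl; sym to ≋-sym; trans to ≋-trans; +-cong to ⊕-cong; -‿cong to ⊖-cong;
            +-identityˡ to ⊕-identityˡ; +-identityʳ to ⊕-identityʳ)

opaque
  unfolding _⊗_

  constant-+ : ∀ x y → (x ℤ.+ y) · 1ˢ ≋ x · 1ˢ ⊕ y · 1ˢ
  constant-+ x y = ≗⇒≋ λ n → ℤ.*-distribʳ-+ (1ˢ n) x y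

  constant-* : ∀ x y → (x ℤ.* y) · 1ˢ ≋ x · 1ˢ ⊗ y · 1ˢ
  constant-* x y = ≗⇒≋ λ n → begin
    x ℤ.* y ℤ.* 1ˢ n          ≡⟨ ℤ.*-assoc x y (1ˢ n) ⟩
    x ℤ.* (y · 1ˢ) n          ≡⟨ cong (x ℤ.*_) (sym (⊗-identityˡ (y · 1ˢ) n)) ⟩
    x ℤ.* (1ˢ ⊗ y · 1ˢ) n     ≡⟨ sym (·-⊗ x 1ˢ (y · 1ˢ) n) ⟩
    (x · 1ˢ ⊗ y · 1ˢ) n       ∎
    where open ≡-Reasoning

  constant-neg : ∀ x → (ℤ.- x) · 1ˢ ≋ ⊖ (x · 1ˢ)
  constant-neg x = ≗⇒≋ λ n → sym (ℤ.neg-distribˡ-* x (1ˢ n))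

  1·≋ : ∀ a → 1ℤ · a ≋ a
  1·≋ a = ≗⇒≋ λ n → ℤ.*-identityˡ (a n)

  0·≋ : ∀ a → 0ℤ · a ≋ 0ˢ
  0·≋ a = ≗⇒≋ λ n → ℤ.*-zeroˡ (a n)

  ·≋⊗ : ∀ c a → c · a ≋ (c · 1ˢ) ⊗ a
  ·≋⊗ c a = ≗⇒≋ λ n →
    trans (cong (c ℤ.*_) (sym (⊗-identityˡ a n))) (sym (·-⊗ c 1ˢ a n))

-- The values 0ˢ and 1ˢ are singled out so that they can be written as literals in
-- equations given to the solver.
constant : ℤ → Series
constant (+ 0) = 0ˢ
constant (+ 1) = 1ˢ
constant x     = x · 1ˢ

constant≋ : ∀ x → constant x ≋ x · 1ˢ
constant≋ (+ 0)                 = ≋-sym (0·≋ 1ˢ)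
constant≋ (+ 1)                 = ≋-sym (1·≋ 1ˢ)
constant≋ (+ ℕ.suc (ℕ.suc _))   = ≋-refl
constant≋ -[1+ _ ]              = ≋-refl

constantMorphism : CommutativeRing.rawRing ℤ.+-*-commutativeRing
                   -Raw-AlmostCommutative⟶ fromCommutativeRing seriesRing
constantMorphism = record
  { ⟦_⟧    = constant
  ; +-homo = λ x y → ≋-trans (constant≋ (x ℤ.+ y)) (≋-trans (constant-+ x y)
               (≋-sym (⊕-cong (constant≋ x) (constant≋ y))))
  ; *-homo = λ x y → ≋-trans (constant≋ (x ℤ.* y)) (≋-trans (constant-* x y)
               (≋-sym (⊗-cong (constant≋ x) (constant≋ y))))
  ; -‿homo = λ x → ≋-trans (constant≋ (ℤ.- x))
               (≋-trans (constant-neg x)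
                        (⊖-cong (≋-sym (constant≋ x))))
  ; 0-homo = ≋-refl
  ; 1-homo = ≋-refl
  }

constant≟ : ∀ x y → Maybe (constant x ≋ constant y)
constant≟ x y with x ℤ.≟ y
... | yes refl = just ≋-refl
... | no _     = nothing

module Solver = RingSolver (CommutativeRing.rawRing ℤ.+-*-commutativeRing)
  (fromCommutativeRing seriesRing) constantMorphism constant≟

-- Congruence modulo 5 and q^N

infix 4 _≋[_]_

record _≋[_]_ (a : Series) (N : ℕ) (b : Series) : Set where
  constructor below
  field
    at< : ∀ n → n < N → a n ≈ b n

open _≋[_]_

≋[]-setoid : ℕ → Setoid 0ℓ 0ℓ
≋[]-setoid N = record
  { Carrier       = Series
  ; _≈_           = _≋[ N ]_
  ; isEquivalence = record
    { refl  = below λ _ _ → ≈-refl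
    ; sym   = λ p → below λ n n<N → ≈-sym (at< p n n<N)
    ; trans = λ p q → below λ n n<N → ≈-trans (at< p n n<N) (at< q n n<N)
    }
  }

module ≋[]-Reasoning N = SetoidReasoning (≋[]-setoid N)

module _ {N : ℕ} where
  open Setoid (≋[]-setoid N) public using ()
    renaming (refl to ≋[]-refl; sym to ≋[]-sym; trans to ≋[]-trans)

≋⇒≋[] : ∀ {N a b} → a ≋ b → a ≋[ N ] b
≋⇒≋[] p = below λ n _ → at p n

≋[]-weaken : ∀ {M N a b} → M ≤ N → a ≋[ N ] b → a ≋[ M ] b
≋[]-weaken M≤N p = below λ n n<M → at< p n (ℕ.≤-trans n<M M≤N)

⊗-cong[] : ∀ {N a a′ b b′} → a ≋[ N ] a′ → b ≋[ N ] b′ → a ⊗ b ≋[ N ] a′ ⊗ b′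
⊗-cong[] p q = below λ n n<N → ⊗-cong-< n
  (λ i i≤n → at< p i (ℕ.≤-<-trans i≤n n<N))
  (λ i i≤n → at< q i (ℕ.≤-<-trans i≤n n<N))

opaque
  unfolding _⊗_

  ⊕-cong[] : ∀ {N a a′ b b′} → a ≋[ N ] a′ → b ≋[ N ] b′ → a ⊕ b ≋[ N ] a′ ⊕ b′
  ⊕-cong[] p q = below λ n n<N → +-cong (at< p n n<N) (at< q n n<N)

  ⊖-cong[] : ∀ {N a b} → a ≋[ N ] b → ⊖ a ≋[ N ] ⊖ b
  ⊖-cong[] p = below λ n n<N → -‿cong (at< p n n<N)

  ·-cong[] : ∀ {N c a b} → a ≋[ N ] b → c · a ≋[ N ] c · b
  ·-cong[] {c = c} p = below λ n n<N → *-cong (≈-refl {c}) (at< p n n<N)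

  ·-cong : ∀ {c a b} → a ≋ b → c · a ≋ c · b
  ·-cong {c} p = pointwise λ n → *-cong (≈-refl {c}) (at p n)

⊖-cancel[] : ∀ {N a b} → a ⊕ ⊖ b ≋[ N ] 0ˢ → a ≋[ N ] b
⊖-cancel[] {N} {a} {b} p = begin
  a                   ≈⟨ ≋⇒≋[] (solve 2 (λ a b → a := (a :- b) :+ b) ≋-refl a b) ⟩
  (a ⊕ ⊖ b) ⊕ b       ≈⟨ ⊕-cong[] p ≋[]-refl ⟩
  0ˢ ⊕ b              ≈⟨ ≋⇒≋[] (⊕-identityˡ b) ⟩
  b                   ∎
  where
  open ≋[]-Reasoning N
  open Solver

opaque
  unfolding _⊗_

  ⊗-zeros : ∀ a b n → (∀ i → i < n → a i ≈ 0ℤ) → (a ⊗ b) n ≈ a n ℤ.* b 0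
  ⊗-zeros a b zero    p = ≈-reflexive (ℤ.+-identityʳ _)
  ⊗-zeros a b (suc n) p = begin
    a 0 ℤ.* b (suc n) ℤ.+ (tail a ⊗ b) n  ≈⟨ +-cong (*-cong (p 0 (s≤s z≤n)) ≈-refl)
                                                (⊗-zeros (tail a) b n λ i i<n → p (suc i) (s≤s i<n)) ⟩
    0ℤ ℤ.+ a (suc n) ℤ.* b 0              ≡⟨ ℤ.+-identityˡ _ ⟩
    a (suc n) ℤ.* b 0                     ∎
    where open ≈-Reasoning

-- The lowest nonzero coefficient of b would reappear unchanged in the product, because a has
-- constant term 1.
⊗-cancelˡ-0 : ∀ {N a b} → a 0 ≡ 1ℤ → a ⊗ b ≋[ N ] 0ˢ → b ≋[ N ] 0ˢ
⊗-cancelˡ-0 {N} {a} {b} a₀≡1 ab≈0 = below λ n n<N → vanish (suc n) n ℕ.≤-refl n<N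
  where
  -- The bound m turns the strong induction on i into a structural one.
  vanish : ∀ m i → i < m → i < N → b i ≈ 0ℤ
  vanish (suc m) i (s≤s i≤m) i<N = begin
    b i             ≡⟨ sym (ℤ.*-identityʳ (b i)) ⟩
    b i ℤ.* 1ℤ      ≡⟨ cong (b i ℤ.*_) (sym a₀≡1) ⟩
    b i ℤ.* a 0     ≈⟨ ⊗-zeros b a i (λ j j<i →
                         vanish m j (ℕ.≤-trans j<i i≤m) (ℕ.<-trans j<i i<N)) ⟨
    (b ⊗ a) i       ≡⟨ ⊗-comm b a i ⟩
    (a ⊗ b) i       ≈⟨ at< ab≈0 i i<N ⟩
    0ℤ              ∎
    where open ≈-Reasoning

⊗-cancelˡ[] : ∀ {N a b c} → a 0 ≡ 1ℤ → a ⊗ b ≋[ N ] a ⊗ c → b ≋[ N ] c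
⊗-cancelˡ[] {N} {a} {b} {c} a₀≡1 p = ⊖-cancel[] (⊗-cancelˡ-0 {N} {a} a₀≡1 (begin
  a ⊗ (b ⊕ ⊖ c)              ≈⟨ ≋⇒≋[] (solve 3 (λ a b c → a :* (b :- c) := a :* b :- a :* c) ≋-refl a b c) ⟩
  a ⊗ b ⊕ ⊖ (a ⊗ c)          ≈⟨ ⊕-cong[] p ≋[]-refl ⟩
  a ⊗ c ⊕ ⊖ (a ⊗ c)          ≈⟨ ≋⇒≋[] (solve 1 (λ x → x :- x := con 0ℤ) ≋-refl (a ⊗ c)) ⟩
  0ˢ                         ∎))
  where
  open ≋[]-Reasoning N
  open Solver

-- Monomials and shifts

X : ℕ → Series
X e n = [ n ℕ.≡ᵇ e ]

opaque
  unfolding _⊗_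

  X-shift : ∀ e a n → (X e ⊗ a) (e + n) ≡ a n
  X-shift zero    a n = ⊗-identityˡ a n
  X-shift (suc e) a n = trans (ℤ.+-identityˡ _) (X-shift e a n)

  X-below : ∀ e a n → n < e → (X e ⊗ a) n ≡ 0ℤ
  X-below (suc e) a zero    _         = refl
  X-below (suc e) a (suc n) (s≤s n<e) = trans (ℤ.+-identityˡ _) (X-below e a n n<e)

  X-+ : ∀ d e → X (d + e) ≋ X d ⊗ X e
  X-+ d e = ≗⇒≋ λ n → sym (homomorphic d n)
    where
    homomorphic : ∀ d n → (X d ⊗ X e) n ≡ X (d + e) n
    homomorphic zero    n       = ⊗-identityˡ (X e) n
    homomorphic (suc d) zero    = refl
    homomorphic (suc d) (suc n) = trans (ℤ.+-identityˡ _) (homomorphic d n)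

-- Multiplication by q^e raises the precision by e; `PD≋` depends on this gain.
X-⊗-cong : ∀ {N a b} e → a ≋[ N ] b → X e ⊗ a ≋[ e + N ] X e ⊗ b
X-⊗-cong {N} {a} {b} e p = below λ n n<e+N → lemma n n<e+N (n ℕ.<? e)
  where
  lemma : ∀ n → n < e + N → Dec (n < e) → (X e ⊗ a) n ≈ (X e ⊗ b) n
  lemma n n<e+N (yes n<e) =
    ≈-reflexive (trans (X-below e a n n<e) (sym (X-below e b n n<e)))
  lemma n n<e+N (no n≮e) with ℕ.m≤n⇒∃[o]m+o≡n (ℕ.≮⇒≥ n≮e)
  ... | o , refl = begin
    (X e ⊗ a) (e + o)   ≡⟨ X-shift e a o ⟩
    a o                 ≈⟨ at< p o (ℕ.+-cancelˡ-< e o N n<e+N) ⟩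
    b o                 ≡⟨ X-shift e b o ⟨
    (X e ⊗ b) (e + o)   ∎
    where open ≈-Reasoning

X-⊗≋0 : ∀ {N} e a → N ≤ e → X e ⊗ a ≋[ N ] 0ˢ
X-⊗≋0 e a N≤e = below λ n n<N → ≈-reflexive (X-below e a n (ℕ.≤-trans n<N N≤e))

X≋0 : ∀ {N} e → N ≤ e → X e ≋[ N ] 0ˢ
X≋0 e N≤e = ≋[]-trans (≋⇒≋[] (≋-sym (≗⇒≋ (⊗-identityʳ (X e))))) (X-⊗≋0 e 1ˢ N≤e)

opaque
  unfolding _⊗_

  1-q^≋ : ∀ k → 1-q^ k ≋ 1ˢ ⊕ ⊖ X k
  1-q^≋ k = ≋-refl

1-q^≋1 : ∀ {N} k → N ≤ k → 1-q^ k ≋[ N ] 1ˢ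
1-q^≋1 {N} k N≤k = begin
  1-q^ k            ≈⟨ ≋⇒≋[] (1-q^≋ k) ⟩
  1ˢ ⊕ ⊖ X k        ≈⟨ ⊕-cong[] ≋[]-refl (⊖-cong[] (X≋0 k N≤k)) ⟩
  1ˢ ⊕ ⊖ 0ˢ         ≈⟨ ≋⇒≋[] (solve 0 (con 1ℤ :- con 0ℤ := con 1ℤ) ≋-refl) ⟩
  1ˢ                ∎
  where
  open ≋[]-Reasoning N
  open Solver
-- Euler's pentagonal number theorem

tri : ℕ → ℕ
tri zero    = 0
tri (suc n) = suc n + tri n

sign : ℕ → Series
sign zero    = 1ˢ
sign (suc n) = ⊖ sign n

P : ℕ → Series
P = partialProduct 1-q^_

opaque
  unfolding _⊗_

  P-suc : ∀ n → P (suc n) ≋ 1-q^ suc n ⊗ P n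
  P-suc n = ≋-refl

P-suc′ : ∀ n → P (suc n) ≋ (1ˢ ⊕ ⊖ X (suc n)) ⊗ P n
P-suc′ n = ≋-trans (P-suc n) (⊗-cong (1-q^≋ (suc n)) ≋-refl)

-- (1 - q^(s+1)) ⋯ (1 - q^(s+d))
P[_,_] : ℕ → ℕ → Series
P[ s , zero  ] = 1ˢ
P[ s , suc d ] = 1-q^ (s + suc d) ⊗ P[ s , d ]

P[0,_] : ∀ n → P[ 0 , n ] ≋ P n
P[0, zero  ] = ≋-refl
P[0, suc n ] = ≋-trans (⊗-cong ≋-refl P[0, n ]) (≋-sym (P-suc n))

-- The definition splits off the highest factor, Shanks' recursion the lowest.
P[]-suc : ∀ s d → P[ s , suc d ] ≋ 1-q^ suc s ⊗ P[ suc s , d ]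
P[]-suc s zero    rewrite ℕ.+-comm s 1 = ≋-refl
P[]-suc s (suc d) rewrite ℕ.+-suc s (suc d) = begin
  y ⊗ P[ s , suc d ]                  ≈⟨ ⊗-cong (≋-refl {y}) (P[]-suc s d) ⟩
  y ⊗ (1-q^ suc s ⊗ P[ suc s , d ])   ≈⟨ solve 3 (λ y x r → y :* (x :* r) := x :* (y :* r)) ≋-refl y (1-q^ suc s) P[ suc s , d ] ⟩
  1-q^ suc s ⊗ (y ⊗ P[ suc s , d ])   ∎
  where
  y = 1-q^ (suc (s + suc d))
  open ≋-Reasoning
  open Solver

≡⇒≋ : ∀ (f : ℕ → Series) {m n} → m ≡ n → f m ≋ f n
≡⇒≋ f refl = ≋-refl

X-≡+ : ∀ {n} d e → n ≡ d + e → X n ≋ X d ⊗ X e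
X-≡+ d e refl = X-+ d e

-- Shanks' identity: with M = s + d, the terms below with s = 0, …, M sum to the partial sum
-- of the pentagonal series, and all but the first are divisible by q^(M+1).
shanksTerm : (M s d : ℕ) → Series
shanksTerm M s d = X (s * M + tri s) ⊗ (sign s ⊗ P[ s , d ])

shanksSum : (M s d : ℕ) → Series
shanksSum M s zero    = shanksTerm M s zero
shanksSum M s (suc d) = shanksTerm M s (suc d) ⊕ shanksSum M (suc s) d

-- With n = M + 1 the exponents are n(3n+1)/2 and n(3n-1)/2, the pentagonal numbers of index n and
-- -n.
pentagonalTerms : ℕ → Series
pentagonalTerms M = sign (suc M) ⊗ (X (suc M * suc M + tri (suc M)) ⊕ X (suc M * M + tri (suc M)))

-- Passing from M to M + 1 changes the part of the sum from s onwards by the two new pentagonal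
-- terms and one boundary term. The boundary term carries the factor 1 - q^s, so it disappears for
-- the full sum, where s = 0. The induction starts at the end of the sum.
shanksStep : ∀ d s M → s + d ≡ M →
  shanksSum (suc M) s (suc d) ≋
  shanksSum M s d ⊕ ⊖ (shanksTerm M s d ⊗ (1ˢ ⊕ ⊖ X s)) ⊕ pentagonalTerms M
shanksStep zero s M s+0≡M rewrite ℕ.+-identityʳ s with refl ← s+0≡M = begin
  X (M * suc M + tri M) ⊗ (σ ⊗ (1-q^ (M + 1) ⊗ 1ˢ)) ⊕ w ⊗ (⊖ σ ⊗ 1ˢ)
    ≈⟨ ⊕-cong (⊗-cong (X-≡+ (M * M + tri M) M e₁) (⊗-cong (≋-refl {σ}) (⊗-cong e₂ (≋-refl {1ˢ})))) ≋-refl ⟩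
  (y ⊗ x) ⊗ (σ ⊗ ((1ˢ ⊕ ⊖ z) ⊗ 1ˢ)) ⊕ w ⊗ (⊖ σ ⊗ 1ˢ)
    ≈⟨ solve 5 (λ σ x y z w →
         (y :* x) :* (σ :* ((con 1ℤ :- z) :* con 1ℤ)) :+ w :* (:- σ :* con 1ℤ)
         := y :* (σ :* con 1ℤ) :- y :* (σ :* con 1ℤ) :* (con 1ℤ :- x)
            :+ (:- σ) :* (w :+ (y :* x) :* z))
       ≋-refl σ x y z w ⟩
  y ⊗ (σ ⊗ 1ˢ) ⊕ ⊖ (y ⊗ (σ ⊗ 1ˢ) ⊗ (1ˢ ⊕ ⊖ x)) ⊕ ⊖ σ ⊗ (w ⊕ (y ⊗ x) ⊗ z)
    ≈⟨ ⊕-cong ≋-refl (⊗-cong ≋-refl (⊕-cong ≋-refl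
         (≋-sym (≋-trans (X-≡+ (M * M + tri M + M) (suc M) e₃)
                         (⊗-cong (X-+ (M * M + tri M) M) ≋-refl))))) ⟩
  y ⊗ (σ ⊗ 1ˢ) ⊕ ⊖ (y ⊗ (σ ⊗ 1ˢ) ⊗ (1ˢ ⊕ ⊖ x)) ⊕ ⊖ σ ⊗ (w ⊕ X (suc M * M + tri (suc M)))
    ∎
  where
  σ = sign M
  x = X M
  y = X (M * M + tri M)
  z = X (suc M)
  w = X (suc M * suc M + tri (suc M))
  open ≋-Reasoning
  open Solver
  e₁ : M * suc M + tri M ≡ M * M + tri M + M
  e₁ = Nat.solve 2 (λ m t → m Nat.:* (Nat.con 1 Nat.:+ m) Nat.:+ t Nat.:=
                            m Nat.:* m Nat.:+ t Nat.:+ m) refl M (tri M)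
  e₂ : 1-q^ (M + 1) ≋ 1ˢ ⊕ ⊖ z
  e₂ rewrite ℕ.+-comm M 1 = 1-q^≋ (suc M)
  e₃ : suc M * M + tri (suc M) ≡ M * M + tri M + M + suc M
  e₃ = Nat.solve 2 (λ m t → (Nat.con 1 Nat.:+ m) Nat.:* m Nat.:+ (Nat.con 1 Nat.:+ m Nat.:+ t) Nat.:=
                            m Nat.:* m Nat.:+ t Nat.:+ m Nat.:+ (Nat.con 1 Nat.:+ m)) refl M (tri M)
shanksStep (suc d) s M s+d≡M = begin
  X (s * suc M + tri s) ⊗ (σ ⊗ (1-q^ (s + suc (suc d)) ⊗ r)) ⊕ shanksSum (suc M) (suc s) (suc d)
    ≈⟨ ⊕-cong (⊗-cong (X-≡+ (s * M + tri s) s e₁) (⊗-cong (≋-refl {σ}) (⊗-cong e₂ (≋-refl {r}))))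
              (shanksStep d (suc s) M (trans (sym (ℕ.+-suc s d)) s+d≡M)) ⟩
  (y ⊗ x) ⊗ (σ ⊗ ((1ˢ ⊕ ⊖ z) ⊗ r)) ⊕
    (S ⊕ ⊖ (X (suc s * M + tri (suc s)) ⊗ (⊖ σ ⊗ r′) ⊗ (1ˢ ⊕ ⊖ X (suc s))) ⊕ E)
    ≈⟨ ⊕-cong ≋-refl (⊕-cong (⊕-cong ≋-refl (⊖-cong (⊗-cong (⊗-cong e₃ ≋-refl) (≋-sym (1-q^≋ (suc s)))))) ≋-refl) ⟩
  (y ⊗ x) ⊗ (σ ⊗ ((1ˢ ⊕ ⊖ z) ⊗ r)) ⊕
    (S ⊕ ⊖ (((y ⊗ x) ⊗ z) ⊗ (⊖ σ ⊗ r′) ⊗ v) ⊕ E)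
    ≈⟨ solve 9 (λ σ x y z r r′ v S E →
         (y :* x) :* (σ :* ((con 1ℤ :- z) :* r)) :+
         (S :- ((y :* x) :* z) :* (:- σ :* r′) :* v :+ E)
         := ((y :* x) :* σ :* ((con 1ℤ :- z) :* r :+ z :* (v :* r′)) :+ S) :+ E)
       ≋-refl σ x y z r r′ v S E ⟩
  ((y ⊗ x) ⊗ σ ⊗ ((1ˢ ⊕ ⊖ z) ⊗ r ⊕ z ⊗ (v ⊗ r′)) ⊕ S) ⊕ E
    -- Here v r′ = r, so that the boundary term inherited from s + 1 combines with the current term:
    -- (1 - z) r + z r = r.
    ≈⟨ ⊕-cong (⊕-cong (⊗-cong ≋-refl (⊕-cong ≋-refl (⊗-cong ≋-refl (≋-sym (P[]-suc s d))))) ≋-refl) ≋-refl ⟩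
  ((y ⊗ x) ⊗ σ ⊗ ((1ˢ ⊕ ⊖ z) ⊗ r ⊕ z ⊗ r) ⊕ S) ⊕ E
    ≈⟨ solve 7 (λ σ x y z r S E →
         ((y :* x) :* σ :* ((con 1ℤ :- z) :* r :+ z :* r) :+ S) :+ E
         := (y :* (σ :* r) :+ S) :- y :* (σ :* r) :* (con 1ℤ :- x) :+ E)
       ≋-refl σ x y z r S E ⟩
  (y ⊗ (σ ⊗ r) ⊕ S) ⊕ ⊖ (y ⊗ (σ ⊗ r) ⊗ (1ˢ ⊕ ⊖ x)) ⊕ E
    ∎
  where
  σ = sign s
  x = X s
  y = X (s * M + tri s)
  z = X (suc M)
  r = P[ s , suc d ]
  r′ = P[ suc s , d ]
  v = 1-q^ suc s
  S = shanksSum M (suc s) d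
  E = pentagonalTerms M
  open ≋-Reasoning
  open Solver
  e₁ : s * suc M + tri s ≡ s * M + tri s + s
  e₁ = Nat.solve 3 (λ s m t → s Nat.:* (Nat.con 1 Nat.:+ m) Nat.:+ t Nat.:=
                              s Nat.:* m Nat.:+ t Nat.:+ s) refl s M (tri s)
  e₂ : 1-q^ (s + suc (suc d)) ≋ 1ˢ ⊕ ⊖ z
  e₂ rewrite ℕ.+-suc s (suc d) | s+d≡M = 1-q^≋ (suc M)
  e₃ : X (suc s * M + tri (suc s)) ≋ (y ⊗ x) ⊗ z
  e₃ = ≋-trans (X-≡+ (s * M + tri s + s) (suc M)
         (Nat.solve 3 (λ s m t → (Nat.con 1 Nat.:+ s) Nat.:* m Nat.:+ (Nat.con 1 Nat.:+ s Nat.:+ t)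
                                 Nat.:= s Nat.:* m Nat.:+ t Nat.:+ s Nat.:+ (Nat.con 1 Nat.:+ m))
                      refl s M (tri s)))
         (⊗-cong (X-+ (s * M + tri s) s) ≋-refl)

pentagonalSum : ℕ → Series
pentagonalSum zero    = 1ˢ
pentagonalSum (suc M) = pentagonalSum M ⊕ pentagonalTerms M

shanksSum≋pentagonalSum : ∀ N → shanksSum N 0 N ≋ pentagonalSum N
shanksSum≋pentagonalSum zero    = solve 0 (con 1ℤ :* (con 1ℤ :* con 1ℤ) := con 1ℤ) ≋-refl
  where open Solver
shanksSum≋pentagonalSum (suc N) = begin
  shanksSum (suc N) 0 (suc N)                               ≈⟨ shanksStep N 0 N refl ⟩
  shanksSum N 0 N ⊕ ⊖ (u ⊗ (1ˢ ⊕ ⊖ 1ˢ)) ⊕ pentagonalTerms N ≈⟨ solve 3 (λ u S E → S :- u :* (con 1ℤ :- con 1ℤ) :+ E := S :+ E) ≋-refl u (shanksSum N 0 N) (pentagonalTerms N) ⟩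
  shanksSum N 0 N ⊕ pentagonalTerms N                       ≈⟨ ⊕-cong (shanksSum≋pentagonalSum N) ≋-refl ⟩
  pentagonalSum (suc N)                                     ∎
  where
  u = shanksTerm N 0 N
  open ≋-Reasoning
  open Solver

shanksTerm≋0 : ∀ M s d → shanksTerm M (suc s) d ≋[ suc M ] 0ˢ
shanksTerm≋0 M s d = X-⊗≋0 _ _ bound
  where
  bound : suc M ≤ suc s * M + tri (suc s)
  bound = subst (_≤ suc s * M + tri (suc s)) (ℕ.+-comm M 1)
            (ℕ.+-mono-≤ (ℕ.m≤m+n M (s * M)) (s≤s z≤n))

shanksSum≋0 : ∀ d M s → shanksSum M (suc s) d ≋[ suc M ] 0ˢ
shanksSum≋0 zero    M s = shanksTerm≋0 M s 0
shanksSum≋0 (suc d) M s =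
  ≋[]-trans (⊕-cong[] (shanksTerm≋0 M s (suc d)) (shanksSum≋0 d M (suc s)))
            (≋⇒≋[] (⊕-identityˡ 0ˢ))

shanksSum≋P : ∀ N → shanksSum N 0 N ≋[ suc N ] P N
shanksSum≋P zero    = ≋⇒≋[] (solve 0 (con 1ℤ :* (con 1ℤ :* con 1ℤ) := con 1ℤ) ≋-refl)
  where open Solver
shanksSum≋P (suc N) = begin
  1ˢ ⊗ (1ˢ ⊗ P[ 0 , suc N ]) ⊕ shanksSum (suc N) 1 N ≈⟨ ⊕-cong[] ≋[]-refl (shanksSum≋0 N (suc N) 0) ⟩
  1ˢ ⊗ (1ˢ ⊗ P[ 0 , suc N ]) ⊕ 0ˢ                    ≈⟨ ≋⇒≋[] (solve 1 (λ r → con 1ℤ :* (con 1ℤ :* r) :+ con 0ℤ := r) ≋-refl P[ 0 , suc N ]) ⟩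
  P[ 0 , suc N ]                                     ≈⟨ ≋⇒≋[] P[0, suc N ] ⟩
  P (suc N)                                          ∎
  where
  open ≋[]-Reasoning (suc (suc N))
  open Solver

-- Shanks' sum equals the pentagonal sum exactly, and modulo q^(N+1) it reduces to its term with s =
-- 0, which is `P N`.
euler : ∀ N → P N ≋[ suc N ] pentagonalSum N
euler N = ≋[]-trans (≋[]-sym (shanksSum≋P N)) (≋⇒≋[] (shanksSum≋pentagonalSum N))
-- Jacobi's identity for the cube of Euler's product

-- D n k is the difference of the coefficients of z^k and z^(k+1) in
-- (1 - zq)(1 - q/z) ⋯ (1 - zq^n)(1 - q^n/z); in the recurrence, the symmetry z ↔ 1/z
-- has been used to replace D n (-1) by - D n 0.
D : ℕ → ℕ → Series
D zero    zero    = 1ˢ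
D zero    (suc k) = 0ˢ
D (suc n) zero    = (1ˢ ⊕ X (suc n) ⊗ X (suc n) ⊕ X (suc n)) ⊗ D n 0 ⊕ ⊖ (X (suc n) ⊗ D n 1)
D (suc n) (suc k) = (1ˢ ⊕ X (suc n) ⊗ X (suc n)) ⊗ D n (suc k) ⊕
                    ⊖ (X (suc n) ⊗ (D n k ⊕ D n (suc (suc k))))

D-vanishes : ∀ {n k} → n < k → D n k ≋ 0ˢ
D-vanishes {zero}  {suc k} _         = ≋-refl
D-vanishes {suc n} {suc k} (s≤s n<k) = begin
  (1ˢ ⊕ x ⊗ x) ⊗ D n (suc k) ⊕ ⊖ (x ⊗ (D n k ⊕ D n (suc (suc k))))
    ≈⟨ ⊕-cong (⊗-cong ≋-refl (D-vanishes (ℕ.m<n⇒m<1+n n<k)))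
         (⊖-cong (⊗-cong ≋-refl (⊕-cong (D-vanishes n<k)
           (D-vanishes (ℕ.m<n⇒m<1+n (ℕ.m<n⇒m<1+n n<k)))))) ⟩
  (1ˢ ⊕ x ⊗ x) ⊗ 0ˢ ⊕ ⊖ (x ⊗ (0ˢ ⊕ 0ˢ))
    ≈⟨ solve 1 (λ x → (con 1ℤ :+ x :* x) :* con 0ℤ :- x :* (con 0ℤ :+ con 0ℤ) := con 0ℤ) ≋-refl x ⟩
  0ˢ ∎
  where
  x = X (suc n)
  open ≋-Reasoning
  open Solver

odd : ℕ → Series
odd zero    = 1ˢ
odd (suc k) = odd k ⊕ (+ 2) · 1ˢ

-- If c_k is the coefficient of z^k, summation by parts turns Σ (2k+1)(c_k - c_(k+1)) into c_0 +
-- 2(c_1 + c_2 + ...), the value at z = 1 of the symmetric Laurent polynomial behind `D`.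
weightedSum : ℕ → ℕ → Series
weightedSum n zero    = 0ˢ
weightedSum n (suc k) = weightedSum n k ⊕ odd k ⊗ D n k

-- At z = 1 the new pair of factors contributes (1 - q^(n+1))²; the remaining summand is the
-- boundary term caused by stopping at k.
weightedSum-suc : ∀ n k →
  weightedSum (suc n) (suc k) ≋
  (1ˢ ⊕ ⊖ X (suc n)) ⊗ (1ˢ ⊕ ⊖ X (suc n)) ⊗ weightedSum n (suc k) ⊕
  X (suc n) ⊗ (odd (suc k) ⊗ D n k ⊕ ⊖ (odd k ⊗ D n (suc k)))
weightedSum-suc n zero    = solve 3 (λ x d e →
    con 0ℤ :+ con 1ℤ :* ((con 1ℤ :+ x :* x :+ x) :* d :- x :* e)
    := (con 1ℤ :- x) :* (con 1ℤ :- x) :* (con 0ℤ :+ con 1ℤ :* d) :+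
       x :* ((con 1ℤ :+ con (+ 2)) :* d :- con 1ℤ :* e))
  ≋-refl (X (suc n)) (D n 0) (D n 1)
  where open Solver
weightedSum-suc n (suc k) = ≋-trans
  (⊕-cong (weightedSum-suc n k) ≋-refl)
  (solve 6 (λ x o w d e f →
    (con 1ℤ :- x) :* (con 1ℤ :- x) :* w :+ x :* ((o :+ con (+ 2)) :* d :- o :* e) :+
    (o :+ con (+ 2)) :* ((con 1ℤ :+ x :* x) :* e :- x :* (d :+ f))
    := (con 1ℤ :- x) :* (con 1ℤ :- x) :* (w :+ (o :+ con (+ 2)) :* e) :+
       x :* (((o :+ con (+ 2)) :+ con (+ 2)) :* e :- (o :+ con (+ 2)) :* f))
    ≋-refl (X (suc n)) (odd k) (weightedSum n (suc k)) (D n k) (D n (suc k)) (D n (suc (suc k))))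
  where open Solver

-- For n ≤ k the partial sum already contains all nonzero `D n i`, so the boundary terms of the
-- recurrence vanish.
weightedSum≋P² : ∀ n k → n ≤ k → weightedSum n (suc k) ≋ P n ⊗ P n
weightedSum≋P² zero zero    _ = solve 0 (con 0ℤ :+ con 1ℤ :* con 1ℤ := con 1ℤ :* con 1ℤ) ≋-refl
  where open Solver
weightedSum≋P² zero (suc k) _ = ≋-trans
  (solve 2 (λ w o → w :+ o :* con 0ℤ := w) ≋-refl (weightedSum 0 (suc k)) (odd (suc k)))
  (weightedSum≋P² zero k z≤n)
  where open Solver
weightedSum≋P² (suc n) k n<k = begin
  weightedSum (suc n) (suc k)
    ≈⟨ weightedSum-suc n k ⟩
  (1ˢ ⊕ ⊖ x) ⊗ (1ˢ ⊕ ⊖ x) ⊗ weightedSum n (suc k) ⊕ x ⊗ (odd (suc k) ⊗ D n k ⊕ ⊖ (odd k ⊗ D n (suc k)))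
    ≈⟨ ⊕-cong (⊗-cong ≋-refl (weightedSum≋P² n k (ℕ.<⇒≤ n<k)))
         (⊗-cong ≋-refl (⊕-cong (⊗-cong ≋-refl (D-vanishes n<k))
           (⊖-cong (⊗-cong ≋-refl (D-vanishes (ℕ.m<n⇒m<1+n n<k)))))) ⟩
  (1ˢ ⊕ ⊖ x) ⊗ (1ˢ ⊕ ⊖ x) ⊗ (P n ⊗ P n) ⊕ x ⊗ (odd (suc k) ⊗ 0ˢ ⊕ ⊖ (odd k ⊗ 0ˢ))
    ≈⟨ solve 4 (λ x p o o′ →
         (con 1ℤ :- x) :* (con 1ℤ :- x) :* (p :* p) :+ x :* (o′ :* con 0ℤ :- o :* con 0ℤ)
         := ((con 1ℤ :- x) :* p) :* ((con 1ℤ :- x) :* p))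
       ≋-refl x (P n) (odd k) (odd (suc k)) ⟩
  ((1ˢ ⊕ ⊖ x) ⊗ P n) ⊗ ((1ˢ ⊕ ⊖ x) ⊗ P n)
    ≈⟨ ⊗-cong (P-suc′ n) (P-suc′ n) ⟨
  P (suc n) ⊗ P (suc n) ∎
  where
  x = X (suc n)
  open ≋-Reasoning
  open Solver

-- P j ⊗ P (n + k + 1) clears the denominator of the Gaussian binomial coefficient
-- [2n+1 choose j]; in the next three lemmas it is one step ahead of D.
module _ (n : ℕ)
  (closedForm : ∀ j k → j + k ≡ n →
    P j ⊗ P (suc (n + k)) ⊗ D n k ≋ sign k ⊗ X (tri k) ⊗ P (suc (n + n))) where

  private
    Q = P (suc (n + n))

  raise-same : ∀ j k → j + k ≡ suc n →
    P j ⊗ P (suc (suc n + k)) ⊗ D n k ≋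
    (1ˢ ⊕ ⊖ X j) ⊗ (1ˢ ⊕ ⊖ X (suc (suc n + k))) ⊗ (sign k ⊗ X (tri k) ⊗ Q)
  raise-same zero    k refl = begin
    1ˢ ⊗ p ⊗ D n (suc n)          ≈⟨ ⊗-cong ≋-refl (D-vanishes (ℕ.n<1+n n)) ⟩
    1ˢ ⊗ p ⊗ 0ˢ                   ≈⟨ solve 3 (λ p z s → con 1ℤ :* p :* con 0ℤ := (con 1ℤ :- con 1ℤ) :* z :* s) ≋-refl p z s ⟩
    (1ˢ ⊕ ⊖ 1ˢ) ⊗ z ⊗ s           ∎
    where
    p = P (suc (suc n + k))
    z = 1ˢ ⊕ ⊖ X (suc (suc n + k))
    s = sign k ⊗ X (tri k) ⊗ Q
    open ≋-Reasoning
    open Solver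
  raise-same (suc j) k j+k≡n = begin
    P (suc j) ⊗ P (suc (suc n + k)) ⊗ D n k
      ≈⟨ ⊗-cong (⊗-cong (P-suc′ j) (P-suc′ (suc n + k))) ≋-refl ⟩
    y ⊗ P j ⊗ (z ⊗ P (suc (n + k))) ⊗ D n k
      ≈⟨ solve 5 (λ y p z r d → y :* p :* (z :* r) :* d := y :* z :* (p :* r :* d)) ≋-refl
           y (P j) z (P (suc (n + k))) (D n k) ⟩
    y ⊗ z ⊗ (P j ⊗ P (suc (n + k)) ⊗ D n k)
      ≈⟨ ⊗-cong ≋-refl (closedForm j k (ℕ.suc-injective j+k≡n)) ⟩
    y ⊗ z ⊗ (sign k ⊗ X (tri k) ⊗ Q) ∎
    where
    y = 1ˢ ⊕ ⊖ X (suc j)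
    z = 1ˢ ⊕ ⊖ X (suc (suc n + k))
    open ≋-Reasoning
    open Solver

  raise-next : ∀ j k → j + k ≡ suc n →
    P j ⊗ P (suc (suc n + k)) ⊗ D n (suc k) ≋
    (1ˢ ⊕ ⊖ X j) ⊗ (X 1 ⊕ ⊖ X j) ⊗ (⊖ sign k ⊗ (X (tri k) ⊗ X k) ⊗ Q)
  raise-next zero    k refl = begin
    1ˢ ⊗ p ⊗ D n (suc (suc n))          ≈⟨ ⊗-cong ≋-refl (D-vanishes (ℕ.n≤1+n (suc n))) ⟩
    1ˢ ⊗ p ⊗ 0ˢ                   ≈⟨ solve 3 (λ p z s → con 1ℤ :* p :* con 0ℤ := (con 1ℤ :- con 1ℤ) :* z :* s) ≋-refl p z s ⟩
    (1ˢ ⊕ ⊖ 1ˢ) ⊗ z ⊗ s           ∎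
    where
    p = P (suc (suc n + k))
    z = X 1 ⊕ ⊖ X 0
    s = ⊖ sign k ⊗ (X (tri k) ⊗ X k) ⊗ Q
    open ≋-Reasoning
    open Solver
  -- Here k = n, so `D n (suc k)` is zero; the factor q - q^j vanishes accordingly at j = 1, as 1 -
  -- q^j did at j = 0.
  raise-next (suc zero) k refl = begin
    P 1 ⊗ p ⊗ D n (suc n)          ≈⟨ ⊗-cong ≋-refl (D-vanishes (ℕ.n<1+n n)) ⟩
    P 1 ⊗ p ⊗ 0ˢ                   ≈⟨ solve 4 (λ r p x s → r :* p :* con 0ℤ := (con 1ℤ :- x) :* (x :- x) :* s) ≋-refl (P 1) p (X 1) s ⟩
    (1ˢ ⊕ ⊖ X 1) ⊗ (X 1 ⊕ ⊖ X 1) ⊗ s           ∎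
    where
    p = P (suc (suc n + k))
    s = ⊖ sign k ⊗ (X (tri k) ⊗ X k) ⊗ Q
    open ≋-Reasoning
    open Solver
  raise-next (suc (suc j)) k j+k≡n = begin
    P (suc (suc j)) ⊗ P (suc (suc n + k)) ⊗ D n (suc k)
      ≈⟨ ⊗-cong (⊗-cong (≋-trans (P-suc′ (suc j)) (⊗-cong ≋-refl (P-suc′ j))) (≡⇒≋ P (cong suc (sym (ℕ.+-suc n k))))) ≋-refl ⟩
    y ⊗ ((1ˢ ⊕ ⊖ X (suc j)) ⊗ P j) ⊗ P (suc (n + suc k)) ⊗ D n (suc k)
      ≈⟨ solve 5 (λ y v p r d → y :* (v :* p) :* r :* d := y :* v :* (p :* r :* d)) ≋-refl
           y (1ˢ ⊕ ⊖ X (suc j)) (P j) (P (suc (n + suc k))) (D n (suc k)) ⟩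
    y ⊗ (1ˢ ⊕ ⊖ X (suc j)) ⊗ (P j ⊗ P (suc (n + suc k)) ⊗ D n (suc k))
      ≈⟨ ⊗-cong ≋-refl (closedForm j (suc k) (trans (ℕ.+-suc j k) (ℕ.suc-injective j+k≡n))) ⟩
    y ⊗ (1ˢ ⊕ ⊖ X (suc j)) ⊗ (⊖ sign k ⊗ X (tri (suc k)) ⊗ Q)
      ≈⟨ ⊗-cong ≋-refl (⊗-cong (⊗-cong ≋-refl e) ≋-refl) ⟩
    y ⊗ (1ˢ ⊕ ⊖ X (suc j)) ⊗ (⊖ sign k ⊗ (X 1 ⊗ (X (tri k) ⊗ X k)) ⊗ Q)
      ≈⟨ solve 6 (λ y v q s t r → y :* (con 1ℤ :- v) :* (s :* (q :* t) :* r)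
                             := y :* (q :- q :* v) :* (s :* t :* r)) ≋-refl
           y (X (suc j)) (X 1) (⊖ sign k) (X (tri k) ⊗ X k) Q ⟩
    y ⊗ (X 1 ⊕ ⊖ (X 1 ⊗ X (suc j))) ⊗ (⊖ sign k ⊗ (X (tri k) ⊗ X k) ⊗ Q)
      ≈⟨ ⊗-cong (⊗-cong ≋-refl (⊕-cong ≋-refl (⊖-cong (X-+ 1 (suc j))))) ≋-refl ⟨
    y ⊗ (X 1 ⊕ ⊖ X (suc (suc j))) ⊗ (⊖ sign k ⊗ (X (tri k) ⊗ X k) ⊗ Q) ∎
    where
    y = 1ˢ ⊕ ⊖ X (suc (suc j))
    e : X (tri (suc k)) ≋ X 1 ⊗ (X (tri k) ⊗ X k)
    e = ≋-trans (X-≡+ 1 (tri k + k) (cong suc (ℕ.+-comm k (tri k)))) (⊗-cong ≋-refl (X-+ (tri k) k))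
    open ≋-Reasoning
    open Solver

  raise-previous : ∀ j k → j + suc k ≡ suc n →
    P j ⊗ P (suc (suc n + suc k)) ⊗ D n k ≋
    (1ˢ ⊕ ⊖ X (suc (suc n + suc k))) ⊗ (1ˢ ⊕ ⊖ X (suc n + suc k)) ⊗ (sign k ⊗ X (tri k) ⊗ Q)
  raise-previous j k j+k≡n = begin
    P j ⊗ P (suc (suc n + suc k)) ⊗ D n k
      ≈⟨ ⊗-cong (⊗-cong ≋-refl (≋-trans (P-suc′ (suc n + suc k)) (⊗-cong ≋-refl (P-suc′ (n + suc k))))) ≋-refl ⟩
    P j ⊗ (z ⊗ (z′ ⊗ P (n + suc k))) ⊗ D n k
      ≈⟨ ⊗-cong (⊗-cong ≋-refl (⊗-cong ≋-refl (⊗-cong ≋-refl (≡⇒≋ P (ℕ.+-suc n k))))) ≋-refl ⟩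
    P j ⊗ (z ⊗ (z′ ⊗ P (suc (n + k)))) ⊗ D n k
      ≈⟨ solve 5 (λ z z′ p r d → p :* (z :* (z′ :* r)) :* d := z :* z′ :* (p :* r :* d)) ≋-refl
           z z′ (P j) (P (suc (n + k))) (D n k) ⟩
    z ⊗ z′ ⊗ (P j ⊗ P (suc (n + k)) ⊗ D n k)
      ≈⟨ ⊗-cong ≋-refl (closedForm j k (ℕ.suc-injective (trans (sym (ℕ.+-suc j k)) j+k≡n))) ⟩
    z ⊗ z′ ⊗ (sign k ⊗ X (tri k) ⊗ Q) ∎
    where
    z = 1ˢ ⊕ ⊖ X (suc (suc n + suc k))
    z′ = 1ˢ ⊕ ⊖ X (suc n + suc k)
    open ≋-Reasoning
    open Solver

P-double : ∀ n → P (suc (suc n + suc n)) ≋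
  (1ˢ ⊕ ⊖ (X (suc n) ⊗ X (suc n) ⊗ X 1)) ⊗ ((1ˢ ⊕ ⊖ (X (suc n) ⊗ X (suc n))) ⊗ P (suc (n + n)))
P-double n = begin
  P (suc (suc n + suc n))
    ≈⟨ ≋-trans (P-suc′ (suc n + suc n)) (⊗-cong ≋-refl (P-suc′ (n + suc n))) ⟩
  (1ˢ ⊕ ⊖ X (suc (suc n + suc n))) ⊗ ((1ˢ ⊕ ⊖ X (suc n + suc n)) ⊗ P (n + suc n))
    ≈⟨ ⊗-cong (⊕-cong ≋-refl (⊖-cong (≋-trans (X-≡+ (suc n + suc n) 1 (ℕ.+-comm 1 _))
         (⊗-cong (X-+ (suc n) (suc n)) ≋-refl))))
       (⊗-cong (⊕-cong ≋-refl (⊖-cong (X-+ (suc n) (suc n)))) (≡⇒≋ P (ℕ.+-suc n n))) ⟩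
  _ ∎
  where open ≋-Reasoning

-- An instance of the q-binomial theorem: `D n k` is the coefficient of z^k in (1 - 1/z)(1 - zq)(1 -
-- q/z) ⋯ (1 - zq^n)(1 - q^n/z), a product of 2n+1 factors, hence ± q^(k(k+1)/2) times the Gaussian
-- binomial [2n+1 choose j] with j = n - k. The proof checks the recurrence of `D`.
closedForm : ∀ n j k → j + k ≡ n →
  P j ⊗ P (suc (n + k)) ⊗ D n k ≋ sign k ⊗ X (tri k) ⊗ P (suc (n + n))
closedForm zero    zero zero    refl = solve 1 (λ p → con 1ℤ :* p :* con 1ℤ := con 1ℤ :* con 1ℤ :* p) ≋-refl (P 1)
  where open Solver
closedForm (suc n) j    zero    j+0≡n rewrite ℕ.+-identityʳ j with refl ← j+0≡n = begin
  P (suc n) ⊗ L ⊗ ((1ˢ ⊕ y ⊗ y ⊕ y) ⊗ D n 0 ⊕ ⊖ (y ⊗ D n 1))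
    ≈⟨ solve 4 (λ m y d e → m :* ((con 1ℤ :+ y :* y :+ y) :* d :- y :* e)
         := (con 1ℤ :+ y :* y :+ y) :* (m :* d) :- y :* (m :* e)) ≋-refl
       (P (suc n) ⊗ L) y (D n 0) (D n 1) ⟩
  (1ˢ ⊕ y ⊗ y ⊕ y) ⊗ (P (suc n) ⊗ L ⊗ D n 0) ⊕ ⊖ (y ⊗ (P (suc n) ⊗ L ⊗ D n 1))
    ≈⟨ ⊕-cong (⊗-cong ≋-refl (raise-same n (closedForm n) (suc n) 0 (ℕ.+-identityʳ (suc n))))
         (⊖-cong (⊗-cong ≋-refl (raise-next n (closedForm n) (suc n) 0 (ℕ.+-identityʳ (suc n))))) ⟩
  (1ˢ ⊕ y ⊗ y ⊕ y) ⊗ ((1ˢ ⊕ ⊖ y) ⊗ (1ˢ ⊕ ⊖ X (suc (suc n + 0))) ⊗ (1ˢ ⊗ 1ˢ ⊗ Q)) ⊕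
    ⊖ (y ⊗ ((1ˢ ⊕ ⊖ y) ⊗ (q ⊕ ⊖ y) ⊗ (⊖ 1ˢ ⊗ (1ˢ ⊗ 1ˢ) ⊗ Q)))
    ≈⟨ ⊕-cong (⊗-cong ≋-refl (⊗-cong (⊗-cong ≋-refl (⊕-cong ≋-refl (⊖-cong e))) ≋-refl)) ≋-refl ⟩
  (1ˢ ⊕ y ⊗ y ⊕ y) ⊗ ((1ˢ ⊕ ⊖ y) ⊗ (1ˢ ⊕ ⊖ (y ⊗ q)) ⊗ (1ˢ ⊗ 1ˢ ⊗ Q)) ⊕
    ⊖ (y ⊗ ((1ˢ ⊕ ⊖ y) ⊗ (q ⊕ ⊖ y) ⊗ (⊖ 1ˢ ⊗ (1ˢ ⊗ 1ˢ) ⊗ Q)))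
    ≈⟨ solve 3 (λ y q r →
         (con 1ℤ :+ y :* y :+ y) :* ((con 1ℤ :- y) :* (con 1ℤ :- y :* q) :* (con 1ℤ :* con 1ℤ :* r)) :-
           (y :* ((con 1ℤ :- y) :* (q :- y) :* (:- con 1ℤ :* (con 1ℤ :* con 1ℤ) :* r)))
         := con 1ℤ :* con 1ℤ :* ((con 1ℤ :- y :* y :* q) :* ((con 1ℤ :- y :* y) :* r)))
       ≋-refl y q Q ⟩
  1ˢ ⊗ 1ˢ ⊗ ((1ˢ ⊕ ⊖ (y ⊗ y ⊗ q)) ⊗ ((1ˢ ⊕ ⊖ (y ⊗ y)) ⊗ Q))
    ≈⟨ ⊗-cong ≋-refl (P-double n) ⟨
  1ˢ ⊗ 1ˢ ⊗ P (suc (suc n + suc n)) ∎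
  where
  L = P (suc (suc n + 0))
  Q = P (suc (n + n))
  y = X (suc n)
  q = X 1
  e : X (suc (suc n + 0)) ≋ y ⊗ q
  e = X-≡+ (suc n) 1 (trans (cong suc (ℕ.+-identityʳ (suc n))) (ℕ.+-comm 1 (suc n)))
  open ≋-Reasoning
  open Solver
closedForm (suc n) j (suc k) j+k≡n = begin
  P j ⊗ L ⊗ ((1ˢ ⊕ x ⊗ x) ⊗ D n (suc k) ⊕ ⊖ (x ⊗ (D n k ⊕ D n (suc (suc k)))))
    ≈⟨ solve 5 (λ m x d e f → m :* ((con 1ℤ :+ x :* x) :* d :- x :* (e :+ f))
         := (con 1ℤ :+ x :* x) :* (m :* d) :- x :* (m :* e :+ m :* f)) ≋-refl
       (P j ⊗ L) x (D n (suc k)) (D n k) (D n (suc (suc k))) ⟩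
  (1ˢ ⊕ x ⊗ x) ⊗ (P j ⊗ L ⊗ D n (suc k)) ⊕
    ⊖ (x ⊗ (P j ⊗ L ⊗ D n k ⊕ P j ⊗ L ⊗ D n (suc (suc k))))
    ≈⟨ ⊕-cong (⊗-cong ≋-refl (raise-same n (closedForm n) j (suc k) j+k≡n))
         (⊖-cong (⊗-cong ≋-refl (⊕-cong (raise-previous n (closedForm n) j k j+k≡n)
                                        (raise-next n (closedForm n) j (suc k) j+k≡n)))) ⟩
  (1ˢ ⊕ x ⊗ x) ⊗ ((1ˢ ⊕ ⊖ y) ⊗ (1ˢ ⊕ ⊖ z) ⊗ (⊖ σ ⊗ X (tri (suc k)) ⊗ Q)) ⊕
    ⊖ (x ⊗ ((1ˢ ⊕ ⊖ z) ⊗ (1ˢ ⊕ ⊖ z′) ⊗ (σ ⊗ t ⊗ Q) ⊕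
            (1ˢ ⊕ ⊖ y) ⊗ (q ⊕ ⊖ y) ⊗ (⊖ ⊖ σ ⊗ (X (tri (suc k)) ⊗ w) ⊗ Q)))
    ≈⟨ ⊕-cong (⊗-cong (⊕-cong ≋-refl (⊗-cong ex ex))
           (⊗-cong (⊗-cong ≋-refl (⊕-cong ≋-refl (⊖-cong ez))) (⊗-cong (⊗-cong ≋-refl et) ≋-refl)))
         (⊖-cong (⊗-cong ex (⊕-cong
           (⊗-cong (⊗-cong (⊕-cong ≋-refl (⊖-cong ez)) (⊕-cong ≋-refl (⊖-cong ez′))) ≋-refl)
           (⊗-cong ≋-refl (⊗-cong (⊗-cong ≋-refl (⊗-cong et ≋-refl)) ≋-refl))))) ⟩
  (1ˢ ⊕ (y ⊗ w) ⊗ (y ⊗ w)) ⊗ ((1ˢ ⊕ ⊖ y) ⊗ (1ˢ ⊕ ⊖ (y ⊗ w ⊗ w ⊗ q)) ⊗ (⊖ σ ⊗ (w ⊗ t) ⊗ Q)) ⊕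
    ⊖ ((y ⊗ w) ⊗ ((1ˢ ⊕ ⊖ (y ⊗ w ⊗ w ⊗ q)) ⊗ (1ˢ ⊕ ⊖ (y ⊗ w ⊗ w)) ⊗ (σ ⊗ t ⊗ Q) ⊕
            (1ˢ ⊕ ⊖ y) ⊗ (q ⊕ ⊖ y) ⊗ (⊖ ⊖ σ ⊗ ((w ⊗ t) ⊗ w) ⊗ Q)))
    ≈⟨ solve 6 (λ y w q σ t r →
         (con 1ℤ :+ (y :* w) :* (y :* w)) :* ((con 1ℤ :- y) :* (con 1ℤ :- y :* w :* w :* q) :* (:- σ :* (w :* t) :* r)) :-
           ((y :* w) :* ((con 1ℤ :- y :* w :* w :* q) :* (con 1ℤ :- y :* w :* w) :* (σ :* t :* r) :+
             (con 1ℤ :- y) :* (q :- y) :* (:- (:- σ) :* ((w :* t) :* w) :* r)))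
         := :- σ :* (w :* t) :* ((con 1ℤ :- (y :* w) :* (y :* w) :* q) :* ((con 1ℤ :- (y :* w) :* (y :* w)) :* r)))
       ≋-refl y w q σ t Q ⟩
  ⊖ σ ⊗ (w ⊗ t) ⊗ ((1ˢ ⊕ ⊖ ((y ⊗ w) ⊗ (y ⊗ w) ⊗ q)) ⊗ ((1ˢ ⊕ ⊖ ((y ⊗ w) ⊗ (y ⊗ w))) ⊗ Q))
    ≈⟨ ⊗-cong (⊗-cong ≋-refl et) (⊗-cong (⊕-cong ≋-refl (⊖-cong (⊗-cong (⊗-cong ex ex) ≋-refl)))
         (⊗-cong (⊕-cong ≋-refl (⊖-cong (⊗-cong ex ex))) ≋-refl)) ⟨
  ⊖ σ ⊗ X (tri (suc k)) ⊗ ((1ˢ ⊕ ⊖ (x ⊗ x ⊗ q)) ⊗ ((1ˢ ⊕ ⊖ (x ⊗ x)) ⊗ Q))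
    ≈⟨ ⊗-cong ≋-refl (P-double n) ⟨
  ⊖ σ ⊗ X (tri (suc k)) ⊗ P (suc (suc n + suc n)) ∎
  where
  L = P (suc (suc n + suc k))
  Q = P (suc (n + n))
  x = X (suc n)
  y = X j
  w = X (suc k)
  q = X 1
  t = X (tri k)
  σ = sign k
  z = X (suc (suc n + suc k))
  z′ = X (suc n + suc k)
  ex : x ≋ y ⊗ w
  ex = X-≡+ j (suc k) (sym j+k≡n)
  et : X (tri (suc k)) ≋ w ⊗ t
  et = X-+ (suc k) (tri k)
  ez′ : z′ ≋ y ⊗ w ⊗ w
  ez′ = ≋-trans (X-+ (suc n) (suc k)) (⊗-cong ex ≋-refl)
  ez : z ≋ y ⊗ w ⊗ w ⊗ q
  ez = ≋-trans (X-≡+ (suc n + suc k) 1 (ℕ.+-comm 1 _)) (⊗-cong ez′ ≋-refl)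
  open ≋-Reasoning
  open Solver

P-+ : ∀ j k → P (j + k) ≋ P[ j , k ] ⊗ P j
P-+ j zero    rewrite ℕ.+-identityʳ j = solve 1 (λ p → p := con 1ℤ :* p) ≋-refl (P j)
  where open Solver
P-+ j (suc k) = begin
  P (j + suc k)                           ≈⟨ ≡⇒≋ P (ℕ.+-suc j k) ⟩
  P (suc (j + k))                         ≈⟨ P-suc (j + k) ⟩
  1-q^ suc (j + k) ⊗ P (j + k)            ≈⟨ ⊗-cong (≡⇒≋ 1-q^_ (ℕ.+-suc j k)) (≋-sym (P-+ j k)) ⟨
  1-q^ (j + suc k) ⊗ (P[ j , k ] ⊗ P j)   ≈⟨ solve 3 (λ x y z → x :* (y :* z) := x :* y :* z) ≋-refl (1-q^ (j + suc k)) P[ j , k ] (P j) ⟩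
  1-q^ (j + suc k) ⊗ P[ j , k ] ⊗ P j     ∎
  where
  open ≋-Reasoning
  open Solver

P[]≋1 : ∀ j k → P[ j , k ] ≋[ suc j ] 1ˢ
P[]≋1 j zero    = ≋[]-refl
P[]≋1 j (suc k) = ≋[]-trans
  (⊗-cong[] (1-q^≋1 (j + suc k) (subst (suc j ≤_) (sym (ℕ.+-suc j k)) (s≤s (ℕ.m≤m+n j k)))) (P[]≋1 j k))
  (≋⇒≋[] (solve 0 (con 1ℤ :* con 1ℤ := con 1ℤ) ≋-refl))
  where open Solver

P-stable : ∀ {m n} → m ≤ n → P n ≋[ suc m ] P m
P-stable {m} m≤n with ℕ.m≤n⇒∃[o]m+o≡n m≤n
... | o , refl = begin
  P (m + o)               ≈⟨ ≋⇒≋[] (P-+ m o) ⟩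
  P[ m , o ] ⊗ P m        ≈⟨ ⊗-cong[] (P[]≋1 m o) ≋[]-refl ⟩
  1ˢ ⊗ P m                ≈⟨ ≋⇒≋[] (solve 1 (λ p → con 1ℤ :* p := p) ≋-refl (P m)) ⟩
  P m                     ∎
  where
  open ≋[]-Reasoning (suc m)
  open Solver

n≤tri[n] : ∀ n → n ≤ tri n
n≤tri[n] zero    = z≤n
n≤tri[n] (suc n) = ℕ.m≤m+n (suc n) (tri n)

-- The limit of the closed form for large n: cancelling the long product `P l` removes P(2n+1), and
-- `P n` differs from `P j` by the factor R, which is close to 1.
PD≋ : ∀ j k → P (j + k) ⊗ D (j + k) k ≋[ suc (j + k) ] sign k ⊗ X (tri k)
PD≋ j k = begin
  P n ⊗ D n k                         ≈⟨ ≋⇒≋[] (≋-trans (⊗-cong (P-+ j k) ≋-refl)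
                                           (solve 3 (λ r p d → r :* p :* d := r :* (p :* d)) ≋-refl R (P j) (D n k))) ⟩
  R ⊗ (P j ⊗ D n k)                   ≈⟨ ⊗-cong[] ≋[]-refl (≋[]-weaken (s≤s (ℕ.≤-trans (ℕ.m≤m+n n k) (ℕ.n≤1+n _)))
                                           (⊗-cancelˡ[] {suc l} {P l} (P₀≡1 l) cleared)) ⟩
  R ⊗ (sign k ⊗ X (tri k))            ≈⟨ ≋⇒≋[] (solve 3 (λ r s t → r :* (s :* t) := t :* (r :* s)) ≋-refl R (sign k) (X (tri k))) ⟩
  -- R is 1 only modulo q^(j+1); the factor q^(tri k) supplies the missing k orders because k ≤
  -- `tri k`.
  X (tri k) ⊗ (R ⊗ sign k)            ≈⟨ ≋[]-weaken bound (X-⊗-cong (tri k) (⊗-cong[] (P[]≋1 j k) ≋[]-refl)) ⟩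
  X (tri k) ⊗ (1ˢ ⊗ sign k)           ≈⟨ ≋⇒≋[] (solve 2 (λ s t → t :* (con 1ℤ :* s) := s :* t) ≋-refl (sign k) (X (tri k))) ⟩
  sign k ⊗ X (tri k)                  ∎
  where
  n = j + k
  l = suc (n + k)
  R = P[ j , k ]
  open ≋[]-Reasoning (suc n)
  open Solver
  bound : suc n ≤ tri k + suc j
  bound = subst (_≤ tri k + suc j) (trans (ℕ.+-suc k j) (cong suc (ℕ.+-comm k j))) (ℕ.+-monoˡ-≤ (suc j) (n≤tri[n] k))
  P₀≡1 : ∀ m → P m 0 ≡ 1ℤ
  P₀≡1 zero    = refl
  P₀≡1 (suc m) = trans (ℤ.+-identityʳ _) (trans (ℤ.*-identityˡ (P m 0)) (P₀≡1 m))
  cleared : P l ⊗ (P j ⊗ D n k) ≋[ suc l ] P l ⊗ (sign k ⊗ X (tri k))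
  cleared = ≋[]-trans
    (≋⇒≋[] (≋-trans (solve 3 (λ a b c → a :* (b :* c) := b :* a :* c) ≋-refl (P l) (P j) (D n k))
                    (closedForm n j k refl)))
    (≋[]-trans (⊗-cong[] ≋[]-refl (P-stable (s≤s (ℕ.+-monoʳ-≤ n (ℕ.m≤n+m k j)))))
               (≋⇒≋[] (solve 2 (λ a b → a :* b := b :* a) ≋-refl (sign k ⊗ X (tri k)) (P l))))

jacobiSum : ℕ → Series
jacobiSum zero    = 0ˢ
jacobiSum (suc k) = jacobiSum k ⊕ odd k ⊗ (sign k ⊗ X (tri k))

P-weightedSum : ∀ n k → k ≤ suc n → P n ⊗ weightedSum n k ≋[ suc n ] jacobiSum k
P-weightedSum n zero    _         = ≋⇒≋[] (solve 1 (λ p → p :* con 0ℤ := con 0ℤ) ≋-refl (P n))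
  where open Solver
P-weightedSum n (suc k) (s≤s k≤n) with ℕ.m≤n⇒∃[o]m+o≡n k≤n
... | j , refl rewrite ℕ.+-comm k j = begin
  P n′ ⊗ (weightedSum n′ k ⊕ odd k ⊗ D n′ k)
    ≈⟨ ≋⇒≋[] (solve 4 (λ p w o d → p :* (w :+ o :* d) := p :* w :+ o :* (p :* d)) ≋-refl
         (P n′) (weightedSum n′ k) (odd k) (D n′ k)) ⟩
  P n′ ⊗ weightedSum n′ k ⊕ odd k ⊗ (P n′ ⊗ D n′ k)
    ≈⟨ ⊕-cong[] (P-weightedSum n′ k (ℕ.m≤n⇒m≤1+n (ℕ.m≤n+m k j))) (⊗-cong[] ≋[]-refl (PD≋ j k)) ⟩
  jacobiSum (suc k) ∎
  where
  n′ = j + k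
  open ≋[]-Reasoning (suc n′)
  open Solver

-- Two of the three factors form the weighted sum of the `D n k`; the third clears their Gaussian
-- denominators.
jacobi : ∀ n → P n ⊗ (P n ⊗ P n) ≋[ suc n ] jacobiSum (suc n)
jacobi n = ≋[]-trans
  (≋⇒≋[] (⊗-cong ≋-refl (≋-sym (weightedSum≋P² n n ℕ.≤-refl))))
  (P-weightedSum n (suc n) ℕ.≤-refl)
-- The substitution q ↦ q^m and the generating function of p₃₃ modulo 5

-- spread k j a is q^j a(q^(k+1)).
spread : ℕ → ℕ → Series → Series
spread k zero    a zero    = a 0
spread k zero    a (suc n) = spread k k (tail a) n
spread k (suc j) a zero    = 0ℤ
spread k (suc j) a (suc n) = spread k j a n

spread-cong-< : ∀ k j {a b} n → (∀ i → i ≤ n → a i ≈ b i) → spread k j a n ≈ spread k j b n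
spread-cong-< k zero    zero    p = p 0 z≤n
spread-cong-< k zero    (suc n) p = spread-cong-< k k n λ i i≤n → p (suc i) (s≤s i≤n)
spread-cong-< k (suc j) zero    p = ≈-refl
spread-cong-< k (suc j) (suc n) p = spread-cong-< k j n λ i i≤n → p i (ℕ.m≤n⇒m≤1+n i≤n)

spread-cong : ∀ k j {a b} → a ≋ b → spread k j a ≋ spread k j b
spread-cong k j p = pointwise λ n → spread-cong-< k j n λ i _ → at p i

spread-cong[] : ∀ k j {N a b} → a ≋[ N ] b → spread k j a ≋[ N ] spread k j b
spread-cong[] k j p = below λ n n<N → spread-cong-< k j n λ i i≤n → at< p i (ℕ.≤-<-trans i≤n n<N)

spread-0ˢ : ∀ k j → spread k j 0ˢ ≗ 0ˢ
spread-0ˢ k zero    zero    = refl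
spread-0ˢ k zero    (suc n) = spread-0ˢ k k n
spread-0ˢ k (suc j) zero    = refl
spread-0ˢ k (suc j) (suc n) = spread-0ˢ k j n

spread-X : ∀ k j e → spread k j (X e) ≗ X (j + e * suc k)
spread-X k zero    zero    zero    = refl
spread-X k zero    (suc e) zero    = refl
spread-X k zero    zero    (suc n) = spread-0ˢ k k n
spread-X k zero    (suc e) (suc n) = spread-X k k e n
spread-X k (suc j) e       zero    = refl
spread-X k (suc j) e       (suc n) = spread-X k j e n

opaque
  unfolding _⊗_

  spread-⊕ : ∀ k j a b → spread k j (a ⊕ b) ≗ spread k j a ⊕ spread k j b
  spread-⊕ k zero    a b zero    = refl
  spread-⊕ k zero    a b (suc n) = spread-⊕ k k (tail a) (tail b) n
  spread-⊕ k (suc j) a b zero    = refl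
  spread-⊕ k (suc j) a b (suc n) = spread-⊕ k j a b n

  spread-· : ∀ k j c a → spread k j (c · a) ≗ c · spread k j a
  spread-· k zero    c a zero    = refl
  spread-· k zero    c a (suc n) = spread-· k k c (tail a) n
  spread-· k (suc j) c a zero    = sym (ℤ.*-zeroʳ c)
  spread-· k (suc j) c a (suc n) = spread-· k j c a n

  -- The offset j is arbitrary because removing the leading coefficient of the left factor leaves a
  -- series with offset k.
  spread-⊗ : ∀ k j a b → spread k j a ⊗ spread k 0 b ≗ spread k j (a ⊗ b)
  spread-⊗ k zero    a b zero    = refl
  spread-⊗ k zero    a b (suc n) = begin
    a 0 ℤ.* spread k k (tail b) n ℤ.+ (spread k k (tail a) ⊗ spread k 0 b) n
      ≡⟨ cong₂ ℤ._+_ (sym (spread-· k k (a 0) (tail b) n)) (spread-⊗ k k (tail a) b n) ⟩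
    spread k k (a 0 · tail b) n ℤ.+ spread k k (tail a ⊗ b) n
      ≡⟨ sym (spread-⊕ k k (a 0 · tail b) (tail a ⊗ b) n) ⟩
    spread k k (a 0 · tail b ⊕ tail a ⊗ b) n ∎
    where open ≡-Reasoning
  spread-⊗ k (suc j) a b zero    = refl
  spread-⊗ k (suc j) a b (suc n) = trans (ℤ.+-identityˡ _) (spread-⊗ k j a b n)

  ^3≋ : ∀ a → a ^ 3 ≋ a ⊗ (a ⊗ (a ⊗ 1ˢ))
  ^3≋ a = ≋-refl

  factor≋ : ∀ j → factor j ≋ (1-q^ (3 * j)) ^ 3 ⊗ 1/[1-q^ j ] ^ 3
  factor≋ j = ≋-refl

  partialProduct-suc : ∀ a n → partialProduct a (suc n) ≋ a (suc n) ⊗ partialProduct a n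
  partialProduct-suc a n = ≋-refl

  inverse≋ : ∀ k → 1-q^ suc k ⊗ 1/[1-q^ suc k ] ≋ 1ˢ
  inverse≋ k = ≗⇒≋ (inverse k)

  5·≋0 : ∀ a → ((+ 5) · 1ˢ) ⊗ a ≋ 0ˢ
  5·≋0 a = ≋-trans (≋-sym (·≋⊗ (+ 5) a)) (pointwise λ n → mod (a n) (identity (a n)))
    where
    identity : ∀ x → + 5 ℤ.* x ≡ 0ℤ ℤ.+ x ℤ.* + 5
    identity = solve-∀

infix 10 _⟨q^3⟩ _⟨q^5⟩

_⟨q^3⟩ _⟨q^5⟩ : Series → Series
a ⟨q^3⟩ = spread 2 0 a
a ⟨q^5⟩ = spread 4 0 a

cube : Series → Series
cube a = a ⊗ (a ⊗ a)

1ˢ-spread : ∀ k → spread k 0 1ˢ ≋ 1ˢ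
1ˢ-spread k = ≗⇒≋ (spread-X k 0 0)

1-x-spread : ∀ k e → spread k 0 (1ˢ ⊕ ⊖ X e) ≋ 1ˢ ⊕ ⊖ X (e * suc k)
1-x-spread k e = begin
  spread k 0 (1ˢ ⊕ ⊖ X e)                  ≈⟨ ≗⇒≋ (spread-⊕ k 0 1ˢ (⊖ X e)) ⟩
  spread k 0 1ˢ ⊕ spread k 0 (⊖ X e)       ≈⟨ ⊕-cong (1ˢ-spread k) (spread-cong k 0 (⊖≋ (X e))) ⟩
  1ˢ ⊕ spread k 0 (-1ℤ · X e)              ≈⟨ ⊕-cong ≋-refl (≗⇒≋ (spread-· k 0 -1ℤ (X e))) ⟩
  1ˢ ⊕ -1ℤ · spread k 0 (X e)              ≈⟨ ⊕-cong ≋-refl (·-cong (≗⇒≋ (spread-X k 0 e))) ⟩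
  1ˢ ⊕ -1ℤ · X (e * suc k)                 ≈⟨ ⊕-cong ≋-refl (≋-sym (⊖≋ (X (e * suc k)))) ⟩
  1ˢ ⊕ ⊖ X (e * suc k)                     ∎
  where
  open ≋-Reasoning
  open Solver
  ⊖≋ : ∀ a → ⊖ a ≋ -1ℤ · a
  ⊖≋ a = ≋-trans (solve 1 (λ a → :- a := con -1ℤ :* a) ≋-refl a) (≋-sym (·≋⊗ -1ℤ a))

P-suc-spread : ∀ k n → spread k 0 (P (suc n)) ≋ (1ˢ ⊕ ⊖ X (suc n * suc k)) ⊗ spread k 0 (P n)
P-suc-spread k n = begin
  spread k 0 (P (suc n))                                ≈⟨ spread-cong k 0 (P-suc′ n) ⟩
  spread k 0 ((1ˢ ⊕ ⊖ X (suc n)) ⊗ P n)                 ≈⟨ ≗⇒≋ (spread-⊗ k 0 _ (P n)) ⟨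
  spread k 0 (1ˢ ⊕ ⊖ X (suc n)) ⊗ spread k 0 (P n)      ≈⟨ ⊗-cong (1-x-spread k (suc n)) ≋-refl ⟩
  (1ˢ ⊕ ⊖ X (suc n * suc k)) ⊗ spread k 0 (P n)         ∎
  where open ≋-Reasoning

factorProduct : ∀ n → partialProduct factor n ⊗ cube (P n) ≋ cube (P n ⟨q^3⟩)
factorProduct zero = ≋-trans
  (solve 0 (con 1ℤ :* (con 1ℤ :* (con 1ℤ :* con 1ℤ)) := con 1ℤ :* (con 1ℤ :* con 1ℤ)) ≋-refl)
  (≋-sym (⊗-cong (1ˢ-spread 2) (⊗-cong (1ˢ-spread 2) (1ˢ-spread 2))))
  where open Solver
factorProduct (suc n) = begin
  partialProduct factor (suc n) ⊗ cube (P (suc n))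
    ≈⟨ ⊗-cong (≋-trans (partialProduct-suc factor n) (⊗-cong (≋-trans (factor≋ (suc n))
         (⊗-cong (^3≋ (1-q^ (3 * suc n))) (^3≋ 1/[1-q^ suc n ]))) ≋-refl))
         (⊗-cong (P-suc n) (⊗-cong (P-suc n) (P-suc n))) ⟩
  z ⊗ (z ⊗ (z ⊗ 1ˢ)) ⊗ (y ⊗ (y ⊗ (y ⊗ 1ˢ))) ⊗ F ⊗ cube (x ⊗ P n)
    ≈⟨ solve 5 (λ x y z f p →
         z :* (z :* (z :* con 1ℤ)) :* (y :* (y :* (y :* con 1ℤ))) :* f :* (x :* p :* (x :* p :* (x :* p)))
         := (x :* y) :* (x :* y) :* (x :* y) :* (z :* z :* z) :* (f :* (p :* (p :* p))))
       ≋-refl x y z F (P n) ⟩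
  (x ⊗ y) ⊗ (x ⊗ y) ⊗ (x ⊗ y) ⊗ (z ⊗ z ⊗ z) ⊗ (F ⊗ cube (P n))
    ≈⟨ ⊗-cong (⊗-cong (⊗-cong (⊗-cong (inverse≋ n) (inverse≋ n)) (inverse≋ n)) ≋-refl) (factorProduct n) ⟩
  1ˢ ⊗ 1ˢ ⊗ 1ˢ ⊗ (z ⊗ z ⊗ z) ⊗ cube (P n ⟨q^3⟩)
    ≈⟨ solve 2 (λ z p → con 1ℤ :* con 1ℤ :* con 1ℤ :* (z :* z :* z) :* (p :* (p :* p))
                 := z :* p :* (z :* p :* (z :* p))) ≋-refl z (P n ⟨q^3⟩) ⟩
  cube (z ⊗ P n ⟨q^3⟩)
    ≈⟨ ⊗-cong e (⊗-cong e e) ⟨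
  cube (P (suc n) ⟨q^3⟩) ∎
  where
  x = 1-q^ suc n
  y = 1/[1-q^ suc n ]
  z = 1-q^ (3 * suc n)
  F = partialProduct factor n
  e : P (suc n) ⟨q^3⟩ ≋ z ⊗ P n ⟨q^3⟩
  e = ≋-trans (P-suc-spread 2 n) (⊗-cong (≋-trans (≡⇒≋ (λ m → 1ˢ ⊕ ⊖ X m) (ℕ.*-comm (suc n) 3))
                                                  (≋-sym (1-q^≋ (3 * suc n)))) ≋-refl)
  open ≋-Reasoning
  open Solver

-- Factor by factor, (1 - x)⁵ = 1 - x⁵ + 5(2x² - x - 2x³ + x⁴). The fifth power is split as cube
-- times square because the cube is later absorbed by the denominators.
frobenius-P : ∀ n → cube (P n) ⊗ (P n ⊗ P n) ≋ P n ⟨q^5⟩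
frobenius-P zero = ≋-trans
  (solve 0 (con 1ℤ :* (con 1ℤ :* con 1ℤ) :* (con 1ℤ :* con 1ℤ) := con 1ℤ) ≋-refl)
  (≋-sym (1ˢ-spread 4))
  where open Solver
frobenius-P (suc n) = begin
  cube (P (suc n)) ⊗ (P (suc n) ⊗ P (suc n))
    ≈⟨ ⊗-cong (⊗-cong (P-suc′ n) (⊗-cong (P-suc′ n) (P-suc′ n))) (⊗-cong (P-suc′ n) (P-suc′ n)) ⟩
  cube ((1ˢ ⊕ ⊖ x) ⊗ P n) ⊗ (((1ˢ ⊕ ⊖ x) ⊗ P n) ⊗ ((1ˢ ⊕ ⊖ x) ⊗ P n))
    ≈⟨ solve 2 (λ x p → let y = con 1ℤ :- x; w = y :* p in
         w :* (w :* w) :* (w :* w) :=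
         ((con 1ℤ :- x :* (x :* (x :* (x :* x)))) :+
           con (+ 5) :* (con (+ 2) :* (x :* x) :- x :- con (+ 2) :* (x :* x :* x) :+ x :* x :* x :* x))
         :* (p :* (p :* p) :* (p :* p))) ≋-refl x (P n) ⟩
  ((1ˢ ⊕ ⊖ (x ⊗ (x ⊗ (x ⊗ (x ⊗ x))))) ⊕ ((+ 5) · 1ˢ) ⊗ r) ⊗ (cube (P n) ⊗ (P n ⊗ P n))
    ≈⟨ ⊗-cong (⊕-cong (⊕-cong ≋-refl (⊖-cong (≋-sym e))) (5·≋0 r)) (frobenius-P n) ⟩
  ((1ˢ ⊕ ⊖ X (suc n * 5)) ⊕ 0ˢ) ⊗ P n ⟨q^5⟩
    ≈⟨ ⊗-cong (⊕-identityʳ _) ≋-refl ⟩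
  (1ˢ ⊕ ⊖ X (suc n * 5)) ⊗ P n ⟨q^5⟩
    ≈⟨ P-suc-spread 4 n ⟨
  P (suc n) ⟨q^5⟩ ∎
  where
  x = X (suc n)
  r = ((+ 2) · 1ˢ) ⊗ (x ⊗ x) ⊕ ⊖ x ⊕ ⊖ (((+ 2) · 1ˢ) ⊗ (x ⊗ x ⊗ x)) ⊕ x ⊗ x ⊗ x ⊗ x
  e : X (suc n * 5) ≋ x ⊗ (x ⊗ (x ⊗ (x ⊗ x)))
  e = begin
    X (suc n * 5)        ≈⟨ X-≡+ m (m + (m + (m + m))) (Nat.solve 1 (λ m → m Nat.:* Nat.con 5 Nat.:=
                              m Nat.:+ (m Nat.:+ (m Nat.:+ (m Nat.:+ m)))) refl m) ⟩
    x ⊗ X (m + (m + (m + m)))  ≈⟨ ⊗-cong ≋-refl (≋-trans (X-+ m _) (⊗-cong ≋-refl (≋-trans (X-+ m _) (⊗-cong ≋-refl (X-+ m m))))) ⟩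
    x ⊗ (x ⊗ (x ⊗ (x ⊗ x)))    ∎
    where
    m = suc n
    open ≋-Reasoning
  open ≋-Reasoning
  open Solver

-- Euler's product and the generating function modulo 5

f : Series
f n = P n n

f≋P : ∀ N → f ≋[ suc N ] P N
f≋P N = below λ n n<1+N → ≈-sym (at< (P-stable (ℕ.≤-pred n<1+N)) n (ℕ.n<1+n n))

p₃₃≋ : ∀ N → p₃₃ ≋[ suc N ] partialProduct factor N
p₃₃≋ N = below λ n n<1+N → ≈-reflexive (sym (proj₂ (p₃₃-isInfiniteProduct n) N (ℕ.≤-pred n<1+N)))

-- In f(q⁵) ≡ f(q)³ f(q)² the cube cancels the denominator of the generating function and the square
-- remains.
generatingFunction : p₃₃ ⊗ f ⟨q^5⟩ ≋ f ⊗ (f ⊗ (cube f) ⟨q^3⟩)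
generatingFunction = pointwise λ N → at< (truncated N) N (ℕ.n<1+n N)
  where
  truncated : ∀ N → p₃₃ ⊗ f ⟨q^5⟩ ≋[ suc N ] f ⊗ (f ⊗ (cube f) ⟨q^3⟩)
  truncated N = begin
    p₃₃ ⊗ f ⟨q^5⟩
      ≈⟨ ⊗-cong[] (p₃₃≋ N) (spread-cong[] 4 0 (f≋P N)) ⟩
    F ⊗ p ⟨q^5⟩
      ≈⟨ ≋⇒≋[] (⊗-cong ≋-refl (≋-sym (frobenius-P N))) ⟩
    F ⊗ (cube p ⊗ (p ⊗ p))
      ≈⟨ ≋⇒≋[] (solve 3 (λ f c p → f :* (c :* (p :* p)) := p :* (p :* (f :* c))) ≋-refl F (cube p) p) ⟩
    p ⊗ (p ⊗ (F ⊗ cube p))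
      ≈⟨ ≋⇒≋[] (⊗-cong ≋-refl (⊗-cong ≋-refl (factorProduct N))) ⟩
    p ⊗ (p ⊗ cube (p ⟨q^3⟩))
      ≈⟨ ≋⇒≋[] (⊗-cong ≋-refl (⊗-cong ≋-refl (≋-trans (⊗-cong ≋-refl (≗⇒≋ (spread-⊗ 2 0 p p)))
                                                         (≗⇒≋ (spread-⊗ 2 0 p (p ⊗ p)))))) ⟩
    p ⊗ (p ⊗ (cube p) ⟨q^3⟩)
      ≈⟨ ⊗-cong[] (f≋P N) (⊗-cong[] (f≋P N) (spread-cong[] 2 0 (⊗-cong[] (f≋P N) (⊗-cong[] (f≋P N) (f≋P N))))) ⟨
    f ⊗ (f ⊗ (cube f) ⟨q^3⟩) ∎
    where
    F = partialProduct factor N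
    p = P N
    open ≋[]-Reasoning (suc N)
    open Solver
-- Sums of finitely supported functions

sumOver : {I : Set} → List I → (I → ℤ) → ℤ
sumOver []       F = 0ℤ
sumOver (i ∷ is) F = F i ℤ.+ sumOver is F

module _ {I : Set} where

  sumOver-cong : ∀ (is : List I) {F G} → (∀ i → F i ≈ G i) → sumOver is F ≈ sumOver is G
  sumOver-cong []       F≈G = ≈-refl
  sumOver-cong (i ∷ is) F≈G = +-cong (F≈G i) (sumOver-cong is F≈G)

  sumOver-+ : ∀ (is : List I) F G →
              sumOver is (λ i → F i ℤ.+ G i) ≡ sumOver is F ℤ.+ sumOver is G
  sumOver-+ []       F G = refl
  sumOver-+ (i ∷ is) F G = trans (cong (λ x → (F i ℤ.+ G i) ℤ.+ x) (sumOver-+ is F G))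
    (identity (F i) (G i) (sumOver is F) (sumOver is G))
    where
    identity : ∀ x y u v → (x ℤ.+ y) ℤ.+ (u ℤ.+ v) ≡ (x ℤ.+ u) ℤ.+ (y ℤ.+ v)
    identity = solve-∀

  sumOver-neg : ∀ (is : List I) F → sumOver is (λ i → ℤ.- F i) ≡ ℤ.- sumOver is F
  sumOver-neg []       F = refl
  sumOver-neg (i ∷ is) F = trans (cong (λ x → ℤ.- F i ℤ.+ x) (sumOver-neg is F))
                                 (sym (ℤ.neg-distrib-+ (F i) (sumOver is F)))

  sumOver-* : ∀ (is : List I) c F → sumOver is (λ i → c ℤ.* F i) ≡ c ℤ.* sumOver is F
  sumOver-* []       c F = sym (ℤ.*-zeroʳ c)
  sumOver-* (i ∷ is) c F = trans (cong (λ x → c ℤ.* F i ℤ.+ x) (sumOver-* is c F))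
                                 (sym (ℤ.*-distribˡ-+ c (F i) (sumOver is F)))

  sumOver-zero : ∀ (is : List I) {F} → (∀ {i} → i ∈ is → F i ≈ 0ℤ) → sumOver is F ≈ 0ℤ
  sumOver-zero []       F≈0 = ≈-refl
  sumOver-zero (i ∷ is) F≈0 = +-cong (F≈0 (here refl)) (sumOver-zero is (F≈0 ∘ there))

  -- Removal of one occurrence of x from a list; it serves to match the entries of two lists one at
  -- a time.
  record Extraction (F : I → ℤ) (x : I) (xs : List I) : Set where
    field
      rest   : List I
      unique : Unique rest
      sum    : sumOver xs F ≡ F x ℤ.+ sumOver rest F
      fresh  : ¬ x ∈ rest
      subset : ∀ {y} → y ∈ rest → y ∈ xs
      split  : ∀ {y} → y ∈ xs → y ≡ x ⊎ y ∈ rest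

  extract : ∀ F {x xs} → Unique xs → x ∈ xs → Extraction F x xs
  extract F (x≢ ∷ u) (here refl) = record
    { rest   = _
    ; unique = u
    ; sum    = refl
    ; fresh  = λ x∈ → All.lookup x≢ x∈ refl
    ; subset = there
    ; split  = λ { (here eq) → inj₁ eq ; (there y∈) → inj₂ y∈ }
    }
  extract F {x} {z ∷ xs} (z≢ ∷ u) (there x∈) = record
    { rest   = z ∷ rest
    ; unique = All.tabulate (λ y∈ → All.lookup z≢ (subset y∈)) ∷ unique
    ; sum    = trans (cong (λ s → F z ℤ.+ s) sum) (identity (F z) (F x) (sumOver rest F))
    ; fresh  = λ { (here refl) → All.lookup z≢ x∈ refl ; (there x∈) → fresh x∈ }
    ; subset = λ { (here eq) → here eq ; (there y∈) → there (subset y∈) }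
    ; split  = λ { (here eq) → inj₂ (here eq)
                 ; (there y∈) → Sum.map₂ there (split y∈) }
    }
    where
    open Extraction (extract F u x∈)
    identity : ∀ x y z → x ℤ.+ (y ℤ.+ z) ≡ y ℤ.+ (x ℤ.+ z)
    identity = solve-∀

  -- Induction on xs, deleting each nonvanishing entry from both lists. This makes the value of a
  -- finitely supported sum independent of the list chosen.
  sumOver-unique : ∀ F {xs ys : List I} → Unique xs → Unique ys →
    (∀ {x} → x ∈ xs → x ∈ ys ⊎ F x ≈ 0ℤ) → (∀ {y} → y ∈ ys → y ∈ xs ⊎ F y ≈ 0ℤ) →
    sumOver xs F ≈ sumOver ys F
  sumOver-unique F {[]} {ys} _ _ _ ys⊆ =
    ≈-sym (sumOver-zero ys (λ y∈ → Sum.[ (λ ()) , id ] (ys⊆ y∈)))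
  sumOver-unique F {x ∷ xs} {ys} (x≢ ∷ u) v xs⊆ ys⊆ with xs⊆ (here refl)
  -- The entry x may still occur in ys; there it is reclassified as a vanishing term, so that ys
  -- stays unchanged.
  ... | inj₂ Fx≈0 = ≈-trans (+-cong Fx≈0 (sumOver-unique F u v (xs⊆ ∘ there) ys⊆xs))
                            (≈-reflexive (ℤ.+-identityˡ _))
    where
    ys⊆xs : ∀ {y} → y ∈ ys → y ∈ xs ⊎ F y ≈ 0ℤ
    ys⊆xs y∈ with ys⊆ y∈
    ... | inj₁ (here refl) = inj₂ Fx≈0
    ... | inj₁ (there y∈xs) = inj₁ y∈xs
    ... | inj₂ Fy≈0 = inj₂ Fy≈0
  ... | inj₁ x∈ys = ≈-trans (+-cong (≈-refl {F x}) (sumOver-unique F u unique xs⊆rest rest⊆xs))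
                            (≈-reflexive (sym sum))
    where
    open Extraction (extract F v x∈ys)
    xs⊆rest : ∀ {y} → y ∈ xs → y ∈ rest ⊎ F y ≈ 0ℤ
    xs⊆rest y∈ with xs⊆ (there y∈)
    ... | inj₂ Fy≈0 = inj₂ Fy≈0
    ... | inj₁ y∈ys with split y∈ys
    ...   | inj₁ refl    = contradiction refl (All.lookup x≢ y∈)
    ...   | inj₂ y∈rest  = inj₁ y∈rest
    rest⊆xs : ∀ {y} → y ∈ rest → y ∈ xs ⊎ F y ≈ 0ℤ
    rest⊆xs y∈ with ys⊆ (subset y∈)
    ... | inj₁ (here refl) = contradiction y∈ fresh
    ... | inj₁ (there y∈xs) = inj₁ y∈xs
    ... | inj₂ Fy≈0 = inj₂ Fy≈0

  -- Finite support up to congruence: the list may also contain indices at which F vanishes, but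
  -- outside it F is 0 modulo 5.
  record Enumeration (F : I → ℤ) : Set where
    field
      support : List I
      unique  : Unique support
      covers  : ∀ i → i ∈ support ⊎ F i ≈ 0ℤ

  open Enumeration public

  total : {F : I → ℤ} → Enumeration F → ℤ
  total {F} E = sumOver (support E) F

  total-cong : ∀ {F G} (E : Enumeration F) (E′ : Enumeration G) → (∀ i → F i ≈ G i) → total E ≈ total E′
  total-cong {F} {G} E E′ F≈G = ≈-trans (sumOver-cong (support E) F≈G)
    (sumOver-unique G (unique E) (unique E′)
      (λ {x} _ → covers E′ x)
      (λ {y} _ → Sum.map₂ (≈-trans (≈-sym (F≈G y))) (covers E y)))

  restrict : ∀ {F G} → Enumeration F → (∀ i → F i ≈ 0ℤ → G i ≈ 0ℤ) → Enumeration G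
  restrict E F⇒G = record
    { support = support E ; unique = unique E ; covers = λ i → Sum.map₂ (F⇒G i) (covers E i) }

-- Change of variables along an injection ψ whose image contains all indices with nonvanishing term.
-- In the applications, congruence conditions on the support say exactly that ψ reaches it.
module _ {I J : Set} {F : I → ℤ} (E : Enumeration F) (ψ : J → I)
         (ψ-injective : ∀ {j j′} → ψ j ≡ ψ j′ → j ≡ j′)
         (preimage : ∀ i → F i ≈ 0ℤ ⊎ ∃ λ j → ψ j ≡ i) where

  private
    preimages : List I → List J
    preimages []       = []
    preimages (i ∷ is) with preimage i
    ... | inj₁ _       = preimages is
    ... | inj₂ (j , _) = j ∷ preimages is

    ∈-preimages⁻ : ∀ is {j} → j ∈ preimages is → ψ j ∈ is
    ∈-preimages⁻ (i ∷ is) j∈ with preimage i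
    ... | inj₁ _ = there (∈-preimages⁻ is j∈)
    ∈-preimages⁻ (i ∷ is) (here refl) | inj₂ (j , ψj≡i) = here ψj≡i
    ∈-preimages⁻ (i ∷ is) (there j∈)  | inj₂ (j , ψj≡i) = there (∈-preimages⁻ is j∈)

    ∈-preimages⁺ : ∀ is j → ψ j ∈ is → j ∈ preimages is ⊎ F (ψ j) ≈ 0ℤ
    ∈-preimages⁺ (i ∷ is) j ψj∈ with preimage i
    ∈-preimages⁺ (i ∷ is) j (here refl) | inj₁ Fi≈0        = inj₂ Fi≈0
    ∈-preimages⁺ (i ∷ is) j (here refl) | inj₂ (j′ , ψj′≡) = inj₁ (here (ψ-injective (sym ψj′≡)))
    ∈-preimages⁺ (i ∷ is) j (there ψj∈) | inj₁ _           = ∈-preimages⁺ is j ψj∈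
    ∈-preimages⁺ (i ∷ is) j (there ψj∈) | inj₂ _           = Sum.map₁ there (∈-preimages⁺ is j ψj∈)

    preimages-unique : ∀ {is} → Unique is → Unique (preimages is)
    preimages-unique []                 = []
    preimages-unique {i ∷ is} (i≢ ∷ u) with preimage i
    ... | inj₁ _          = preimages-unique u
    ... | inj₂ (j , refl) =
      All.tabulate (λ j′∈ j≡j′ → All.lookup i≢ (∈-preimages⁻ is j′∈) (cong ψ j≡j′)) ∷ preimages-unique u

    sumOver-preimages : ∀ is → sumOver is F ≈ sumOver (preimages is) (F ∘ ψ)
    sumOver-preimages []       = ≈-refl
    sumOver-preimages (i ∷ is) with preimage i
    ... | inj₁ Fi≈0       = ≈-trans (+-cong Fi≈0 (sumOver-preimages is)) (≈-reflexive (ℤ.+-identityˡ _))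
    ... | inj₂ (j , refl) = +-cong (≈-refl {F i}) (sumOver-preimages is)

  reindex : Enumeration (F ∘ ψ)
  reindex = record
    { support = preimages (support E)
    ; unique  = preimages-unique (unique E)
    ; covers  = λ j → Sum.[ ∈-preimages⁺ (support E) j , inj₂ ]′ (covers E (ψ j))
    }

  total-reindex : total E ≈ total reindex
  total-reindex = sumOver-preimages (support E)

-- Theta series

sumSeries : {I : Set} → List I → (I → Series) → Series
sumSeries []       F = 0ˢ
sumSeries (i ∷ is) F = F i ⊕ sumSeries is F

-- The assertion that a is the sum of w i q^(e i) over the infinite set I, in which each exponent
-- occurs finitely often. The lists may also contain indices with larger exponents, as happens for
-- products.
record Theta {I : Set} (a : Series) (e : I → ℕ) (w : I → ℤ) : Set where
  field
    indices  : ℕ → List I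
    distinct : ∀ n → Unique (indices n)
    complete : ∀ n i → e i ≤ n → i ∈ indices n
    expand   : ∀ n → a ≋[ suc n ] sumSeries (indices n) (λ i → w i · X (e i))

open Theta

X-≢ : ∀ e n → e ≢ n → X e n ≡ 0ℤ
X-≢ e n e≢n with n ℕ.≡ᵇ e in eq
... | false = refl
... | true  = contradiction (sym (ℕ.≡ᵇ⇒≡ n e (subst T (sym eq) _))) e≢n

opaque
  unfolding _⊗_

  sumSeries-at : ∀ {I : Set} (is : List I) (w : I → ℤ) (e : I → ℕ) n →
    sumSeries is (λ i → w i · X (e i)) n ≡ sumOver is (λ i → w i ℤ.* X (e i) n)
  sumSeries-at []       w e n = refl
  sumSeries-at (i ∷ is) w e n = cong (λ x → w i ℤ.* X (e i) n ℤ.+ x) (sumSeries-at is w e n)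

  ·-assoc : ∀ c d a → (c ℤ.* d) · a ≋ c · (d · a)
  ·-assoc c d a = ≗⇒≋ λ n → ℤ.*-assoc c d (a n)

spread-sumSeries : ∀ {I : Set} k (is : List I) (w : I → ℤ) (e : I → ℕ) →
  spread k 0 (sumSeries is (λ i → w i · X (e i))) ≋ sumSeries is (λ i → w i · X (e i * suc k))
spread-sumSeries k []       w e = ≗⇒≋ (spread-0ˢ k 0)
spread-sumSeries k (i ∷ is) w e = ≋-trans (≗⇒≋ (spread-⊕ k 0 _ _))
  (⊕-cong (≋-trans (≗⇒≋ (spread-· k 0 (w i) (X (e i)))) (·-cong (≗⇒≋ (spread-X k 0 (e i)))))
          (spread-sumSeries k is w e))

·X⊗·X : ∀ c d m n → (c · X m) ⊗ (d · X n) ≋ (c ℤ.* d) · X (m + n)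
·X⊗·X c d m n = begin
  (c · X m) ⊗ (d · X n)       ≈⟨ ≗⇒≋ (·-⊗ c (X m) (d · X n)) ⟩
  c · (X m ⊗ (d · X n))       ≈⟨ ·-cong (≗⇒≋ (⊗-comm (X m) (d · X n))) ⟩
  c · ((d · X n) ⊗ X m)       ≈⟨ ·-cong (≗⇒≋ (·-⊗ d (X n) (X m))) ⟩
  c · (d · (X n ⊗ X m))       ≈⟨ ≋-sym (·-assoc c d (X n ⊗ X m)) ⟩
  (c ℤ.* d) · (X n ⊗ X m)     ≈⟨ ·-cong (≗⇒≋ (⊗-comm (X n) (X m))) ⟩
  (c ℤ.* d) · (X m ⊗ X n)     ≈⟨ ·-cong (≋-sym (X-+ m n)) ⟩
  (c ℤ.* d) · X (m + n)       ∎
  where open ≋-Reasoning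

module _ {I J : Set} (w : I → ℤ) (e : I → ℕ) (w′ : J → ℤ) (e′ : J → ℕ) where

  private
    term : I × J → Series
    term (i , j) = (w i ℤ.* w′ j) · X (e i + e′ j)

  sumSeries-pair : ∀ i js rest →
    (w i · X (e i)) ⊗ sumSeries js (λ j → w′ j · X (e′ j)) ⊕ sumSeries rest term ≋
    sumSeries (List.map (i ,_) js List.++ rest) term
  sumSeries-pair i []       rest = solve 2 (λ x y → x :* con 0ℤ :+ y := y) ≋-refl (w i · X (e i)) (sumSeries rest term)
    where open Solver
  sumSeries-pair i (j ∷ js) rest = ≋-trans
    (solve 4 (λ x y z u → x :* (y :+ z) :+ u := x :* y :+ (x :* z :+ u)) ≋-refl
      (w i · X (e i)) (w′ j · X (e′ j)) (sumSeries js (λ j → w′ j · X (e′ j))) (sumSeries rest term))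
    (⊕-cong (·X⊗·X (w i) (w′ j) (e i) (e′ j)) (sumSeries-pair i js rest))
    where open Solver

  sumSeries-⊗ : ∀ is js →
    sumSeries is (λ i → w i · X (e i)) ⊗ sumSeries js (λ j → w′ j · X (e′ j)) ≋
    sumSeries (List.cartesianProduct is js) term
  sumSeries-⊗ []       js = solve 1 (λ y → con 0ℤ :* y := con 0ℤ) ≋-refl (sumSeries js (λ j → w′ j · X (e′ j)))
    where open Solver
  sumSeries-⊗ (i ∷ is) js = ≋-trans
    (solve 3 (λ x y z → (x :+ y) :* z := x :* z :+ y :* z) ≋-refl
      (w i · X (e i)) (sumSeries is (λ i → w i · X (e i))) (sumSeries js (λ j → w′ j · X (e′ j))))
    (≋-trans (⊕-cong ≋-refl (sumSeries-⊗ is js)) (sumSeries-pair i js (List.cartesianProduct is js)))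
    where open Solver

theta-⊗ : ∀ {I J : Set} {a b} {e : I → ℕ} {e′ : J → ℕ} {w w′} →
  Theta a e w → Theta b e′ w′ →
  Theta (a ⊗ b) (λ (i , j) → e i + e′ j) (λ (i , j) → w i ℤ.* w′ j)
theta-⊗ {e = e} {e′} {w} {w′} A B = record
  { indices  = λ n → List.cartesianProduct (indices A n) (indices B n)
  ; distinct = λ n → Unique.cartesianProduct⁺ (distinct A n) (distinct B n)
  ; complete = λ n (i , j) e≤n → ∈-cartesianProduct⁺
      (complete A n i (ℕ.m+n≤o⇒m≤o (e i) e≤n)) (complete B n j (ℕ.m+n≤o⇒n≤o (e i) e≤n))
  ; expand   = λ n → ≋[]-trans (⊗-cong[] (expand A n) (expand B n))
      (≋⇒≋[] (sumSeries-⊗ w e w′ e′ (indices A n) (indices B n)))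
  }

theta-spread : ∀ {I : Set} {a} {e : I → ℕ} {w} k → Theta a e w →
  Theta (spread k 0 a) (λ i → e i * suc k) w
theta-spread {e = e} {w} k A = record
  { indices  = indices A
  ; distinct = distinct A
  ; complete = λ n i e≤n → complete A n i (ℕ.≤-trans (ℕ.m≤m*n (e i) (suc k)) e≤n)
  ; expand   = λ n → ≋[]-trans (spread-cong[] k 0 (expand A n)) (≋⇒≋[] (spread-sumSeries k (indices A n) w e))
  }

module _ {I : Set} {a} {e : I → ℕ} {w} (A : Theta a e w) where

  -- The support depends only on the exponents, so the same theta series enumerates sums with
  -- other weights.
  enumerate : ∀ n (v : I → ℤ) → Enumeration (λ i → v i ℤ.* X (e i) n)
  enumerate n v = record
    { support = indices A n
    ; unique  = distinct A n
    ; covers  = λ i → cover i (e i ℕ.≤? n)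
    }
    where
    cover : ∀ i → Dec (e i ≤ n) → i ∈ indices A n ⊎ v i ℤ.* X (e i) n ≈ 0ℤ
    cover i (yes e≤n) = inj₁ (complete A n i e≤n)
    cover i (no e≰n)  = inj₂ (≈-reflexive (trans (cong (v i ℤ.*_) (X-≢ (e i) n (λ e≡n → e≰n (ℕ.≤-reflexive e≡n))))
                                                 (ℤ.*-zeroʳ (v i))))

  coefficient : ∀ n → a n ≈ total (enumerate n w)
  coefficient n = begin
    a n                                                  ≈⟨ at< (expand A n) n (ℕ.n<1+n n) ⟩
    sumSeries (indices A n) (λ i → w i · X (e i)) n      ≡⟨ sumSeries-at (indices A n) w e n ⟩
    sumOver (indices A n) (λ i → w i ℤ.* X (e i) n)      ∎
    where open ≈-Reasoning

-- The theta series f = (q; q)_∞ and f³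

sgn : ℕ → ℤ
sgn zero    = 1ℤ
sgn (suc n) = ℤ.- sgn n

sgnℤ : ℤ → ℤ
sgnℤ (+ n)    = sgn n
sgnℤ -[1+ n ] = sgn (suc n)

-- The generalised pentagonal number i(3i+1)/2 without division; the clauses follow the two
-- monomials of `pentagonalTerms`.
pent : ℤ → ℕ
pent (+ n)    = n * n + tri n
pent -[1+ n ] = suc n * n + tri (suc n)

triℤ : ℤ → ℕ
triℤ (+ n)    = tri n
triℤ -[1+ n ] = tri n

-- The range from -n to n - 1 is stable under k ↦ -1-k, as Jacobi's sum requires. For the pentagonal
-- sum it contains one extra index, whose exponent lies beyond the truncation.
symmetric : ℕ → List ℤ
symmetric zero    = []
symmetric (suc n) = + n ∷ -[1+ n ] ∷ symmetric n

∈-symmetric⁻ : ∀ n {i} → i ∈ symmetric n → ∃ λ m → m < n × (i ≡ + m ⊎ i ≡ -[1+ m ])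
∈-symmetric⁻ (suc n) (here refl)         = n , ℕ.n<1+n n , inj₁ refl
∈-symmetric⁻ (suc n) (there (here refl)) = n , ℕ.n<1+n n , inj₂ refl
∈-symmetric⁻ (suc n) (there (there i∈))  =
  let m , m<n , eq = ∈-symmetric⁻ n i∈ in m , ℕ.m<n⇒m<1+n m<n , eq

+∈-symmetric : ∀ {m n} → m < n → + m ∈ symmetric n
+∈-symmetric {m} {suc n} (s≤s m≤n) with ℕ.m≤n⇒m<n∨m≡n m≤n
... | inj₂ refl = here refl
... | inj₁ m<n  = there (there (+∈-symmetric m<n))

-∈-symmetric : ∀ {m n} → m < n → -[1+ m ] ∈ symmetric n
-∈-symmetric {m} {suc n} (s≤s m≤n) with ℕ.m≤n⇒m<n∨m≡n m≤n
... | inj₂ refl = there (here refl)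
... | inj₁ m<n  = there (there (-∈-symmetric m<n))

symmetric-unique : ∀ n → Unique (symmetric n)
symmetric-unique zero    = []
symmetric-unique (suc n) =
  ((λ ()) ∷ All.tabulate (λ i∈ eq → new₊ (∈-symmetric⁻ n i∈) eq)) ∷
  All.tabulate (λ i∈ eq → new₋ (∈-symmetric⁻ n i∈) eq) ∷ symmetric-unique n
  where
  new₊ : ∀ {i} → (∃ λ m → m < n × (i ≡ + m ⊎ i ≡ -[1+ m ])) → + n ≢ i
  new₊ (m , m<n , inj₁ refl) refl = ℕ.<-irrefl refl m<n
  new₊ (m , m<n , inj₂ refl) ()
  new₋ : ∀ {i} → (∃ λ m → m < n × (i ≡ + m ⊎ i ≡ -[1+ m ])) → -[1+ n ] ≢ i
  new₋ (m , m<n , inj₁ refl) ()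
  new₋ (m , m<n , inj₂ refl) refl = ℕ.<-irrefl refl m<n

symmetric-complete : (e : ℤ → ℕ) → (∀ m → m ≤ e (+ m)) → (∀ m → m ≤ e -[1+ m ]) →
  ∀ n i → e i ≤ n → i ∈ symmetric (suc n)
symmetric-complete e e₊ e₋ n (+ m)    e≤n = +∈-symmetric (s≤s (ℕ.≤-trans (e₊ m) e≤n))
symmetric-complete e e₊ e₋ n -[1+ m ] e≤n = -∈-symmetric (s≤s (ℕ.≤-trans (e₋ m) e≤n))

m<pent[-1-m] : ∀ m → m < pent -[1+ m ]
m<pent[-1-m] m = ℕ.≤-trans (s≤s (ℕ.m≤m+n m (tri m))) (ℕ.m≤n+m (suc (m + tri m)) (suc m * m))

pent-complete : ∀ n i → pent i ≤ n → i ∈ symmetric (suc n)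
pent-complete = symmetric-complete pent
  (λ m → ℕ.≤-trans (n≤tri[n] m) (ℕ.m≤n+m (tri m) (m * m))) (λ m → ℕ.<⇒≤ (m<pent[-1-m] m))

sign≋ : ∀ n → sign n ≋ sgn n · 1ˢ
sign≋ zero    = ≋-sym (1·≋ 1ˢ)
sign≋ (suc n) = ≋-trans (⊖-cong (sign≋ n)) (≋-sym (constant-neg (sgn n)))

sign⊗ : ∀ n a → sign n ⊗ a ≋ sgn n · a
sign⊗ n a = ≋-trans (⊗-cong (sign≋ n) ≋-refl) (≋-sym (·≋⊗ (sgn n) a))

pentagonalSum≋ : ∀ n → sumSeries (symmetric (suc n)) (λ i → sgnℤ i · X (pent i)) ≋
                       pentagonalSum n ⊕ sgnℤ -[1+ n ] · X (pent -[1+ n ])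
pentagonalSum≋ zero    = ≋-trans (⊕-cong (1·≋ 1ˢ) ≋-refl)
  (solve 1 (λ x → con 1ℤ :+ (x :+ con 0ℤ) := con 1ℤ :+ x) ≋-refl (sgnℤ -[1+ 0 ] · X (pent -[1+ 0 ])))
  where open Solver
pentagonalSum≋ (suc n) = begin
  u ⊕ (v ⊕ sumSeries (symmetric (suc n)) (λ i → sgnℤ i · X (pent i)))
    ≈⟨ ⊕-cong ≋-refl (⊕-cong ≋-refl (pentagonalSum≋ n)) ⟩
  u ⊕ (v ⊕ (pentagonalSum n ⊕ v′))
    ≈⟨ solve 4 (λ u v v′ p → u :+ (v :+ (p :+ v′)) := p :+ (u :+ v′) :+ v) ≋-refl u v v′ (pentagonalSum n) ⟩
  pentagonalSum n ⊕ (u ⊕ v′) ⊕ v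
    ≈⟨ ⊕-cong (⊕-cong ≋-refl (≋-sym (≋-trans
         (solve 3 (λ s x y → s :* (x :+ y) := s :* x :+ s :* y) ≋-refl (sign (suc n)) (X (pent (+ suc n))) (X (pent -[1+ n ])))
         (⊕-cong (sign⊗ (suc n) _) (sign⊗ (suc n) _))))) ≋-refl ⟩
  pentagonalSum (suc n) ⊕ v ∎
  where
  u = sgnℤ (+ suc n) · X (pent (+ suc n))
  v = sgnℤ -[1+ suc n ] · X (pent -[1+ suc n ])
  v′ = sgnℤ -[1+ n ] · X (pent -[1+ n ])
  open ≋-Reasoning
  open Solver

f-theta : Theta f pent sgnℤ
f-theta = record
  { indices  = symmetric ∘ suc
  ; distinct = symmetric-unique ∘ suc
  ; complete = pent-complete
  ; expand   = λ n → ≋[]-trans (f≋P n) (≋[]-trans (euler n) (≋[]-sym (≋[]-trans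
      (≋⇒≋[] (pentagonalSum≋ n))
      (≋[]-trans (⊕-cong[] ≋[]-refl (·-cong[] (X≋0 (pent -[1+ n ]) (m<pent[-1-m] n))))
                 (≋⇒≋[] (≋-trans (⊕-cong ≋-refl (·0ˢ (sgnℤ -[1+ n ]))) (⊕-identityʳ _)))))))
  }
  where
  opaque
    unfolding _⊗_
    ·0ˢ : ∀ c → c · 0ˢ ≋ 0ˢ
    ·0ˢ c = ≗⇒≋ λ _ → ℤ.*-zeroʳ c

oddℤ : ℤ → ℤ
oddℤ k = + 2 ℤ.* k ℤ.+ 1ℤ

odd≋ : ∀ k → odd k ≋ oddℤ (+ k) · 1ˢ
odd≋ zero    = ≋-sym (1·≋ 1ˢ)
odd≋ (suc k) = ≋-trans (⊕-cong (odd≋ k) ≋-refl)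
  (≋-trans (≋-sym (constant-+ (oddℤ (+ k)) (+ 2))) (≡⇒≋ℤ (identity (+ k))))
  where
  ≡⇒≋ℤ : ∀ {c d} → c ≡ d → c · 1ˢ ≋ d · 1ˢ
  ≡⇒≋ℤ refl = ≋-refl
  identity : ∀ k → (+ 2 ℤ.* k ℤ.+ 1ℤ) ℤ.+ + 2 ≡ + 2 ℤ.* (1ℤ ℤ.+ k) ℤ.+ 1ℤ
  identity = solve-∀

-- Pairing k with -1-k doubles Jacobi's sum; the factor 3 is 1/2 modulo 5.
cubeWeight : ℤ → ℤ
cubeWeight k = + 3 ℤ.* (sgnℤ k ℤ.* oddℤ k)

opaque
  unfolding _⊗_

  cubeTerms : ∀ k → odd k ⊗ (sign k ⊗ X (tri k)) ≋
    cubeWeight (+ k) · X (tri k) ⊕ cubeWeight -[1+ k ] · X (tri k)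
  cubeTerms k = ≋-trans (⊗-cong (odd≋ k) (sign⊗ k (X (tri k))))
    (≋-trans (≋-sym (·≋⊗ (oddℤ (+ k)) (sgn k · X (tri k))))
      (pointwise λ n → mod (ℤ.- (oddℤ (+ k) ℤ.* (sgn k ℤ.* X (tri k) n))) (identity (+ k) (sgn k) (X (tri k) n))))
    where
    identity : ∀ k s x → (+ 2 ℤ.* k ℤ.+ 1ℤ) ℤ.* (s ℤ.* x) ≡
      (+ 3 ℤ.* (s ℤ.* (+ 2 ℤ.* k ℤ.+ 1ℤ)) ℤ.* x ℤ.+
       + 3 ℤ.* ((ℤ.- s) ℤ.* (+ 2 ℤ.* (ℤ.- (1ℤ ℤ.+ k)) ℤ.+ 1ℤ)) ℤ.* x) ℤ.+
      (ℤ.- ((+ 2 ℤ.* k ℤ.+ 1ℤ) ℤ.* (s ℤ.* x))) ℤ.* + 5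
    identity = solve-∀

jacobiSum≋ : ∀ n → sumSeries (symmetric n) (λ i → cubeWeight i · X (triℤ i)) ≋ jacobiSum n
jacobiSum≋ zero    = ≋-refl
jacobiSum≋ (suc n) = begin
  u ⊕ (v ⊕ sumSeries (symmetric n) (λ i → cubeWeight i · X (triℤ i)))
    ≈⟨ ⊕-cong ≋-refl (⊕-cong ≋-refl (jacobiSum≋ n)) ⟩
  u ⊕ (v ⊕ jacobiSum n)
    ≈⟨ solve 3 (λ u v p → u :+ (v :+ p) := p :+ (u :+ v)) ≋-refl u v (jacobiSum n) ⟩
  jacobiSum n ⊕ (u ⊕ v)
    ≈⟨ ⊕-cong ≋-refl (≋-sym (cubeTerms n)) ⟩
  jacobiSum (suc n) ∎
  where
  u = cubeWeight (+ n) · X (tri n)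
  v = cubeWeight -[1+ n ] · X (tri n)
  open ≋-Reasoning
  open Solver

f³-theta : Theta (cube f) triℤ cubeWeight
f³-theta = record
  { indices  = symmetric ∘ suc
  ; distinct = symmetric-unique ∘ suc
  ; complete = symmetric-complete triℤ n≤tri[n] n≤tri[n]
  ; expand   = λ n → ≋[]-trans (⊗-cong[] (f≋P n) (⊗-cong[] (f≋P n) (f≋P n)))
      (≋[]-trans (jacobi n) (≋⇒≋[] (≋-sym (jacobiSum≋ (suc n)))))
  }

A : Series
A n = sumOver (symmetric (suc n)) (λ i → sgnℤ i ℤ.* (+ 6 ℤ.* i ℤ.+ 1ℤ) ℤ.* X (pent i) n)

A-theta : Theta A pent (λ i → sgnℤ i ℤ.* (+ 6 ℤ.* i ℤ.+ 1ℤ))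
A-theta = record
  { indices  = symmetric ∘ suc
  ; distinct = symmetric-unique ∘ suc
  ; complete = pent-complete
  ; expand   = λ n → below λ m m<1+n → expansion n m (ℕ.≤-pred m<1+n)
  }
  where
  w : ℤ → ℤ
  w i = sgnℤ i ℤ.* (+ 6 ℤ.* i ℤ.+ 1ℤ)
  -- `A` takes its coefficient of q^m from the list for m, while the expansion modulo q^(n+1) uses
  -- the longer list for n.
  larger : ∀ n m → m ≤ n → Enumeration (λ i → w i ℤ.* X (pent i) m)
  larger n m m≤n = record
    { support = symmetric (suc n)
    ; unique  = symmetric-unique (suc n)
    ; covers  = λ i → cover i (pent i ℕ.≤? n)
    }
    where
    cover : ∀ i → Dec (pent i ≤ n) → i ∈ symmetric (suc n) ⊎ w i ℤ.* X (pent i) m ≈ 0ℤ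
    cover i (yes p≤n) = inj₁ (pent-complete n i p≤n)
    cover i (no p≰n)  = inj₂ (≈-reflexive (trans
      (cong (w i ℤ.*_) (X-≢ (pent i) m (λ p≡m → p≰n (ℕ.≤-trans (ℕ.≤-reflexive p≡m) m≤n))))
      (ℤ.*-zeroʳ (w i))))
  expansion : ∀ n m → m ≤ n → A m ≈ sumSeries (symmetric (suc n)) (λ i → w i · X (pent i)) m
  expansion n m m≤n = begin
    A m                                                            ≈⟨ total-cong (enumerate f-theta m w) (larger n m m≤n) (λ i → ≈-refl {w i ℤ.* X (pent i) m}) ⟩
    sumOver (symmetric (suc n)) (λ i → w i ℤ.* X (pent i) m)       ≡⟨ sumSeries-at (symmetric (suc n)) w pent m ⟨
    sumSeries (symmetric (suc n)) (λ i → w i · X (pent i)) m       ∎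
    where open ≈-Reasoning
-- Symmetries of sums

≈-*0 : ∀ {x} y → x ≈ 0ℤ → x ℤ.* y ≈ 0ℤ
≈-*0 y x≈0 = ≈-trans (*-cong x≈0 (≈-refl {y})) (≈-reflexive (ℤ.*-zeroˡ y))

-- 2 is invertible modulo 5, with inverse 3.
x≈-x⇒x≈0 : ∀ {x} → x ≈ ℤ.- x → x ≈ 0ℤ
x≈-x⇒x≈0 {x} x≈-x = begin
  x                                      ≈⟨ mod (ℤ.- x) (identity x) ⟩
  + 3 ℤ.* (x ℤ.+ x)                      ≈⟨ *-cong (≈-refl {+ 3}) (+-cong x≈-x (≈-refl {x})) ⟩
  + 3 ℤ.* (ℤ.- x ℤ.+ x)                  ≡⟨ cong (+ 3 ℤ.*_) (ℤ.+-inverseˡ x) ⟩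
  0ℤ                                     ∎
  where
  open ≈-Reasoning
  identity : ∀ x → x ≡ + 3 ℤ.* (x ℤ.+ x) ℤ.+ (ℤ.- x) ℤ.* + 5
  identity = solve-∀

module _ {I : Set} {F : I → ℤ} (E : Enumeration F)
         (σ : I → I) (σ-involutive : ∀ i → σ (σ i) ≡ i) where

  private
    σ-injective : ∀ {i j} → σ i ≡ σ j → i ≡ j
    σ-injective {i} {j} eq = trans (sym (σ-involutive i)) (trans (cong σ eq) (σ-involutive j))

  total-antisymmetric : (∀ i → F (σ i) ≈ ℤ.- F i) → total E ≈ 0ℤ
  total-antisymmetric F∘σ≈-F = x≈-x⇒x≈0 (begin
    total E                             ≈⟨ total-reindex E σ σ-injective σ-preimage ⟩
    total (reindex E σ σ-injective σ-preimage)
                                        ≈⟨ total-cong (reindex E σ σ-injective σ-preimage)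
                                             (restrict E (λ i → -‿cong {F i} {0ℤ})) F∘σ≈-F ⟩
    sumOver (support E) (λ i → ℤ.- F i) ≡⟨ sumOver-neg (support E) F ⟩
    ℤ.- total E                         ∎)
    where
    open ≈-Reasoning
    σ-preimage : ∀ i → F i ≈ 0ℤ ⊎ ∃ λ j → σ j ≡ i
    σ-preimage i = inj₂ (σ i , σ-involutive i)

  -- On the support of F, c and c ∘ σ add up to 1, and σ carries one half of the sum to the other.
  total-fold : (c : I → ℤ) → (∀ i → F (σ i) ≈ F i) → (∀ i → F i ≈ F i ℤ.* (c i ℤ.+ c (σ i))) →
    total E ≈ + 2 ℤ.* sumOver (support E) (λ i → F i ℤ.* c i)
  total-fold c F∘σ≈F F≈ = begin
    total E
      ≈⟨ sumOver-cong xs (λ i → ≈-trans (F≈ i) (≈-reflexive (ℤ.*-distribˡ-+ (F i) (c i) (c (σ i))))) ⟩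
    sumOver xs (λ i → F i ℤ.* c i ℤ.+ F i ℤ.* c (σ i))
      ≡⟨ sumOver-+ xs (λ i → F i ℤ.* c i) (λ i → F i ℤ.* c (σ i)) ⟩
    S ℤ.+ sumOver xs (λ i → F i ℤ.* c (σ i))
      ≈⟨ +-cong (≈-refl {S}) (total-cong (restrict E (λ i → ≈-*0 (c (σ i)))) (reindex Ec σ σ-injective σ-preimage)
           (λ i → *-cong (≈-sym (F∘σ≈F i)) (≈-refl {c (σ i)}))) ⟩
    S ℤ.+ total (reindex Ec σ σ-injective σ-preimage)
      ≈⟨ +-cong (≈-refl {S}) (≈-sym (total-reindex Ec σ σ-injective σ-preimage)) ⟩
    S ℤ.+ S
      ≡⟨ identity S ⟩
    + 2 ℤ.* S ∎
    where
    open ≈-Reasoning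
    xs = support E
    S = sumOver xs (λ i → F i ℤ.* c i)
    Ec : Enumeration (λ i → F i ℤ.* c i)
    Ec = restrict E (λ i → ≈-*0 (c i))
    σ-preimage : ∀ i → F i ℤ.* c i ≈ 0ℤ ⊎ ∃ λ j → σ j ≡ i
    σ-preimage i = inj₂ (σ i , σ-involutive i)
    identity : ∀ x → x ℤ.+ x ≡ + 2 ℤ.* x
    identity = solve-∀

-- Signs and exponents

sgn-⊖ : ∀ m n → sgnℤ (m ℤ.⊖ n) ≡ sgn m ℤ.* sgn n
sgn-⊖ zero    zero    = refl
sgn-⊖ (suc m) zero    = sym (ℤ.*-identityʳ (sgn (suc m)))
sgn-⊖ zero    (suc n) = sym (ℤ.*-identityˡ (sgn (suc n)))
sgn-⊖ (suc m) (suc n) = trans (cong sgnℤ (ℤ.[1+m]⊖[1+n]≡m⊖n m n))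
  (trans (sgn-⊖ m n) (identity (sgn m) (sgn n)))
  where
  identity : ∀ x y → x ℤ.* y ≡ (ℤ.- x) ℤ.* (ℤ.- y)
  identity = solve-∀

sgn-+ : ∀ m n → sgn (m + n) ≡ sgn m ℤ.* sgn n
sgn-+ zero    n = sym (ℤ.*-identityˡ (sgn n))
sgn-+ (suc m) n = trans (cong ℤ.-_ (sgn-+ m n)) (ℤ.neg-distribˡ-* (sgn m) (sgn n))

sgnℤ-+ : ∀ i j → sgnℤ (i ℤ.+ j) ≡ sgnℤ i ℤ.* sgnℤ j
sgnℤ-+ (+ m)    (+ n)    = sgn-+ m n
sgnℤ-+ (+ m)    -[1+ n ] = sgn-⊖ m (suc n)
sgnℤ-+ -[1+ m ] (+ n)    = trans (sgn-⊖ n (suc m)) (ℤ.*-comm (sgn n) (sgn (suc m)))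
sgnℤ-+ -[1+ m ] -[1+ n ] = trans (cong (λ k → sgn (suc k)) (sym (ℕ.+-suc m n))) (sgn-+ (suc m) (suc n))

sgn² : ∀ n → sgn n ℤ.* sgn n ≡ 1ℤ
sgn² zero    = refl
sgn² (suc n) = trans (identity (sgn n)) (sgn² n)
  where
  identity : ∀ x → (ℤ.- x) ℤ.* (ℤ.- x) ≡ x ℤ.* x
  identity = solve-∀

sgnℤ-double : ∀ i → sgnℤ (i ℤ.+ i) ≡ 1ℤ
sgnℤ-double i = trans (sgnℤ-+ i i) (sgnℤ² i)
  where
  sgnℤ² : ∀ i → sgnℤ i ℤ.* sgnℤ i ≡ 1ℤ
  sgnℤ² (+ n)    = sgn² n
  sgnℤ² -[1+ n ] = sgn² (suc n)

sgnℤ-even : ∀ {i} j k → i ≡ j ℤ.+ (k ℤ.+ k) → sgnℤ i ≡ sgnℤ j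
sgnℤ-even j k refl = trans (sgnℤ-+ j (k ℤ.+ k))
  (trans (cong (sgnℤ j ℤ.*_) (sgnℤ-double k)) (ℤ.*-identityʳ (sgnℤ j)))

sgnℤ-odd : ∀ {i} j k → i ≡ j ℤ.+ (k ℤ.+ k) ℤ.+ 1ℤ → sgnℤ i ≡ ℤ.- sgnℤ j
sgnℤ-odd j k refl = trans (sgnℤ-+ (j ℤ.+ (k ℤ.+ k)) 1ℤ)
  (trans (cong (ℤ._* -1ℤ) (sgnℤ-even j k refl)) (identity (sgnℤ j)))
  where
  identity : ∀ x → x ℤ.* -1ℤ ≡ ℤ.- x
  identity = solve-∀

tri-double : ∀ n → + tri n ℤ.* + 2 ≡ + n ℤ.* (+ n ℤ.+ 1ℤ)
tri-double zero    = refl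
tri-double (suc n) = trans (ℤ.*-distribʳ-+ (+ 2) (+ suc n) (+ tri n))
  (trans (cong (λ x → + suc n ℤ.* + 2 ℤ.+ x) (tri-double n)) (identity (+ n)))
  where
  identity : ∀ n → (1ℤ ℤ.+ n) ℤ.* + 2 ℤ.+ n ℤ.* (n ℤ.+ 1ℤ) ≡ (1ℤ ℤ.+ n) ℤ.* ((1ℤ ℤ.+ n) ℤ.+ 1ℤ)
  identity = solve-∀

triℤ-double : ∀ k → + triℤ k ℤ.* + 2 ≡ k ℤ.* (k ℤ.+ 1ℤ)
triℤ-double (+ n)    = tri-double n
triℤ-double -[1+ n ] = trans (tri-double n) (identity (+ n))
  where
  identity : ∀ n → n ℤ.* (n ℤ.+ 1ℤ) ≡ (ℤ.- (1ℤ ℤ.+ n)) ℤ.* (ℤ.- (1ℤ ℤ.+ n) ℤ.+ 1ℤ)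
  identity = solve-∀

pent₂ : ℤ → ℤ
pent₂ i = i ℤ.* (+ 3 ℤ.* i ℤ.+ 1ℤ)

pent-double : ∀ i → + pent i ℤ.* + 2 ≡ pent₂ i
pent-double (+ n)    = trans (cong (λ x → (x ℤ.+ + tri n) ℤ.* + 2) (ℤ.pos-* n n))
  (trans (ℤ.*-distribʳ-+ (+ 2) (+ n ℤ.* + n) (+ tri n))
  (trans (cong (λ x → + n ℤ.* + n ℤ.* + 2 ℤ.+ x) (tri-double n)) (identity (+ n))))
  where
  identity : ∀ n → n ℤ.* n ℤ.* + 2 ℤ.+ n ℤ.* (n ℤ.+ 1ℤ) ≡ n ℤ.* (+ 3 ℤ.* n ℤ.+ 1ℤ)
  identity = solve-∀
pent-double -[1+ n ] = trans (cong (λ x → (x ℤ.+ + tri (suc n)) ℤ.* + 2) (ℤ.pos-* (suc n) n))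
  (trans (ℤ.*-distribʳ-+ (+ 2) (+ suc n ℤ.* + n) (+ tri (suc n)))
  (trans (cong (λ x → + suc n ℤ.* + n ℤ.* + 2 ℤ.+ x) (tri-double (suc n))) (identity (+ n))))
  where
  identity : ∀ n → (1ℤ ℤ.+ n) ℤ.* n ℤ.* + 2 ℤ.+ (1ℤ ℤ.+ n) ℤ.* ((1ℤ ℤ.+ n) ℤ.+ 1ℤ) ≡
                   (ℤ.- (1ℤ ℤ.+ n)) ℤ.* (+ 3 ℤ.* (ℤ.- (1ℤ ℤ.+ n)) ℤ.+ 1ℤ)
  identity = solve-∀

-- Doubled exponents are polynomials in the indices, so equality of exponents is left to the ring
-- solver after doubling.
double-injective : ∀ {m n} → + m ℤ.* + 2 ≡ + n ℤ.* + 2 → m ≡ n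
double-injective {m} {n} eq = ℤ.+-injective (ℤ.*-cancelʳ-≡ (+ m) (+ n) (+ 2) eq)

-- Residues modulo 5

infix 4 _≈?_

_≈?_ : ∀ x y → Dec (x ≈ y)
x ≈? y = map′ from to ((+ 5) Signed.∣? (x ℤ.- y))
  where
  from : + 5 Signed.∣ (x ℤ.- y) → x ≈ y
  from (Signed.divides k eq) = mod k (trans (identity x y) (cong (λ u → y ℤ.+ u) eq))
    where
    identity : ∀ x y → x ≡ y ℤ.+ (x ℤ.- y)
    identity = solve-∀
  to : x ≈ y → + 5 Signed.∣ (x ℤ.- y)
  to (mod k eq) = Signed.divides k (trans (cong (ℤ._- y) eq) (identity y (k ℤ.* + 5)))
    where
    identity : ∀ y u → (y ℤ.+ u) ℤ.- y ≡ u
    identity = solve-∀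

residue : ∀ x → ∃ λ (r : Fin 5) → x ≈ + toℕ r
residue x = fromℕ< r<5 , mod (x DivMod./ + 5) (trans (DivMod.a≡a%n+[a/n]*n x (+ 5))
  (cong (λ r → + r ℤ.+ (x DivMod./ + 5) ℤ.* + 5) (sym (toℕ-fromℕ< r<5))))
  where
  r<5 : x DivMod.% + 5 < 5
  r<5 = DivMod.n%d<d x (+ 5)

-- The indicator of 0 modulo 5, by Fermat's little theorem.
isZero : ℤ → ℤ
isZero x = 1ℤ ℤ.- x ℤ.* x ℤ.* x ℤ.* x

isZero-cong : ∀ {x y} → x ≈ y → isZero x ≈ isZero y
isZero-cong p = +-cong (≈-refl {1ℤ}) (-‿cong (*-cong (*-cong (*-cong p p) p) p))

pent₂-cong : ∀ {x y} → x ≈ y → pent₂ x ≈ pent₂ y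
pent₂-cong p = *-cong p (+-cong (*-cong (≈-refl {+ 3}) p) (≈-refl {1ℤ}))

oddℤ-cong : ∀ {x y} → x ≈ y → oddℤ x ≈ oddℤ y
oddℤ-cong p = +-cong (*-cong (≈-refl {+ 2}) p) (≈-refl {1ℤ})

isZero? : ∀ x → x ≈ 0ℤ ⊎ isZero x ≈ 0ℤ
isZero? x with residue x
... | r , x≈r = Sum.map (≈-trans x≈r) (≈-trans (isZero-cong x≈r)) (check r)
  where
  check : (r : Fin 5) → + toℕ r ≈ 0ℤ ⊎ isZero (+ toℕ r) ≈ 0ℤ
  check = toWitness {a? = all? λ r → (+ toℕ r ≈? 0ℤ) ⊎-dec (isZero (+ toℕ r) ≈? 0ℤ)} _

isZero-* : ∀ k → isZero (k ℤ.* + 5) ≈ 1ℤ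
isZero-* k = isZero-cong {k ℤ.* + 5} {0ℤ} (mod k (sym (ℤ.+-identityˡ (k ℤ.* + 5))))

-- The form x² + y² + 9z² underlying f²f(q³)³ is ≡ x² + y² - z²: if it vanishes and z does not,
-- then exactly one of x = 6a + 1 and y = 6b + 1 vanishes …
oneVanishes : ∀ a b k → pent₂ a ℤ.+ (pent₂ b ℤ.+ + 3 ℤ.* (k ℤ.* (k ℤ.+ 1ℤ))) ≈ + 2 →
  oddℤ k ≈ oddℤ k ℤ.* (isZero (a ℤ.+ 1ℤ) ℤ.+ isZero (b ℤ.+ 1ℤ))
oneVanishes a b k hyp with residue a | residue b | residue k
... | r , a≈r | s , b≈s | t , k≈t = begin
  oddℤ k      ≈⟨ oddℤ-cong k≈t ⟩
  oddℤ k′     ≈⟨ check r s t (≈-trans (≈-sym (form a≈r b≈s k≈t)) hyp) ⟩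
  oddℤ k′ ℤ.* (isZero (a′ ℤ.+ 1ℤ) ℤ.+ isZero (b′ ℤ.+ 1ℤ))
              ≈⟨ *-cong (oddℤ-cong k≈t) (+-cong (isZero-cong (+-cong a≈r (≈-refl {1ℤ})))
                                                (isZero-cong (+-cong b≈s (≈-refl {1ℤ})))) ⟨
  oddℤ k ℤ.* (isZero (a ℤ.+ 1ℤ) ℤ.+ isZero (b ℤ.+ 1ℤ)) ∎
  where
  open ≈-Reasoning
  a′ = + toℕ r
  b′ = + toℕ s
  k′ = + toℕ t
  Q : ℤ → ℤ → ℤ → ℤ
  Q a b k = pent₂ a ℤ.+ (pent₂ b ℤ.+ + 3 ℤ.* (k ℤ.* (k ℤ.+ 1ℤ)))
  form : ∀ {a a′ b b′ k k′} → a ≈ a′ → b ≈ b′ → k ≈ k′ → Q a b k ≈ Q a′ b′ k′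
  form p q r = +-cong (pent₂-cong p) (+-cong (pent₂-cong q)
    (*-cong (≈-refl {+ 3}) (*-cong r (+-cong r (≈-refl {1ℤ})))))
  -- All 125 triples of residues are decided by evaluation; those with z ≡ 0 pass because the factor
  -- `oddℤ` makes both sides vanish. The value 2 in the hypothesis is twice the residue 1 of the
  -- exponent.
  check : (r s t : Fin 5) → Q (+ toℕ r) (+ toℕ s) (+ toℕ t) ≈ + 2 →
    oddℤ (+ toℕ t) ≈ oddℤ (+ toℕ t) ℤ.* (isZero (+ toℕ r ℤ.+ 1ℤ) ℤ.+ isZero (+ toℕ s ℤ.+ 1ℤ))
  check = toWitness {a? = all? λ r → all? λ s → all? λ t →
    (Q (+ toℕ r) (+ toℕ s) (+ toℕ t) ≈? + 2) →-dec
    (oddℤ (+ toℕ t) ≈? (oddℤ (+ toℕ t) ℤ.* (isZero (+ toℕ r ℤ.+ 1ℤ) ℤ.+ isZero (+ toℕ s ℤ.+ 1ℤ))))} _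

-- … and the other one is ± z.
otherMatches : ∀ b k → pent₂ b ℤ.+ + 3 ℤ.* (k ℤ.* (k ℤ.+ 1ℤ)) ≈ 0ℤ →
  oddℤ k ≈ oddℤ k ℤ.* (isZero (k ℤ.- + 3 ℤ.* b) ℤ.+ isZero ((-1ℤ ℤ.- k) ℤ.- + 3 ℤ.* b))
otherMatches b k hyp with residue b | residue k
... | s , b≈s | t , k≈t = begin
  oddℤ k      ≈⟨ oddℤ-cong k≈t ⟩
  oddℤ k′     ≈⟨ check s t (≈-trans (≈-sym (form b≈s k≈t)) hyp) ⟩
  oddℤ k′ ℤ.* (isZero (k′ ℤ.- + 3 ℤ.* b′) ℤ.+ isZero ((-1ℤ ℤ.- k′) ℤ.- + 3 ℤ.* b′))
              ≈⟨ *-cong (oddℤ-cong k≈t) (+-cong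
                   (isZero-cong (+-cong k≈t (-‿cong (*-cong (≈-refl {+ 3}) b≈s))))
                   (isZero-cong (+-cong (+-cong (≈-refl { -1ℤ}) (-‿cong k≈t)) (-‿cong (*-cong (≈-refl {+ 3}) b≈s))))) ⟨
  oddℤ k ℤ.* (isZero (k ℤ.- + 3 ℤ.* b) ℤ.+ isZero ((-1ℤ ℤ.- k) ℤ.- + 3 ℤ.* b)) ∎
  where
  open ≈-Reasoning
  b′ = + toℕ s
  k′ = + toℕ t
  Q : ℤ → ℤ → ℤ
  Q b k = pent₂ b ℤ.+ + 3 ℤ.* (k ℤ.* (k ℤ.+ 1ℤ))
  form : ∀ {b b′ k k′} → b ≈ b′ → k ≈ k′ → Q b k ≈ Q b′ k′
  form q r = +-cong (pent₂-cong q) (*-cong (≈-refl {+ 3}) (*-cong r (+-cong r (≈-refl {1ℤ}))))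
  check : (s t : Fin 5) → Q (+ toℕ s) (+ toℕ t) ≈ 0ℤ →
    oddℤ (+ toℕ t) ≈ oddℤ (+ toℕ t) ℤ.* (isZero (+ toℕ t ℤ.- + 3 ℤ.* + toℕ s) ℤ.+
                                         isZero ((-1ℤ ℤ.- + toℕ t) ℤ.- + 3 ℤ.* + toℕ s))
  check = toWitness {a? = all? λ s → all? λ t →
    (Q (+ toℕ s) (+ toℕ t) ≈? 0ℤ) →-dec
    (oddℤ (+ toℕ t) ≈? (oddℤ (+ toℕ t) ℤ.* (isZero (+ toℕ t ℤ.- + 3 ℤ.* + toℕ s) ℤ.+
                                            isZero ((-1ℤ ℤ.- + toℕ t) ℤ.- + 3 ℤ.* + toℕ s))))} _

-- For the exponent e = s(3s+1)/2 one has (6s+1)² = 24e + 1, which is 0 modulo 5 for e ≡ 1 and a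
-- nonresidue, hence impossible, for e ≡ 3 and e ≡ 4.
weightVanishes : ∀ s (r : Fin 3) → pent₂ s ≈ + 2 ℤ.* + lookup (1 ∷ 3 ∷ 4 ∷ []) r → + 6 ℤ.* s ℤ.+ 1ℤ ≈ 0ℤ
weightVanishes s r hyp with residue s
... | t , s≈t = ≈-trans (+-cong (*-cong (≈-refl {+ 6}) s≈t) (≈-refl {1ℤ}))
  (check t r (≈-trans (≈-sym (pent₂-cong s≈t)) hyp))
  where
  check : (t : Fin 5) (r : Fin 3) → pent₂ (+ toℕ t) ≈ + 2 ℤ.* + lookup (1 ∷ 3 ∷ 4 ∷ []) r →
    + 6 ℤ.* + toℕ t ℤ.+ 1ℤ ≈ 0ℤ
  check = toWitness {a? = all? λ t → all? λ r →
    (pent₂ (+ toℕ t) ≈? (+ 2 ℤ.* + lookup (1 ∷ 3 ∷ 4 ∷ []) r)) →-dec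
    ((+ 6 ℤ.* + toℕ t ℤ.+ 1ℤ) ≈? 0ℤ)} _
-- The coefficients p₃₃ (5m + 1)

X-*5 : ∀ e n → X (suc (e * 5)) (suc (n * 5)) ≡ X e n
X-*5 zero    zero    = refl
X-*5 zero    (suc n) = refl
X-*5 (suc e) zero    = refl
X-*5 (suc e) (suc n) = X-*5 e n

X-support : ∀ e n → X e n ≡ 0ℤ ⊎ e ≡ n
X-support e n with e ℕ.≟ n
... | yes e≡n = inj₂ e≡n
... | no e≢n  = inj₁ (X-≢ e n e≢n)

zeroTerm : ∀ w {x} t → x ≡ 0ℤ → w ℤ.* x ≈ (w ℤ.* x) ℤ.* t
zeroTerm w t refl = ≈-reflexive (identity w t)
  where
  identity : ∀ w t → w ℤ.* 0ℤ ≡ (w ℤ.* 0ℤ) ℤ.* t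
  identity = solve-∀

eU : ℤ × ℤ × ℤ → ℕ
eU (a , b , k) = pent a + (pent b + triℤ k * 3)

wU : ℤ × ℤ × ℤ → ℤ
wU (a , b , k) = sgnℤ a ℤ.* (sgnℤ b ℤ.* cubeWeight k)

U-theta : Theta (f ⊗ (f ⊗ (cube f) ⟨q^3⟩)) eU wU
U-theta = theta-⊗ f-theta (theta-⊗ f-theta (theta-spread 2 f³-theta))

B : Series
B = f ⟨q^5⟩ ⊗ A

wA : ℤ → ℤ
wA s = + 6 ℤ.* s ℤ.+ 1ℤ

eV : ℤ × ℤ × ℤ → ℕ
eV (i , c , s) = pent i + (pent c * 5 + pent s)

-- The weight is a parameter because three of them occur over the same exponents: the one produced
-- by the division, `wA`, and their difference.
wV : (ℤ → ℤ → ℤ) → ℤ × ℤ × ℤ → ℤ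
wV v (i , c , s) = sgnℤ i ℤ.* (sgnℤ c ℤ.* (sgnℤ s ℤ.* v i s))

V-theta : Theta (f ⊗ B) eV (wV λ i s → wA s)
V-theta = theta-⊗ f-theta (theta-⊗ (theta-spread 4 f-theta) A-theta)

eU-double : ∀ a b k → pent₂ a ℤ.+ (pent₂ b ℤ.+ + 3 ℤ.* (k ℤ.* (k ℤ.+ 1ℤ))) ≡ + eU (a , b , k) ℤ.* + 2
eU-double a b k = begin
  pent₂ a ℤ.+ (pent₂ b ℤ.+ + 3 ℤ.* (k ℤ.* (k ℤ.+ 1ℤ)))
    ≡⟨ cong₂ ℤ._+_ (sym (pent-double a)) (cong₂ ℤ._+_ (sym (pent-double b)) (cong (+ 3 ℤ.*_) (sym (triℤ-double k)))) ⟩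
  x ℤ.* + 2 ℤ.+ (y ℤ.* + 2 ℤ.+ + 3 ℤ.* (z ℤ.* + 2))
    ≡⟨ identity x y z ⟩
  (x ℤ.+ (y ℤ.+ z ℤ.* + 3)) ℤ.* + 2
    ≡⟨ cong (λ u → (x ℤ.+ (y ℤ.+ u)) ℤ.* + 2) (sym (ℤ.pos-* (triℤ k) 3)) ⟩
  + eU (a , b , k) ℤ.* + 2 ∎
  where
  open ≡-Reasoning
  x = + pent a
  y = + pent b
  z = + triℤ k
  identity : ∀ x y z → x ℤ.* + 2 ℤ.+ (y ℤ.* + 2 ℤ.+ + 3 ℤ.* (z ℤ.* + 2)) ≡ (x ℤ.+ (y ℤ.+ z ℤ.* + 3)) ℤ.* + 2
  identity = solve-∀

eB-double : ∀ c s → + (pent c * 5 + pent s) ℤ.* + 2 ≡ pent₂ c ℤ.* + 5 ℤ.+ pent₂ s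
eB-double c s = begin
  + (pent c * 5 + pent s) ℤ.* + 2
    ≡⟨ cong (λ u → (u ℤ.+ + pent s) ℤ.* + 2) (ℤ.pos-* (pent c) 5) ⟩
  (+ pent c ℤ.* + 5 ℤ.+ + pent s) ℤ.* + 2
    ≡⟨ identity (+ pent c) (+ pent s) ⟩
  + pent c ℤ.* + 2 ℤ.* + 5 ℤ.+ + pent s ℤ.* + 2
    ≡⟨ cong₂ (λ u v → u ℤ.* + 5 ℤ.+ v) (pent-double c) (pent-double s) ⟩
  pent₂ c ℤ.* + 5 ℤ.+ pent₂ s ∎
  where
  open ≡-Reasoning
  identity : ∀ x y → (x ℤ.* + 5 ℤ.+ y) ℤ.* + 2 ≡ x ℤ.* + 2 ℤ.* + 5 ℤ.+ y ℤ.* + 2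
  identity = solve-∀

-- In terms of z = 2k+1 this is z ↦ -z.
reflect : ℤ → ℤ
reflect (+ n)    = -[1+ n ]
reflect -[1+ n ] = + n

reflect≡ : ∀ k → reflect k ≡ -1ℤ ℤ.- k
reflect≡ (+ zero)  = refl
reflect≡ (+ suc n) = refl
reflect≡ -[1+ n ]  = refl

reflect-involutive : ∀ k → reflect (reflect k) ≡ k
reflect-involutive (+ n)    = refl
reflect-involutive -[1+ n ] = refl

triℤ-reflect : ∀ k → triℤ (reflect k) ≡ triℤ k
triℤ-reflect (+ n)    = refl
triℤ-reflect -[1+ n ] = refl

cubeWeight-reflect : ∀ k → cubeWeight (reflect k) ≡ cubeWeight k
cubeWeight-reflect k = trans
  (cong₂ (λ s o → + 3 ℤ.* (s ℤ.* oddℤ o)) (sgnℤ-reflect k) (reflect≡ k))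
  (identity (sgnℤ k) k)
  where
  sgnℤ-reflect : ∀ k → sgnℤ (reflect k) ≡ ℤ.- sgnℤ k
  sgnℤ-reflect (+ n)    = refl
  sgnℤ-reflect -[1+ n ] = sym (ℤ.neg-involutive (sgn n))
  identity : ∀ s k → + 3 ℤ.* ((ℤ.- s) ℤ.* (+ 2 ℤ.* (-1ℤ ℤ.- k) ℤ.+ 1ℤ)) ≡ + 3 ℤ.* (s ℤ.* (+ 2 ℤ.* k ℤ.+ 1ℤ))
  identity = solve-∀

wU-scale : ∀ a b k t → oddℤ k ≈ oddℤ k ℤ.* t → wU (a , b , k) ≈ wU (a , b , k) ℤ.* t
wU-scale a b k t o≈ = begin
  wU (a , b , k)
    ≈⟨ *-cong (≈-refl {sgnℤ a}) (*-cong (≈-refl {sgnℤ b}) (*-cong (≈-refl {+ 3}) (*-cong (≈-refl {sgnℤ k}) o≈))) ⟩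
  sgnℤ a ℤ.* (sgnℤ b ℤ.* (+ 3 ℤ.* (sgnℤ k ℤ.* (oddℤ k ℤ.* t))))
    ≡⟨ identity (sgnℤ a) (sgnℤ b) (sgnℤ k) (oddℤ k) t ⟩
  wU (a , b , k) ℤ.* t ∎
  where
  open ≈-Reasoning
  identity : ∀ x y z o t → x ℤ.* (y ℤ.* (+ 3 ℤ.* (z ℤ.* (o ℤ.* t)))) ≡ x ℤ.* (y ℤ.* (+ 3 ℤ.* (z ℤ.* o))) ℤ.* t
  identity = solve-∀

*-swapʳ : ∀ x y z → x ℤ.* y ℤ.* z ≡ x ℤ.* z ℤ.* y
*-swapʳ = solve-∀

module _ (m : ℕ) where

  private
    n = suc (m * 5)

    F : ℤ × ℤ × ℤ → ℤ
    F p = wU p ℤ.* X (eU p) n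

    E : Enumeration F
    E = enumerate U-theta n wU

    n-double : + n ℤ.* + 2 ≈ + 2
    n-double = mod (+ 2 ℤ.* + m) (trans (cong (λ x → (1ℤ ℤ.+ x) ℤ.* + 2) (ℤ.pos-* m 5)) (identity (+ m)))
      where
      identity : ∀ m → (1ℤ ℤ.+ m ℤ.* + 5) ℤ.* + 2 ≡ + 2 ℤ.+ (+ 2 ℤ.* m) ℤ.* + 5
      identity = solve-∀

    form≈2 : ∀ a b k → eU (a , b , k) ≡ n → pent₂ a ℤ.+ (pent₂ b ℤ.+ + 3 ℤ.* (k ℤ.* (k ℤ.+ 1ℤ))) ≈ + 2
    form≈2 a b k eq = ≈-trans (≈-reflexive (trans (eU-double a b k) (cong (λ e → + e ℤ.* + 2) eq))) n-double

    swap : ℤ × ℤ × ℤ → ℤ × ℤ × ℤ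
    swap (a , b , k) = b , a , k

    -- Selects the triples with 5 dividing x, since 6a + 1 ≡ a + 1.
    α : ℤ × ℤ × ℤ → ℤ
    α (a , _) = isZero (a ℤ.+ 1ℤ)

    F-swap : ∀ p → F (swap p) ≈ F p
    F-swap (a , b , k) = ≈-reflexive (cong₂ (λ w e → w ℤ.* X e n)
      (identity (sgnℤ b) (sgnℤ a) (cubeWeight k))
      (Nat.solve 3 (λ x y z → y Nat.:+ (x Nat.:+ z) Nat.:= x Nat.:+ (y Nat.:+ z)) refl (pent a) (pent b) (triℤ k * 3)))
      where
      identity : ∀ x y z → x ℤ.* (y ℤ.* z) ≡ y ℤ.* (x ℤ.* z)
      identity = solve-∀

    F-α : ∀ p → F p ≈ F p ℤ.* (α p ℤ.+ α (swap p))
    F-α p@(a , b , k) with X-support (eU p) n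
    ... | inj₁ X≡0 = zeroTerm (wU p) (α p ℤ.+ α (swap p)) X≡0
    ... | inj₂ e≡n = ≈-trans (*-cong (wU-scale a b k t (oneVanishes a b k (form≈2 a b k e≡n))) (≈-refl {X (eU p) n}))
                             (≈-reflexive (*-swapʳ (wU p) t (X (eU p) n)))
      where
      t = α p ℤ.+ α (swap p)

    F′ : ℤ × ℤ × ℤ → ℤ
    F′ p = F p ℤ.* α p

    E′ : Enumeration F′
    E′ = restrict E (λ p → ≈-*0 (α p))

    flip : ℤ × ℤ × ℤ → ℤ × ℤ × ℤ
    flip (a , b , k) = a , b , reflect k

    -- Selects z ≡ y modulo 5, because (2k+1) - (6b+1) = 2(k - 3b); this is divisibility of y + 3iz
    -- by 2 + i.
    γ : ℤ × ℤ × ℤ → ℤ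
    γ (a , b , k) = isZero (k ℤ.- + 3 ℤ.* b)

    F′-flip : ∀ p → F′ (flip p) ≈ F′ p
    F′-flip p@(a , b , k) = ≈-reflexive (cong₂ (λ w t → sgnℤ a ℤ.* (sgnℤ b ℤ.* w) ℤ.* X (pent a + (pent b + t * 3)) n ℤ.* α p)
      (cubeWeight-reflect k) (triℤ-reflect k))

    F′-γ : ∀ p → F′ p ≈ F′ p ℤ.* (γ p ℤ.+ γ (flip p))
    F′-γ p@(a , b , k) with isZero? (a ℤ.+ 1ℤ) | X-support (eU p) n
    ... | inj₂ α≈0 | _        = ≈-trans F′≈0 (≈-sym (≈-*0 t F′≈0))
      where
      t = γ p ℤ.+ γ (flip p)
      F′≈0 : F′ p ≈ 0ℤ
      F′≈0 = ≈-trans (*-cong (≈-refl {F p}) α≈0) (≈-reflexive (ℤ.*-zeroʳ (F p)))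
    ... | inj₁ _   | inj₁ X≡0 = ≈-trans F′≈0 (≈-sym (≈-*0 t F′≈0))
      where
      t = γ p ℤ.+ γ (flip p)
      F′≈0 : F′ p ≈ 0ℤ
      F′≈0 = ≈-*0 (α p) (≈-reflexive (trans (cong (wU p ℤ.*_) X≡0) (ℤ.*-zeroʳ (wU p))))
    ... | inj₁ a+1≈0 | inj₂ e≡n = begin
      wU p ℤ.* x ℤ.* α p           ≈⟨ *-cong (*-cong (wU-scale a b k t odd≈) (≈-refl {x})) (≈-refl {α p}) ⟩
      wU p ℤ.* t ℤ.* x ℤ.* α p     ≡⟨ identity (wU p) t x (α p) ⟩
      wU p ℤ.* x ℤ.* α p ℤ.* t     ∎
      where
      open ≈-Reasoning
      x = X (eU p) n
      t = γ p ℤ.+ γ (flip p)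
      Q = pent₂ b ℤ.+ + 3 ℤ.* (k ℤ.* (k ℤ.+ 1ℤ))
      identity : ∀ w t x y → w ℤ.* t ℤ.* x ℤ.* y ≡ w ℤ.* x ℤ.* y ℤ.* t
      identity = solve-∀
      a≈-1 : a ≈ -1ℤ
      a≈-1 = ≈-trans (≈-reflexive (identity′ a)) (+-cong a+1≈0 (≈-refl { -1ℤ}))
        where
        identity′ : ∀ a → a ≡ (a ℤ.+ 1ℤ) ℤ.+ -1ℤ
        identity′ = solve-∀
      -- For a ≡ -1 the first summand is `pent₂ -1ℤ` = 2, which uses up the whole value 2 of the
      -- form.
      Q≈0 : Q ≈ 0ℤ
      Q≈0 = begin
        Q                               ≡⟨ identity′ Q (pent₂ a) ⟩
        (pent₂ a ℤ.+ Q) ℤ.- pent₂ a     ≈⟨ +-cong (form≈2 a b k e≡n) (-‿cong (pent₂-cong a≈-1)) ⟩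
        0ℤ                              ∎
        where
        identity′ : ∀ x y → x ≡ (y ℤ.+ x) ℤ.- y
        identity′ = solve-∀
      odd≈ : oddℤ k ≈ oddℤ k ℤ.* t
      odd≈ = subst (λ l → oddℤ k ≈ oddℤ k ℤ.* (γ p ℤ.+ isZero (l ℤ.- + 3 ℤ.* b))) (sym (reflect≡ k)) (otherMatches b k Q≈0)

    F″ : ℤ × ℤ × ℤ → ℤ
    F″ p = F′ p ℤ.* γ p

    E″ : Enumeration F″
    E″ = restrict E′ (λ p → ≈-*0 (γ p))

    -- In terms of x = 6a+1, y = 6b+1 and z = 2k+1 this is x = -5(6c+1) and
    -- y + 3iz = (2 + i)((6s+1) + i(6j+1)), where j is the first coordinate.
    ψ : ℤ × ℤ × ℤ → ℤ × ℤ × ℤ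
    ψ (i , c , s) = -1ℤ ℤ.- + 5 ℤ.* c , + 2 ℤ.* s ℤ.- i , s ℤ.+ + 2 ℤ.* i

    -- Inverting the linear map ψ needs division by 5 only in (a + 1)/5 and (k - 3b)/5, which are t
    -- and u.
    ψ⁻¹ : ∀ a b k t u → a ℤ.+ 1ℤ ≡ 0ℤ ℤ.+ t ℤ.* + 5 → k ℤ.- + 3 ℤ.* b ≡ 0ℤ ℤ.+ u ℤ.* + 5 →
      ψ (b ℤ.+ + 2 ℤ.* u , ℤ.- t , b ℤ.+ u) ≡ (a , b , k)
    ψ⁻¹ a b k t u eqa eqk = cong₂ _,_
      (trans (identity₁ t) (trans (cong (ℤ._- 1ℤ) (sym eqa)) (identity₂ a)))
      (cong₂ _,_ (identity₃ b u)
        (trans (identity₄ b u) (trans (cong (ℤ._+ + 3 ℤ.* b) (sym eqk)) (identity₅ k b))))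
      where
      identity₁ : ∀ t → -1ℤ ℤ.- + 5 ℤ.* (ℤ.- t) ≡ (0ℤ ℤ.+ t ℤ.* + 5) ℤ.- 1ℤ
      identity₁ = solve-∀
      identity₂ : ∀ a → (a ℤ.+ 1ℤ) ℤ.- 1ℤ ≡ a
      identity₂ = solve-∀
      identity₃ : ∀ b u → + 2 ℤ.* (b ℤ.+ u) ℤ.- (b ℤ.+ + 2 ℤ.* u) ≡ b
      identity₃ = solve-∀
      identity₄ : ∀ b u → (b ℤ.+ u) ℤ.+ + 2 ℤ.* (b ℤ.+ + 2 ℤ.* u) ≡ (0ℤ ℤ.+ u ℤ.* + 5) ℤ.+ + 3 ℤ.* b
      identity₄ = solve-∀
      identity₅ : ∀ k b → (k ℤ.- + 3 ℤ.* b) ℤ.+ + 3 ℤ.* b ≡ k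
      identity₅ = solve-∀

    ψ-injective : ∀ {p q} → ψ p ≡ ψ q → p ≡ q
    ψ-injective {i , c , s} {i′ , c′ , s′} eq = cong₂ _,_ i≡i′ (cong₂ _,_ c≡c′ s≡s′)
      where
      a≡ = cong proj₁ eq
      b≡ = cong (proj₁ ∘ proj₂) eq
      k≡ = cong (proj₂ ∘ proj₂) eq
      c≡c′ : c ≡ c′
      c≡c′ = ℤ.*-cancelʳ-≡ c c′ (+ 5) (trans (identity c) (trans (cong (λ a → -1ℤ ℤ.- a) a≡) (sym (identity c′))))
        where
        identity : ∀ c → c ℤ.* + 5 ≡ -1ℤ ℤ.- (-1ℤ ℤ.- + 5 ℤ.* c)
        identity = solve-∀
      s≡s′ : s ≡ s′
      s≡s′ = ℤ.*-cancelʳ-≡ s s′ (+ 5) (trans (identity s i)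
        (trans (cong₂ (λ b k → + 2 ℤ.* b ℤ.+ k) b≡ k≡) (sym (identity s′ i′))))
        where
        identity : ∀ s i → s ℤ.* + 5 ≡ + 2 ℤ.* (+ 2 ℤ.* s ℤ.- i) ℤ.+ (s ℤ.+ + 2 ℤ.* i)
        identity = solve-∀
      i≡i′ : i ≡ i′
      i≡i′ = trans (identity s i) (trans (cong₂ (λ s b → + 2 ℤ.* s ℤ.- b) s≡s′ b≡) (sym (identity s′ i′)))
        where
        identity : ∀ s i → i ≡ + 2 ℤ.* s ℤ.- (+ 2 ℤ.* s ℤ.- i)
        identity = solve-∀

    ψ-preimage : ∀ p → F″ p ≈ 0ℤ ⊎ ∃ λ q → ψ q ≡ p
    ψ-preimage p@(a , b , k) with isZero? (a ℤ.+ 1ℤ) | isZero? (k ℤ.- + 3 ℤ.* b)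
    ... | inj₂ α≈0 | _        = inj₁ (≈-*0 (γ p) (≈-trans (*-cong (≈-refl {F p}) α≈0) (≈-reflexive (ℤ.*-zeroʳ (F p)))))
    ... | inj₁ _   | inj₂ γ≈0 = inj₁ (≈-trans (*-cong (≈-refl {F′ p}) γ≈0) (≈-reflexive (ℤ.*-zeroʳ (F′ p))))
    ... | inj₁ (mod t eqa) | inj₁ (mod u eqk) = inj₂ ((b ℤ.+ + 2 ℤ.* u , ℤ.- t , b ℤ.+ u) , ψ⁻¹ a b k t u eqa eqk)

    -- This is z in the new variables, namely ((6s+1) + 2(6i+1))/3.
    v : ℤ → ℤ → ℤ
    v i s = + 4 ℤ.* i ℤ.+ + 2 ℤ.* s ℤ.+ 1ℤ

    -- Multiplicativity of the norm: since 2 + i has norm 5, x² + y² + 9z² is 5 times the form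
    -- belonging to `eV`.
    eU-ψ : ∀ q → eU (ψ q) ≡ suc (eV q * 5)
    eU-ψ q@(i , c , s) = double-injective (begin
      + eU (ψ q) ℤ.* + 2
        ≡⟨ eU-double (-1ℤ ℤ.- + 5 ℤ.* c) (+ 2 ℤ.* s ℤ.- i) (s ℤ.+ + 2 ℤ.* i) ⟨
      pent₂ (-1ℤ ℤ.- + 5 ℤ.* c) ℤ.+ (pent₂ (+ 2 ℤ.* s ℤ.- i) ℤ.+ + 3 ℤ.* ((s ℤ.+ + 2 ℤ.* i) ℤ.* ((s ℤ.+ + 2 ℤ.* i) ℤ.+ 1ℤ)))
        ≡⟨ identity i c s ⟩
      + 2 ℤ.+ (pent₂ i ℤ.+ (pent₂ c ℤ.* + 5 ℤ.+ pent₂ s)) ℤ.* + 5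
        ≡⟨ cong₂ (λ x y → + 2 ℤ.+ (x ℤ.+ y) ℤ.* + 5) (sym (pent-double i)) (sym (eB-double c s)) ⟩
      + 2 ℤ.+ (+ pent i ℤ.* + 2 ℤ.+ + (pent c * 5 + pent s) ℤ.* + 2) ℤ.* + 5
        ≡⟨ identity′ (+ pent i) (+ (pent c * 5 + pent s)) ⟩
      (1ℤ ℤ.+ + eV q ℤ.* + 5) ℤ.* + 2
        ≡⟨ cong (λ x → (1ℤ ℤ.+ x) ℤ.* + 2) (ℤ.pos-* (eV q) 5) ⟨
      + suc (eV q * 5) ℤ.* + 2 ∎)
      where
      open ≡-Reasoning
      identity : ∀ i c s →
        (-1ℤ ℤ.- + 5 ℤ.* c) ℤ.* (+ 3 ℤ.* (-1ℤ ℤ.- + 5 ℤ.* c) ℤ.+ 1ℤ) ℤ.+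
        ((+ 2 ℤ.* s ℤ.- i) ℤ.* (+ 3 ℤ.* (+ 2 ℤ.* s ℤ.- i) ℤ.+ 1ℤ) ℤ.+
         + 3 ℤ.* ((s ℤ.+ + 2 ℤ.* i) ℤ.* ((s ℤ.+ + 2 ℤ.* i) ℤ.+ 1ℤ))) ≡
        + 2 ℤ.+ (i ℤ.* (+ 3 ℤ.* i ℤ.+ 1ℤ) ℤ.+
          (c ℤ.* (+ 3 ℤ.* c ℤ.+ 1ℤ) ℤ.* + 5 ℤ.+ s ℤ.* (+ 3 ℤ.* s ℤ.+ 1ℤ))) ℤ.* + 5
      identity = solve-∀
      identity′ : ∀ x y → + 2 ℤ.+ (x ℤ.* + 2 ℤ.+ y ℤ.* + 2) ℤ.* + 5 ≡ (1ℤ ℤ.+ (x ℤ.+ y) ℤ.* + 5) ℤ.* + 2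
      identity′ = solve-∀

    -- The 3 comes from `cubeWeight`, the minus sign from the odd shift in -1 - 5c; the other two
    -- coordinates keep the parity of i and of s.
    wU-ψ : ∀ q → wU (ψ q) ≡ -[1+ 2 ] ℤ.* wV v q
    wU-ψ (i , c , s) = trans
      (cong₂ ℤ._*_ (sgnℤ-odd c (-1ℤ ℤ.- + 3 ℤ.* c) (identity₁ c))
        (cong₂ (λ x y → x ℤ.* (+ 3 ℤ.* (y ℤ.* oddℤ (s ℤ.+ + 2 ℤ.* i))))
          (sgnℤ-even i (s ℤ.- i) (identity₂ i s)) (sgnℤ-even s i (identity₃ i s))))
      (identity₄ (sgnℤ i) (sgnℤ c) (sgnℤ s) i s)
      where
      identity₁ : ∀ c → -1ℤ ℤ.- + 5 ℤ.* c ≡ c ℤ.+ ((-1ℤ ℤ.- + 3 ℤ.* c) ℤ.+ (-1ℤ ℤ.- + 3 ℤ.* c)) ℤ.+ 1ℤ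
      identity₁ = solve-∀
      identity₂ : ∀ i s → + 2 ℤ.* s ℤ.- i ≡ i ℤ.+ ((s ℤ.- i) ℤ.+ (s ℤ.- i))
      identity₂ = solve-∀
      identity₃ : ∀ i s → s ℤ.+ + 2 ℤ.* i ≡ s ℤ.+ (i ℤ.+ i)
      identity₃ = solve-∀
      identity₄ : ∀ x y z i s → (ℤ.- y) ℤ.* (x ℤ.* (+ 3 ℤ.* (z ℤ.* (+ 2 ℤ.* (s ℤ.+ + 2 ℤ.* i) ℤ.+ 1ℤ)))) ≡
        -[1+ 2 ] ℤ.* (x ℤ.* (y ℤ.* (z ℤ.* (+ 4 ℤ.* i ℤ.+ + 2 ℤ.* s ℤ.+ 1ℤ))))
      identity₄ = solve-∀

    F″-ψ : ∀ q → F″ (ψ q) ≈ (-[1+ 2 ] ℤ.* wV v q) ℤ.* X (eV q) m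
    F″-ψ q@(i , c , s) = begin
      F (ψ q) ℤ.* α (ψ q) ℤ.* γ (ψ q)
        ≈⟨ *-cong (*-cong (≈-refl {F (ψ q)}) α≈1) γ≈1 ⟩
      F (ψ q) ℤ.* 1ℤ ℤ.* 1ℤ
        ≡⟨ trans (ℤ.*-identityʳ _) (ℤ.*-identityʳ (F (ψ q))) ⟩
      wU (ψ q) ℤ.* X (eU (ψ q)) n
        ≡⟨ cong₂ ℤ._*_ (wU-ψ q) (trans (cong (λ e → X e n) (eU-ψ q)) (X-*5 (eV q) m)) ⟩
      (-[1+ 2 ] ℤ.* wV v q) ℤ.* X (eV q) m ∎
      where
      open ≈-Reasoning
      α≈1 : α (ψ q) ≈ 1ℤ
      α≈1 = ≈-trans (≈-reflexive (cong isZero (identity c))) (isZero-* (ℤ.- c))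
        where
        identity : ∀ c → (-1ℤ ℤ.- + 5 ℤ.* c) ℤ.+ 1ℤ ≡ (ℤ.- c) ℤ.* + 5
        identity = solve-∀
      γ≈1 : γ (ψ q) ≈ 1ℤ
      γ≈1 = ≈-trans (≈-reflexive (cong isZero (identity i s))) (isZero-* (i ℤ.- s))
        where
        identity : ∀ i s → (s ℤ.+ + 2 ℤ.* i) ℤ.- + 3 ℤ.* (+ 2 ℤ.* s ℤ.- i) ≡ (i ℤ.- s) ℤ.* + 5
        identity = solve-∀

    exchange : ℤ × ℤ × ℤ → ℤ × ℤ × ℤ
    exchange (i , c , s) = s , c , i

    sumV : (ℤ → ℤ → ℤ) → ℤ
    sumV u = total (enumerate V-theta m (wV u))

    -- The weight 4i + 2s + 1 differs from 6s + 1 by 4i - 4s, which changes sign under the exchange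
    -- of i and s.
    exchange-antisymmetric : sumV (λ i s → + 4 ℤ.* i ℤ.- + 4 ℤ.* s) ≈ 0ℤ
    exchange-antisymmetric = total-antisymmetric (enumerate V-theta m (wV λ i s → + 4 ℤ.* i ℤ.- + 4 ℤ.* s))
      exchange (λ _ → refl) λ (i , c , s) → ≈-reflexive (trans
        (cong (λ e → wV (λ i s → + 4 ℤ.* i ℤ.- + 4 ℤ.* s) (s , c , i) ℤ.* X e m)
          (Nat.solve 3 (λ x y z → x Nat.:+ (y Nat.:+ z) Nat.:= z Nat.:+ (y Nat.:+ x)) refl (pent s) (pent c * 5) (pent i)))
        (identity (sgnℤ i) (sgnℤ c) (sgnℤ s) i s (X (eV (i , c , s)) m)))
      where
      identity : ∀ x y z i s e → z ℤ.* (y ℤ.* (x ℤ.* (+ 4 ℤ.* s ℤ.- + 4 ℤ.* i))) ℤ.* e ≡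
                                 ℤ.- (x ℤ.* (y ℤ.* (z ℤ.* (+ 4 ℤ.* i ℤ.- + 4 ℤ.* s))) ℤ.* e)
      identity = solve-∀

    sumV-v : sumV v ≈ (f ⊗ B) m
    sumV-v = begin
      sumV v
        ≈⟨ sumOver-cong xs (λ (i , c , s) → ≈-reflexive (identity (sgnℤ i) (sgnℤ c) (sgnℤ s) i s (X (eV (i , c , s)) m))) ⟩
      sumOver xs (λ q → wV w₁ q ℤ.* X (eV q) m ℤ.+ wV w₂ q ℤ.* X (eV q) m)
        ≡⟨ sumOver-+ xs (λ q → wV w₁ q ℤ.* X (eV q) m) (λ q → wV w₂ q ℤ.* X (eV q) m) ⟩
      sumV w₁ ℤ.+ sumV w₂
        ≈⟨ +-cong (≈-sym (coefficient V-theta m)) exchange-antisymmetric ⟩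
      (f ⊗ B) m ℤ.+ 0ℤ
        ≡⟨ ℤ.+-identityʳ _ ⟩
      (f ⊗ B) m ∎
      where
      open ≈-Reasoning
      xs = indices V-theta m
      w₁ w₂ : ℤ → ℤ → ℤ
      w₁ i s = wA s
      w₂ i s = + 4 ℤ.* i ℤ.- + 4 ℤ.* s
      identity : ∀ x y z i s e → x ℤ.* (y ℤ.* (z ℤ.* (+ 4 ℤ.* i ℤ.+ + 2 ℤ.* s ℤ.+ 1ℤ))) ℤ.* e ≡
        x ℤ.* (y ℤ.* (z ℤ.* (+ 6 ℤ.* s ℤ.+ 1ℤ))) ℤ.* e ℤ.+
        x ℤ.* (y ℤ.* (z ℤ.* (+ 4 ℤ.* i ℤ.- + 4 ℤ.* s))) ℤ.* e
      identity = solve-∀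

  -- The constant is 2 · 2 · (-3) = -12 ≡ 3: one factor 2 for the choice between x and y, one for
  -- the sign of z, and -3 from the weights.
  U≈3fB : (f ⊗ (f ⊗ (cube f) ⟨q^3⟩)) n ≈ + 3 ℤ.* (f ⊗ B) m
  U≈3fB = begin
    (f ⊗ (f ⊗ (cube f) ⟨q^3⟩)) n
      ≈⟨ coefficient U-theta n ⟩
    total E
      ≈⟨ total-fold E swap (λ _ → refl) α F-swap F-α ⟩
    + 2 ℤ.* total E′
      ≈⟨ *-cong (≈-refl {+ 2}) (total-fold E′ flip (λ (a , b , k) → cong (λ k → a , b , k) (reflect-involutive k)) γ F′-flip F′-γ) ⟩
    + 2 ℤ.* (+ 2 ℤ.* total E″)
      ≈⟨ *-cong (≈-refl {+ 2}) (*-cong (≈-refl {+ 2}) (≈-trans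
           (total-reindex E″ ψ ψ-injective ψ-preimage)
           (total-cong (reindex E″ ψ ψ-injective ψ-preimage) (enumerate V-theta m (λ q → -[1+ 2 ] ℤ.* wV v q)) F″-ψ))) ⟩
    + 2 ℤ.* (+ 2 ℤ.* sumOver xs (λ q → (-[1+ 2 ] ℤ.* wV v q) ℤ.* X (eV q) m))
      ≈⟨ *-cong (≈-refl {+ 2}) (*-cong (≈-refl {+ 2}) (sumOver-cong xs (λ q →
           ≈-reflexive (ℤ.*-assoc -[1+ 2 ] (wV v q) (X (eV q) m))))) ⟩
    + 2 ℤ.* (+ 2 ℤ.* sumOver xs (λ q → -[1+ 2 ] ℤ.* (wV v q ℤ.* X (eV q) m)))
      ≡⟨ cong (λ x → + 2 ℤ.* (+ 2 ℤ.* x)) (sumOver-* xs -[1+ 2 ] (λ q → wV v q ℤ.* X (eV q) m)) ⟩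
    + 2 ℤ.* (+ 2 ℤ.* (-[1+ 2 ] ℤ.* sumV v))
      ≈⟨ *-cong (≈-refl {+ 2}) (*-cong (≈-refl {+ 2}) (*-cong (≈-refl { -[1+ 2 ]}) sumV-v)) ⟩
    + 2 ℤ.* (+ 2 ℤ.* (-[1+ 2 ] ℤ.* (f ⊗ B) m))
      ≈⟨ mod (-[1+ 2 ] ℤ.* (f ⊗ B) m) (identity ((f ⊗ B) m)) ⟩
    + 3 ℤ.* (f ⊗ B) m ∎
    where
    open ≈-Reasoning
    xs = indices V-theta m
    identity : ∀ x → + 2 ℤ.* (+ 2 ℤ.* (-[1+ 2 ] ℤ.* x)) ≡ + 3 ℤ.* x ℤ.+ -[1+ 2 ] ℤ.* x ℤ.* + 5
    identity = solve-∀

-- Extraction of the exponents 5n + 1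

section : Series → Series
section a n = a (suc (n * 5))

opaque
  unfolding _⊗_

  -- A series in q⁵ preserves residue classes of exponents, so it passes through the extraction and
  -- becomes a series in q.
  section-⊗ : ∀ b a n → (b ⟨q^5⟩ ⊗ a) (suc (n * 5)) ≡ (b ⊗ section a) n
  section-⊗ b a zero    = refl
  section-⊗ b a (suc n) = cong (λ x → b 0 ℤ.* a (suc (suc n * 5)) ℤ.+ x)
    (trans (ℤ.+-identityˡ _) (trans (ℤ.+-identityˡ _) (trans (ℤ.+-identityˡ _) (trans (ℤ.+-identityˡ _)
      (section-⊗ (tail b) a n)))))

  ⊗-·ʳ : ∀ c a b → a ⊗ (c · b) ≗ c · (a ⊗ b)
  ⊗-·ʳ c a b n = trans (⊗-comm a (c · b) n) (trans (·-⊗ c b a n) (cong (c ℤ.*_) (⊗-comm b a n)))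

  ·-at : ∀ c a n → (c · a) n ≡ c ℤ.* a n
  ·-at c a n = refl

-- Extraction turns the factor f(q⁵) into f(q), which also divides the right-hand side and can be
-- cancelled since its constant term is 1.
p₃₃-section : ∀ m → p₃₃ (suc (m * 5)) ≈ + 3 ℤ.* B m
p₃₃-section m = ≈-trans (at< (⊗-cancelˡ[] {suc m} {f} refl equation) m (ℕ.n<1+n m)) (≈-reflexive (·-at (+ 3) B m))
  where
  open ≈-Reasoning
  equation : f ⊗ section p₃₃ ≋[ suc m ] f ⊗ ((+ 3) · B)
  equation = below λ n _ → begin
    (f ⊗ section p₃₃) n                          ≡⟨ section-⊗ f p₃₃ n ⟨
    (f ⟨q^5⟩ ⊗ p₃₃) (suc (n * 5))                ≡⟨ ⊗-comm (f ⟨q^5⟩) p₃₃ (suc (n * 5)) ⟩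
    (p₃₃ ⊗ f ⟨q^5⟩) (suc (n * 5))                ≈⟨ at generatingFunction (suc (n * 5)) ⟩
    (f ⊗ (f ⊗ (cube f) ⟨q^3⟩)) (suc (n * 5))     ≈⟨ U≈3fB n ⟩
    + 3 ℤ.* (f ⊗ B) n                            ≡⟨ ·-at (+ 3) (f ⊗ B) n ⟨
    ((+ 3) · (f ⊗ B)) n                          ≡⟨ ⊗-·ʳ (+ 3) f B n ⟨
    (f ⊗ ((+ 3) · B)) n                          ∎

-- Vanishing coefficients of f(q⁵)A

eB : ℤ × ℤ → ℕ
eB (c , s) = pent c * 5 + pent s

wB : ℤ × ℤ → ℤ
wB (c , s) = sgnℤ c ℤ.* (sgnℤ s ℤ.* wA s)

B-theta : Theta B eB wB
B-theta = theta-⊗ (theta-spread 4 f-theta) A-theta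

-- The factor f(q⁵) does not change exponents modulo 5, so `pent s` already lies in the class 1, 3
-- or 4 and every single term vanishes.
B-vanishes-5 : ∀ r n → B (lookup (1 ∷ 3 ∷ 4 ∷ []) r + n * 5) ≈ 0ℤ
B-vanishes-5 r n = ≈-trans (coefficient B-theta m) (sumOver-zero (indices B-theta m) (λ {p} _ → vanish p))
  where
  l = lookup (1 ∷ 3 ∷ 4 ∷ []) r
  m = l + n * 5
  vanish : ∀ p → wB p ℤ.* X (eB p) m ≈ 0ℤ
  vanish p@(c , s) with X-support (eB p) m
  ... | inj₁ X≡0 = ≈-reflexive (trans (cong (wB p ℤ.*_) X≡0) (ℤ.*-zeroʳ (wB p)))
  ... | inj₂ e≡m = ≈-*0 (X (eB p) m) (begin
    sgnℤ c ℤ.* (sgnℤ s ℤ.* wA s)   ≈⟨ *-cong (≈-refl {sgnℤ c}) (*-cong (≈-refl {sgnℤ s}) (weightVanishes s r form)) ⟩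
    sgnℤ c ℤ.* (sgnℤ s ℤ.* 0ℤ)     ≡⟨ identity (sgnℤ c) (sgnℤ s) ⟩
    0ℤ                             ∎)
    where
    open ≈-Reasoning
    identity : ∀ x y → x ℤ.* (y ℤ.* 0ℤ) ≡ 0ℤ
    identity = solve-∀
    form : pent₂ s ≈ + 2 ℤ.* + l
    form = begin
      pent₂ s                                              ≈⟨ mod (ℤ.- pent₂ c) (identity₁ (pent₂ s) (pent₂ c)) ⟩
      pent₂ c ℤ.* + 5 ℤ.+ pent₂ s                          ≡⟨ eB-double c s ⟨
      + eB p ℤ.* + 2                                       ≡⟨ cong (λ e → + e ℤ.* + 2) e≡m ⟩
      (+ l ℤ.+ + (n * 5)) ℤ.* + 2                          ≡⟨ cong (λ x → (+ l ℤ.+ x) ℤ.* + 2) (ℤ.pos-* n 5) ⟩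
      (+ l ℤ.+ + n ℤ.* + 5) ℤ.* + 2                        ≈⟨ mod (+ 2 ℤ.* + n) (identity₂ (+ l) (+ n)) ⟩
      + 2 ℤ.* + l                                          ∎
      where
      identity₁ : ∀ x y → x ≡ (y ℤ.* + 5 ℤ.+ x) ℤ.+ (ℤ.- y) ℤ.* + 5
      identity₁ = solve-∀
      identity₂ : ∀ l n → (l ℤ.+ n ℤ.* + 5) ℤ.* + 2 ≡ + 2 ℤ.* l ℤ.+ + 2 ℤ.* n ℤ.* + 5
      identity₂ = solve-∀

-- On the exponents ≡ 1 modulo 3 one has s = c + 3j - 1, and then c ↦ -c-j preserves the
-- exponent and negates the weight 6s + 1 modulo 5.
B-vanishes-3 : ∀ n → B (suc (n * 3)) ≈ 0ℤ
B-vanishes-3 n = begin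
  B m                                       ≈⟨ coefficient B-theta m ⟩
  total E                                   ≈⟨ total-reindex E ψ ψ-injective ψ-preimage ⟩
  total (reindex E ψ ψ-injective ψ-preimage) ≈⟨ total-antisymmetric (reindex E ψ ψ-injective ψ-preimage) σ σ-involutive antisymmetric ⟩
  0ℤ                                        ∎
  where
  open ≈-Reasoning
  m = suc (n * 3)
  F : ℤ × ℤ → ℤ
  F p = wB p ℤ.* X (eB p) m
  E : Enumeration F
  E = enumerate B-theta m wB

  ψ : ℤ × ℤ → ℤ × ℤ
  ψ (c , j) = c , c ℤ.+ + 3 ℤ.* j ℤ.- 1ℤ

  ψ-injective : ∀ {p q} → ψ p ≡ ψ q → p ≡ q
  ψ-injective {c , j} {c′ , j′} eq = cong₂ _,_ (cong proj₁ eq)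
    (ℤ.*-cancelʳ-≡ j j′ (+ 3) (trans (identity c j) (trans (cong (λ (c , s) → s ℤ.- c ℤ.+ 1ℤ) eq) (sym (identity c′ j′)))))
    where
    identity : ∀ c j → j ℤ.* + 3 ≡ (c ℤ.+ + 3 ℤ.* j ℤ.- 1ℤ) ℤ.- c ℤ.+ 1ℤ
    identity = solve-∀

  ψ-preimage : ∀ p → F p ≈ 0ℤ ⊎ ∃ λ q → ψ q ≡ p
  ψ-preimage p@(c , s) with X-support (eB p) m
  ... | inj₁ X≡0 = inj₁ (≈-reflexive (trans (cong (wB p ℤ.*_) X≡0) (ℤ.*-zeroʳ (wB p))))
  ... | inj₂ e≡m = inj₂ ((c , j) , cong (c ,_) s≡)
    where
    N = + n
    -- Solving 15c² + 5c + 3s² + s = 2(3n+1) for the linear s gives s - c + 1 as 3 times this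
    -- expression.
    j = 1ℤ ℤ.+ + 2 ℤ.* N ℤ.- + 5 ℤ.* c ℤ.* c ℤ.- + 2 ℤ.* c ℤ.- s ℤ.* s
    form : pent₂ c ℤ.* + 5 ℤ.+ pent₂ s ≡ (1ℤ ℤ.+ N ℤ.* + 3) ℤ.* + 2
    form = trans (sym (eB-double c s)) (trans (cong (λ e → + e ℤ.* + 2) e≡m)
      (cong (λ x → (1ℤ ℤ.+ x) ℤ.* + 2) (ℤ.pos-* n 3)))
    s≡ : c ℤ.+ + 3 ℤ.* j ℤ.- 1ℤ ≡ s
    s≡ = trans (identity₁ c s N)
      (trans (cong (λ x → x ℤ.- (+ 15 ℤ.* c ℤ.* c ℤ.+ + 5 ℤ.* c ℤ.+ + 3 ℤ.* s ℤ.* s)) (sym form)) (identity₂ c s))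
      where
      identity₁ : ∀ c s N → c ℤ.+ + 3 ℤ.* (1ℤ ℤ.+ + 2 ℤ.* N ℤ.- + 5 ℤ.* c ℤ.* c ℤ.- + 2 ℤ.* c ℤ.- s ℤ.* s) ℤ.- 1ℤ ≡
        (1ℤ ℤ.+ N ℤ.* + 3) ℤ.* + 2 ℤ.- (+ 15 ℤ.* c ℤ.* c ℤ.+ + 5 ℤ.* c ℤ.+ + 3 ℤ.* s ℤ.* s)
      identity₁ = solve-∀
      identity₂ : ∀ c s → (c ℤ.* (+ 3 ℤ.* c ℤ.+ 1ℤ) ℤ.* + 5 ℤ.+ s ℤ.* (+ 3 ℤ.* s ℤ.+ 1ℤ)) ℤ.-
        (+ 15 ℤ.* c ℤ.* c ℤ.+ + 5 ℤ.* c ℤ.+ + 3 ℤ.* s ℤ.* s) ≡ s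
      identity₂ = solve-∀

  -- With u = 6s+1 and w = 6c+1 this sends u + w√-5 to the conjugate of (2 + √-5)(u + w√-5)/3. The
  -- multiplier has norm 1, and 2/3 ≡ -1 modulo 5 explains the change of sign of u.
  σ : ℤ × ℤ → ℤ × ℤ
  σ (c , j) = ℤ.- c ℤ.- j , j

  σ-involutive : ∀ p → σ (σ p) ≡ p
  σ-involutive (c , j) = cong (_, j) (identity c j)
    where
    identity : ∀ c j → ℤ.- (ℤ.- c ℤ.- j) ℤ.- j ≡ c
    identity = solve-∀

  eB-σ : ∀ p → eB (ψ (σ p)) ≡ eB (ψ p)
  eB-σ (c , j) = double-injective (trans
    (eB-double (ℤ.- c ℤ.- j) (ℤ.- c ℤ.- j ℤ.+ + 3 ℤ.* j ℤ.- 1ℤ))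
    (trans (identity c j) (sym (eB-double c (c ℤ.+ + 3 ℤ.* j ℤ.- 1ℤ)))))
    where
    identity : ∀ c j → let c′ = ℤ.- c ℤ.- j ; s = c ℤ.+ + 3 ℤ.* j ℤ.- 1ℤ ; s′ = c′ ℤ.+ + 3 ℤ.* j ℤ.- 1ℤ in
      c′ ℤ.* (+ 3 ℤ.* c′ ℤ.+ 1ℤ) ℤ.* + 5 ℤ.+ s′ ℤ.* (+ 3 ℤ.* s′ ℤ.+ 1ℤ) ≡
      c ℤ.* (+ 3 ℤ.* c ℤ.+ 1ℤ) ℤ.* + 5 ℤ.+ s ℤ.* (+ 3 ℤ.* s ℤ.+ 1ℤ)
    identity = solve-∀

  sign-ψ : ∀ c j → sgnℤ c ℤ.* sgnℤ (c ℤ.+ + 3 ℤ.* j ℤ.- 1ℤ) ≡ ℤ.- sgnℤ j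
  sign-ψ c j = trans (sym (sgnℤ-+ c _)) (sgnℤ-odd j (c ℤ.+ j ℤ.- 1ℤ) (identity c j))
    where
    identity : ∀ c j → c ℤ.+ (c ℤ.+ + 3 ℤ.* j ℤ.- 1ℤ) ≡ j ℤ.+ ((c ℤ.+ j ℤ.- 1ℤ) ℤ.+ (c ℤ.+ j ℤ.- 1ℤ)) ℤ.+ 1ℤ
    identity = solve-∀

  wB-ψ : ∀ c j → wB (ψ (c , j)) ≡ ℤ.- sgnℤ j ℤ.* wA (c ℤ.+ + 3 ℤ.* j ℤ.- 1ℤ)
  wB-ψ c j = trans (sym (ℤ.*-assoc (sgnℤ c) _ _)) (cong (ℤ._* wA (c ℤ.+ + 3 ℤ.* j ℤ.- 1ℤ)) (sign-ψ c j))

  antisymmetric : ∀ p → F (ψ (σ p)) ≈ ℤ.- F (ψ p)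
  antisymmetric p@(c , j) = begin
    wB (ψ (σ p)) ℤ.* X (eB (ψ (σ p))) m
      ≡⟨ cong₂ (λ w e → w ℤ.* X e m) (wB-ψ (ℤ.- c ℤ.- j) j) (eB-σ p) ⟩
    ℤ.- sgnℤ j ℤ.* wA (ℤ.- c ℤ.- j ℤ.+ + 3 ℤ.* j ℤ.- 1ℤ) ℤ.* x
      -- The two weights 6s + 1 add up to 30j - 10 = 5(6j - 2).
      ≈⟨ mod (ℤ.- sgnℤ j ℤ.* x ℤ.* (+ 6 ℤ.* j ℤ.- + 2)) (identity (sgnℤ j) c j x) ⟩
    ℤ.- (ℤ.- sgnℤ j ℤ.* wA (c ℤ.+ + 3 ℤ.* j ℤ.- 1ℤ) ℤ.* x)
      ≡⟨ cong (λ w → ℤ.- (w ℤ.* x)) (wB-ψ c j) ⟨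
    ℤ.- F (ψ p) ∎
    where
    x = X (eB (ψ p)) m
    identity : ∀ t c j x →
      ℤ.- t ℤ.* (+ 6 ℤ.* (ℤ.- c ℤ.- j ℤ.+ + 3 ℤ.* j ℤ.- 1ℤ) ℤ.+ 1ℤ) ℤ.* x ≡
      ℤ.- (ℤ.- t ℤ.* (+ 6 ℤ.* (c ℤ.+ + 3 ℤ.* j ℤ.- 1ℤ) ℤ.+ 1ℤ) ℤ.* x) ℤ.+
      ℤ.- t ℤ.* x ℤ.* (+ 6 ℤ.* j ℤ.- + 2) ℤ.* + 5
    identity = solve-∀

divides-section : ∀ {k} m → k ≡ suc (m * 5) → B m ≈ 0ℤ → + 5 ∣ p₃₃ k
divides-section m refl Bm≈0 = ≈0⇒∣ (≈-trans (p₃₃-section m) (*-cong (≈-refl {+ 3}) Bm≈0))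

-- All four progressions lie in the class 5m + 1; they are m = 3n + 1 and m = 5n + 1, 5n + 3, 5n +
-- 4.
theorem1p2 : (n : ℕ) →
    (+ 5 ∣ p₃₃ (15 * n + 6)) ×
    (+ 5 ∣ p₃₃ (25 * n + 6)) ×
    (+ 5 ∣ p₃₃ (25 * n + 16)) ×
    (+ 5 ∣ p₃₃ (25 * n + 21))
theorem1p2 n =
    divides-section (1 + n * 3)
      (solve 1 (λ n → con 15 :* n :+ con 6 := con 1 :+ (con 1 :+ n :* con 3) :* con 5) refl n) (B-vanishes-3 n)
  , divides-section (1 + n * 5)
      (solve 1 (λ n → con 25 :* n :+ con 6 := con 1 :+ (con 1 :+ n :* con 5) :* con 5) refl n) (B-vanishes-5 Fin.zero n)
  , divides-section (3 + n * 5)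
      (solve 1 (λ n → con 25 :* n :+ con 16 := con 1 :+ (con 3 :+ n :* con 5) :* con 5) refl n) (B-vanishes-5 (Fin.suc Fin.zero) n)
  , divides-section (4 + n * 5)
      (solve 1 (λ n → con 25 :* n :+ con 21 := con 1 :+ (con 4 :+ n :* con 5) :* con 5) refl n) (B-vanishes-5 (Fin.suc (Fin.suc Fin.zero)) n)
  where open Nat
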